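{- The family $\{\bar H_\mu(\mathbf{x};q,t)\}_\mu$, indexed by all partitions $\mu$, of fully colored Macdonald polynomials is a linear basis of the algebra $\Lambda$ of symmetric functions over $\mathbb{Q}(q,t)$.
   Context: Diagrams: a partition $\lambda$ is identified with $\{(i,j):1\le j\le\ell(\lambda),1\le i\le\lambda_j\}$ (French convention, $i$ column, $j$ row); $\lambda^t$ is the conjugate; leg length of $(i,j)$ is $\lambda^t_i-j$. $\mu\oplus\nu=(\mu_1+\nu_1,\mu_2+\nu_2,\dots)$, $\lambda^B=\bigoplus_{b\in B}\lambda^b$. For a filling $\sigma:\lambda\to\mathbb{Z}_{>0}$: descents are boxes $(i,j+1)$ with $\sigma((i,j+1))>\sigma((i,j))$, $\mathrm{maj}(\sigma)=\sum_{\text{descents}}(\text{leg}+1)$; an inversion pair is a pair $(\square_1,\square_2)$ in one row, $\square_1$ strictly left of $\square_2$, such that with $\square_3$ directly below $\square_1$: $\sigma(\square_1)\le\sigma(\square_3)<\sigma(\square_2)$ or $\sigma(\square_3)<\sigma(\square_2)<\sigma(\square_1)$ or $\sigma(\square_2)<\sigma(\square_1)\le\sigma(\square_3)$ (in row 1, $\sigma(\square_3)$ is smaller than all entries); $\mathrm{inv}(\sigma)$ is their number. Modified Macdonald polynomials: $\tilde H_\lambda=\sum_{\sigma:\lambda\to\mathbb{Z}_{>0}}q^{\mathrm{inv}(\sigma)}t^{\mathrm{maj}(\sigma)}\prod_\square x_{\sigma(\square)}$. Macdonald cumulant of partitions $\lambda^1,\dots,\lambda^r$: $\kappa(\lambda^1,\dots,\lambda^r)=(q-1)^{1-r}\sum_{\pi}(-1)^{\#\pi-1}(\#\pi-1)!\prod_{B\in\pi}\tilde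 H_{\lambda^B}$, over set partitions $\pi$ of $[r]$. For a partition $\mu$, the fully colored Macdonald polynomial is $\bar H_\mu(\mathbf{x};q,t)=\kappa(1^{\mu^t_1},1^{\mu^t_2},\dots,1^{\mu^t_{\mu_1}})$, where $1^k$ denotes the one-column partition $(1,\dots,1)$ with $k$ parts. -}

module Defs where

open import Data.Nat as ℕ using (ℕ; zero; suc; _∸_; _≡ᵇ_; _<ᵇ_; _≤ᵇ_; _!)
open import Data.Integer as ℤ using (ℤ; +_; -[1+_])
open import Data.Bool using (Bool; true; false; if_then_else_; _∧_; _∨_)
open import Data.List using (List; []; _∷_; _++_; map; concatMap; concat; foldr; length; filterᵇ; replicate; upTo; zipWith)
open import Data.Nat.ListAction using (sum)
open import Data.List.Relation.Unary.All using (All)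
open import Data.List.Relation.Unary.Linked using (Linked)
open import Data.List.Relation.Binary.Permutation.Propositional using (_↭_)
open import Data.Product using (_×_; _,_; proj₁; proj₂; ∃)
open import Relation.Binary.PropositionalEquality using (_≡_)
open import Relation.Nullary using (¬_)

-- ℤ[q,t]: finite formal sums of terms c·q^a·t^b (c , a , b)

Pqt : Set
Pqt = List (ℤ × ℕ × ℕ)

coeffP : Pqt → ℕ → ℕ → ℤ
coeffP [] a b = + 0
coeffP ((c , i , j) ∷ p) a b =
  (if (i ≡ᵇ a) ∧ (j ≡ᵇ b) then c else + 0) ℤ.+ coeffP p a b

_≈P_ : Pqt → Pqt → Set
p ≈P r = ∀ a b → coeffP p a b ≡ coeffP r a b

_+P_ : Pqt → Pqt → Pqt
p +P r = p ++ r

_*P_ : Pqt → Pqt → Pqt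
p *P r = concatMap (λ { (c , a , b) →
           map (λ { (d , a' , b') → (c ℤ.* d , a ℕ.+ a' , b ℕ.+ b') }) r }) p

constP : ℤ → Pqt
constP c = (c , 0 , 0) ∷ []

qt^ : ℕ → ℕ → Pqt
qt^ a b = (+ 1 , a , b) ∷ []

powP : Pqt → ℕ → Pqt
powP p zero = constP (+ 1)
powP p (suc n) = p *P powP p n

qMinus1 : Pqt
qMinus1 = (+ 1 , 1 , 0) ∷ (-[1+ 0 ] , 0 , 0) ∷ []

-- ℚ(q,t) = field of fractions of ℤ[q,t] (= Frac ℚ[q,t])

record QT : Set where
  constructor _/_
  field
    num : Pqt
    den : Pqt
open QT public

_≈Q_ : QT → QT → Set
x ≈Q y = (num x *P den y) ≈P (num y *P den x)

ValidQ : QT → Set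
ValidQ x = ¬ (den x ≈P [])

fromP : Pqt → QT
fromP p = p / constP (+ 1)

0Q : QT
0Q = fromP []

1Q : QT
1Q = fromP (constP (+ 1))

_+Q_ : QT → QT → QT
x +Q y = ((num x *P den y) +P (num y *P den x)) / (den x *P den y)

_*Q_ : QT → QT → QT
x *Q y = (num x *P num y) / (den x *P den y)

sumQ : List QT → QT
sumQ = foldr _+Q_ 0Q

-- Formal power series in x₁,x₂,… over ℚ(q,t), given by coefficients:
-- F α = coefficient of x₁^α₁ x₂^α₂ ⋯ x_k^α_k  (α = α₁ ∷ … ∷ α_k ∷ [])

Ser : Set
Ser = List ℕ → QT

_≈S_ : Ser → Ser → Set
F ≈S G = ∀ α → F α ≈Q G α

0S : Ser
0S _ = 0Q

allZero : List ℕ → Bool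
allZero [] = true
allZero (a ∷ α) = (a ≡ᵇ 0) ∧ allZero α

1S : Ser
1S α = if allZero α then 1Q else 0Q

_+S_ : Ser → Ser → Ser
(F +S G) α = F α +Q G α

_·S_ : QT → Ser → Ser
(c ·S F) α = c *Q F α

below : List ℕ → List (List ℕ)
below [] = [] ∷ []
below (a ∷ α) = concatMap (λ b → map (b ∷_) (below α)) (upTo (suc a))

_*S_ : Ser → Ser → Ser
(F *S G) α = sumQ (map (λ β → F β *Q G (zipWith _∸_ α β)) (below α))

sumS : List Ser → Ser
sumS = foldr _+S_ 0S

prodS : List Ser → Ser
prodS = foldr _*S_ 1S

IsPartition : List ℕ → Set
IsPartition la = All (λ k → 1 ℕ.≤ k) la × Linked ℕ._≥_ la

oneTo : ℕ → List ℕ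
oneTo n = map suc (upTo n)

-- 1-based lookup with default (index 0 or out of range gives the default)
nth1 : {A : Set} → A → List A → ℕ → A
nth1 d xs zero = d
nth1 d [] (suc k) = d
nth1 d (x ∷ xs) (suc zero) = x
nth1 d (x ∷ xs) (suc (suc k)) = nth1 d xs (suc k)

conjAt : List ℕ → ℕ → ℕ
conjAt la i = length (filterᵇ (λ k → i ≤ᵇ k) la)

conjugate : List ℕ → List ℕ
conjugate la = map (conjAt la) (oneTo (nth1 0 la 1))

_⊕_ : List ℕ → List ℕ → List ℕ
[] ⊕ ys = ys
(x ∷ xs) ⊕ [] = x ∷ xs
(x ∷ xs) ⊕ (y ∷ ys) = (x ℕ.+ y) ∷ (xs ⊕ ys)

⊕all : List (List ℕ) → List ℕ
⊕all = foldr _⊕_ []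

col : ℕ → List ℕ
col k = replicate k 1

-- Fillings σ : λ → ℤ_{>0}, stored row by row: row j (1-based, bottom
-- row = 1) is the list σ(1,j), …, σ(λ_j,j).

Filling : Set
Filling = List (List ℕ)

-- σ((i,j)), 0 outside the diagram (in particular in row 0)
val : Filling → ℕ → ℕ → ℕ
val σ i j = nth1 0 (nth1 [] σ j) i

ind : Bool → ℕ
ind b = if b then 1 else 0

sumOver : List ℕ → (ℕ → ℕ) → ℕ
sumOver xs f = sum (map f xs)

-- maj: descents (i,j+1) with σ(i,j+1) > σ(i,j); weight leg+1 = λ^t_i - j
majF : List ℕ → Filling → ℕ
majF la σ =
  sumOver (oneTo (length la ∸ 1)) λ j →
  sumOver (oneTo (nth1 0 la (suc j))) λ i →
    if val σ i j <ᵇ val σ i (suc j) then conjAt la i ∸ j else 0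

invCond : ℕ → ℕ → ℕ → Bool
invCond s1 s2 s3 =
  ((s1 ≤ᵇ s3) ∧ (s3 <ᵇ s2)) ∨ ((s3 <ᵇ s2) ∧ (s2 <ᵇ s1)) ∨ ((s2 <ᵇ s1) ∧ (s1 ≤ᵇ s3))

-- inv: pairs □₁=(i1,j), □₂=(i2,j), i1<i2, □₃=(i1,j-1); in row 1
-- σ(□₃)=0 is smaller than all (positive) entries
invF : List ℕ → Filling → ℕ
invF la σ =
  sumOver (oneTo (length la)) λ j →
  sumOver (oneTo (nth1 0 la j)) λ i2 →
  sumOver (oneTo (i2 ∸ 1)) λ i1 →
    ind (invCond (val σ i1 j) (val σ i2 j) (val σ i1 (j ∸ 1)))

words : ℕ → ℕ → List (List ℕ)
words zero n = [] ∷ []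
words (suc l) n = concatMap (λ x → map (x ∷_) (words l n)) (oneTo n)

fillings : List ℕ → ℕ → List Filling
fillings [] n = [] ∷ []
fillings (r ∷ la) n = concatMap (λ w → map (w ∷_) (fillings la n)) (words r n)

content : ℕ → Filling → List ℕ
content n σ = map (λ k → length (filterᵇ (λ x → x ≡ᵇ k) (concat σ))) (oneTo n)

eqListᵇ : List ℕ → List ℕ → Bool
eqListᵇ [] [] = true
eqListᵇ [] (_ ∷ _) = false
eqListᵇ (_ ∷ _) [] = false
eqListᵇ (x ∷ xs) (y ∷ ys) = (x ≡ᵇ y) ∧ eqListᵇ xs ys

-- modified Macdonald polynomial H̃_λ: coefficient of x^α is the sum of
-- q^inv t^maj over the fillings σ with ∏ x_{σ(□)} = x^α
Htilde : List ℕ → Ser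
Htilde la α =
  sumQ (map (λ σ → fromP (qt^ (invF la σ) (majF la σ)))
            (filterᵇ (λ σ → eqListᵇ (content (length α) σ) α)
                     (fillings la (length α))))

-- Set partitions of a list (positions regarded as distinct elements)

insertEach : {A : Set} → A → List (List A) → List (List (List A))
insertEach x [] = []
insertEach x (B ∷ π) = ((x ∷ B) ∷ π) ∷ map (B ∷_) (insertEach x π)

setPartitions : {A : Set} → List A → List (List (List A))
setPartitions [] = [] ∷ []
setPartitions (x ∷ xs) =
  concatMap (λ π → ((x ∷ []) ∷ π) ∷ insertEach x π) (setPartitions xs)

cumCoef : ℕ → QT
cumCoef k = fromP (constP ((-[1+ 0 ] ℤ.^ (k ∸ 1)) ℤ.* (+ ((k ∸ 1) !))))

cumulant : List (List ℕ) → Ser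
cumulant Ls =
  (constP (+ 1) / powP qMinus1 (length Ls ∸ 1)) ·S
  sumS (map (λ π → cumCoef (length π) ·S prodS (map (λ B → Htilde (⊕all B)) π))
            (setPartitions Ls))

Hbar : List ℕ → Ser
Hbar μ = cumulant (map col (conjugate μ))

InΛ : Ser → Set
InΛ f =
  (∀ α → ValidQ (f α)) ×
  (∀ α → f α ≈Q f (α ++ 0 ∷ [])) ×          -- x^α does not depend on trailing zero exponents
  (∀ α β → α ↭ β → f α ≈Q f β) ×
  (∃ λ d → ∀ α → d ℕ.< sum α → f α ≈Q 0Q)

LinComb : Set
LinComb = List (QT × List ℕ)

evalLC : LinComb → Ser
evalLC [] = 0S
evalLC ((c , μ) ∷ L) = (c ·S Hbar μ) +S evalLC L

module Submission where

{- Symmetry.  Up to a power of q depending only on the shape, the weight q^inv t^maj of a filling is a product over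
   pairs of cells.  Fixing all letters other than a and a + 1 leaves a sum over 0-1 labellings of cells in reading
   order, in which each cell interacts with an interval of the cells after it.  If k is the last cell that interacts
   with the first cell v, then v and k contribute a multiple of the sum without that interaction, plus the labellings
   with v = 1, k = 0; in the latter every cell in between contributes exactly one inversion, so v and k can be deleted.
   By induction the sum is symmetric in the numbers of zeros and ones.

   Basis.  In K_μ = (q - 1)^(r - 1) H̄_μ the largest power of q, q^N with N = Σ C(μ_j, 2), comes from H̃_μ only, since
   the other set partitions have strictly smaller degree.  Its coefficient counts the fillings in which every pair of
   cells in a row is an inversion.  The rows of such a filling have distinct entries, so the sum of its entries is at
   least w(μ) = Σ C(μ_j + 1, 2), with equality only for the filling with rows μ_j, …, 2, 1, whose content is μᵗ.  Hence
   the matrix of top coefficients at the exponents μᵗ is triangular with respect to w, and the K_μ are independent.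
   Elimination over the partitions of size at most d then shows that they span. -}

open import Defs
open import Level using (0ℓ)
open import Algebra.Bundles using (CommutativeRing)
open import Data.Bool using (Bool; true; false; if_then_else_; _∧_; not)
import Data.Bool.Properties as 𝔹ₚ
open import Data.Empty using (⊥; ⊥-elim)
open import Data.Integer as ℤ using (ℤ; -[1+_])
import Data.Integer.Properties as ℤₚ
import Data.Integer.Tactic.RingSolver as ℤS
open import Data.List using (List; []; _∷_; _++_; map; foldr; length; concat; concatMap; filterᵇ; zip; zipWith; replicate; upTo; applyUpTo; filter; deduplicate)
import Data.List.Properties as Lₚ
open import Data.List.Membership.Propositional using (_∈_)
import Data.List.Membership.Propositional.Properties as ∈ₚ
open import Data.List.Relation.Binary.Permutation.Propositional as Perm using (_↭_; ↭-sym; ↭-trans)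
import Data.List.Relation.Binary.Permutation.Propositional.Properties as Permₚ
open import Data.List.Relation.Unary.All as All using (All; []; _∷_)
import Data.List.Relation.Unary.All.Properties as Allₚ
open import Data.List.Relation.Unary.AllPairs as AllPairs using (AllPairs; []; _∷_)
import Data.List.Relation.Unary.AllPairs.Properties as AllPairsₚ
open import Data.List.Relation.Unary.Any as Any using (Any; here; there)
import Data.List.Relation.Unary.Any.Properties as Anyₚ
open import Data.List.Relation.Unary.Linked as Linked using (Linked)
open import Data.List.Relation.Unary.Linked.Properties using (AllPairs⇒Linked; Linked⇒AllPairs)
open import Data.List.Relation.Unary.Unique.Propositional using (Unique)
import Data.List.Relation.Unary.Unique.DecPropositional.Properties as DecUniqueₚ
import Data.List.Relation.Unary.Unique.Propositional.Properties as Uniqueₚ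
open import Data.List.Reverse using (Reverse; reverseView; _∶_∶ʳ_)
open import Data.Maybe using (Maybe; just; nothing)
open import Data.Nat as ℕ using (ℕ; zero; suc; _≡ᵇ_; _<ᵇ_; _≤ᵇ_; _∸_; _≤_; _<_; _>_; _≥_; z≤n; s≤s; _⊔_; _!)
import Data.Nat.Properties as ℕₚ
open import Data.Nat.ListAction using (sum)
open import Data.Nat.ListAction.Properties using (sum-↭; sum-++)
open import Data.Nat.Solver using (module +-*-Solver)
open import Data.Product using (_×_; _,_; proj₁; proj₂; Σ)
open import Data.Sum using (_⊎_; inj₁; inj₂; [_,_]′)
open import Data.Unit using (⊤; tt)
open import Function using (_∘_; id; flip)
open import Relation.Binary.Definitions using (tri<; tri≈; tri>)
open import Relation.Binary.PropositionalEquality as ≡ using (_≡_; _≢_; cong; cong₂; subst)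
open import Relation.Nullary using (¬_; Dec; yes; no)
open import Relation.Nullary.Decidable using (_×-dec_)

-- `inv` counts triples of cells, so it has no evident form as a product over pairs. For two cells
-- of a row and the cell below the left one, consider the conditions right < left, below < right,
-- left ≤ below. They are cyclic, so one or two of them hold, and two exactly for an inversion.
-- Counting all these conditions therefore counts inversions, up to the number of triples, which
-- depends on the shape only.
--
-- Deleting v and k requires that every cell between two interacting cells is attacked by the first
-- and attacks the second. The same property forces a pair with other than inversion weights, namely
-- a cell and the one directly below it, to be the last interaction of its cell, so the weights
-- t^(leg + 1) and q^arm do no harm.
--
-- Spanning needs no further combinatorics: partitions index both the polynomials and the orbits of
-- exponents, so the elimination is a square system. All this takes place in ℤ[q,t], where nonzero
-- factors can be cancelled; fractions enter only to have their denominators cleared.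

<ᵇ-yes : ∀ {m n} → m < n → (m <ᵇ n) ≡ true
<ᵇ-yes {zero} (s≤s l) = ≡.refl
<ᵇ-yes {suc m} (s≤s l) = <ᵇ-yes l

<ᵇ-no : ∀ {m n} → n ≤ m → (m <ᵇ n) ≡ false
<ᵇ-no z≤n = ≡.refl
<ᵇ-no (s≤s l) = <ᵇ-no l

≡ᵇ-yes : ∀ n → (n ≡ᵇ n) ≡ true
≡ᵇ-yes zero = ≡.refl
≡ᵇ-yes (suc n) = ≡ᵇ-yes n

≡ᵇ-≢ : ∀ {m n} → ¬ m ≡ n → (m ≡ᵇ n) ≡ false
≡ᵇ-≢ {zero} {zero} h = ⊥-elim (h ≡.refl)
≡ᵇ-≢ {zero} {suc n} h = ≡.refl
≡ᵇ-≢ {suc m} {zero} h = ≡.refl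
≡ᵇ-≢ {suc m} {suc n} h = ≡ᵇ-≢ {m} {n} (h ∘ cong suc)

-- Finite sums and rearrangement identities in a commutative ring

module RingSums (R : CommutativeRing 0ℓ 0ℓ) where
  open CommutativeRing R renaming (Carrier to C)
  open import Relation.Binary.Reasoning.Setoid setoid

  module Ids where
    open import Algebra.Solver.Ring.NaturalCoefficients.Default commutativeSemiring
      using (solve; _:=_; _:+_; _:*_)
    +-mid : ∀ a b c d → (((a + b) + (c + d))) ≈ (((a + c) + (b + d)))
    +-mid = solve 4 (λ a b c d → (((a :+ b) :+ (c :+ d))) := (((a :+ c) :+ (b :+ d)))) refl
    shuffle : ∀ a b c d → (((a * b) * (c * d))) ≈ (((a * c) * (b * d)))
    shuffle = solve 4 (λ a b c d → (((a :* b) :* (c :* d))) := (((a :* c) :* (b :* d)))) refl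
    W-cons : ∀ a b s x t → (((a * b) * (s * (x * t)))) ≈ (((a * s) * ((b * x) * t)))
    W-cons = solve 5 (λ a b s x t → (((a :* b) :* (s :* (x :* t)))) := (((a :* s) :* ((b :* x) :* t)))) refl
    delete : ∀ r s k x l t → ((r * (s * ((k * x) * (l * t))))) ≈ ((((r * k) * l) * (s * (x * t))))
    delete = solve 6 (λ r s k x l t → ((r :* (s :* ((k :* x) :* (l :* t))))) := ((((r :* k) :* l) :* (s :* (x :* t))))) refl
    split' : ∀ l p x y ez → ((((l * p) * x) + ((p * y) + ez))) ≈ (((p * ((l * x) + y)) + ez))
    split' = solve 5 (λ l p x y ez → ((((l :* p) :* x) :+ ((p :* y) :+ ez))) := (((p :* ((l :* x) :+ y)) :+ ez))) refl
    move : ∀ p r w → (p * (r * w)) ≈ (r * (p * w))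
    move = solve 3 (λ p r w → (p :* (r :* w)) := (r :* (p :* w))) refl
    factor₁ : ∀ r p w → (((r * p) * w)) ≈ ((p * (r * w)))
    factor₁ = solve 3 (λ r p w → (((r :* p) :* w)) := ((p :* (r :* w)))) refl
    factor₂ : ∀ r p e w → (((r * (e + p)) * w)) ≈ (((p * (r * w)) + (e * (r * w))))
    factor₂ = solve 4 (λ r p e w → (((r :* (e :+ p)) :* w)) := (((p :* (r :* w)) :+ (e :* (r :* w))))) refl
    regroup : ∀ p e a b c → (((p * a) + (e * c)) + (p * b)) ≈ (((p * (a + b)) + (e * c)))
    regroup = solve 5 (λ p e a b c → (((p :* a) :+ (e :* c)) :+ (p :* b)) := (((p :* (a :+ b)) :+ (e :* c)))) refl

  +-mid : ∀ a b c d → (a + b) + (c + d) ≈ (a + c) + (b + d)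
  +-mid = Ids.+-mid

  sumL : {A : Set} → List A → (A → C) → C
  sumL [] f = 0#
  sumL (x ∷ xs) f = f x + sumL xs f

  module _ {A : Set} where
    sumL-cong-All : ∀ {xs : List A} {f g : A → C} → All (λ x → f x ≈ g x) xs → sumL xs f ≈ sumL xs g
    sumL-cong-All [] = refl
    sumL-cong-All (h ∷ hs) = +-cong h (sumL-cong-All hs)

    sumL-cong : ∀ (xs : List A) {f g : A → C} → (∀ x → f x ≈ g x) → sumL xs f ≈ sumL xs g
    sumL-cong [] h = refl
    sumL-cong (x ∷ xs) h = +-cong (h x) (sumL-cong xs h)

    sumL-zero-All : ∀ {xs : List A} {f : A → C} → All (λ x → f x ≈ 0#) xs → sumL xs f ≈ 0#
    sumL-zero-All [] = refl
    sumL-zero-All (h ∷ hs) = trans (+-cong h (sumL-zero-All hs)) (+-identityˡ 0#)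

    sumL-zero : ∀ (xs : List A) → sumL xs (λ _ → 0#) ≈ 0#
    sumL-zero xs = sumL-zero-All {xs} (All.universal (λ _ → refl) xs)

    sumL-++ : ∀ (xs ys : List A) (f : A → C) → sumL (xs ++ ys) f ≈ sumL xs f + sumL ys f
    sumL-++ [] ys f = sym (+-identityˡ _)
    sumL-++ (x ∷ xs) ys f = trans (+-congˡ (sumL-++ xs ys f)) (sym (+-assoc _ _ _))

    sumL-add : ∀ (xs : List A) (f g : A → C) → sumL xs (λ x → f x + g x) ≈ sumL xs f + sumL xs g
    sumL-add [] f g = sym (+-identityˡ 0#)
    sumL-add (x ∷ xs) f g = trans (+-congˡ (sumL-add xs f g)) (+-mid _ _ _ _)

    sumL-*ˡ : ∀ c (xs : List A) (f : A → C) → sumL xs (λ x → c * f x) ≈ c * sumL xs f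
    sumL-*ˡ c [] f = sym (zeroʳ c)
    sumL-*ˡ c (x ∷ xs) f = trans (+-congˡ (sumL-*ˡ c xs f)) (sym (distribˡ c _ _))

    sumL-filter : ∀ (b : A → Bool) (xs : List A) (f : A → C) →
      sumL (filterᵇ b xs) f ≈ sumL xs (λ x → if b x then f x else 0#)
    sumL-filter b [] f = refl
    sumL-filter b (x ∷ xs) f with b x
    ... | true = +-congˡ (sumL-filter b xs f)
    ... | false = trans (sumL-filter b xs f) (sym (+-identityˡ _))

    sumL-↭ : ∀ {xs ys : List A} (f : A → C) → xs ↭ ys → sumL xs f ≈ sumL ys f
    sumL-↭ f Perm.refl = refl
    sumL-↭ f (Perm.prep x h) = +-congˡ (sumL-↭ f h)
    sumL-↭ f (Perm.swap {xs = xs} {ys = ys} x y h) = begin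
      f x + (f y + sumL xs f) ≈⟨ sym (+-assoc _ _ _) ⟩
      (f x + f y) + sumL xs f ≈⟨ +-cong (+-comm _ _) (sumL-↭ f h) ⟩
      (f y + f x) + sumL ys f ≈⟨ +-assoc _ _ _ ⟩
      f y + (f x + sumL ys f) ∎
    sumL-↭ f (Perm.trans h k) = trans (sumL-↭ f h) (sumL-↭ f k)

    sumL-pick : ∀ {xs : List A} (f : A → C) {x} → Unique xs → x ∈ xs → (∀ y → y ∈ xs → y ≢ x → f y ≈ 0#) →
      sumL xs f ≈ f x
    sumL-pick f (h ∷ u) (here ≡.refl) z =
      trans (+-congˡ (sumL-zero-All (All.tabulate (λ {y} y∈ → z y (there y∈) (All.lookup h y∈ ∘ ≡.sym))))) (+-identityʳ _)
    sumL-pick f (h ∷ u) (there x∈) z =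
      trans (+-cong (z _ (here ≡.refl) (All.lookup h x∈)) (sumL-pick f u x∈ (λ y y∈ → z y (there y∈)))) (+-identityˡ _)

  sumL-map : ∀ {A B : Set} (h : A → B) xs (f : B → C) → sumL (map h xs) f ≡ sumL xs (f ∘ h)
  sumL-map h [] f = ≡.refl
  sumL-map h (x ∷ xs) f = cong (f (h x) +_) (sumL-map h xs f)

  sumL-concatMap : ∀ {A B : Set} (h : A → List B) xs (f : B → C) →
    sumL (concatMap h xs) f ≈ sumL xs (λ x → sumL (h x) f)
  sumL-concatMap h [] f = refl
  sumL-concatMap h (x ∷ xs) f = trans (sumL-++ (h x) (concatMap h xs) f) (+-congˡ (sumL-concatMap h xs f))

  sumL-swap : ∀ {A B : Set} (xs : List A) (ys : List B) (f : A → B → C) →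
    sumL xs (λ x → sumL ys (f x)) ≈ sumL ys (λ y → sumL xs (λ x → f x y))
  sumL-swap [] ys f = sym (sumL-zero ys)
  sumL-swap (x ∷ xs) ys f = trans (+-congˡ (sumL-swap xs ys f)) (sym (sumL-add ys (f x) _))

-- Symmetry of sums over 0-1 labellings with pairwise weights

data Kind (C : Set) : Set where
  free att : Kind C
  gen : C → C → Kind C

free? : ∀ {C} (k : Kind C) → k ≡ free ⊎ k ≢ free
free? free = inj₁ ≡.refl
free? att = inj₂ (λ ())
free? (gen _ _) = inj₂ (λ ())

-- A filling is an ordered list of labelled cells, and its weight is a product over pairs of cells.
-- The pair u ≺ v contributes according to whether the label of u exceeds that of v:
-- nothing when `free`, a factor q for each inversion when `att`, and p or p' when `gen p p'`.
module LLT (R : CommutativeRing 0ℓ 0ℓ) (V : Set) (_≺_ : V → V → Set)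
           (q : CommutativeRing.Carrier R) (kind : V → V → Kind (CommutativeRing.Carrier R))
           (chain : ∀ {u v w} → u ≺ v → v ≺ w → kind u w ≢ free → kind u v ≡ att × kind v w ≡ att) where
  open CommutativeRing R renaming (Carrier to C)
  open RingSums R
  open import Relation.Binary.Reasoning.Setoid setoid

  wt : Kind C → Bool → C
  wt free _ = 1#
  wt att true = q
  wt att false = 1#
  wt (gen p p') true = p
  wt (gen p p') false = p'

  module Weight (L : Set) (gt : L → L → Bool) where
    row : V → L → List (V × L) → C
    row v x [] = 1#
    row v x ((u , y) ∷ σ) = wt (kind v u) (gt x y) * row v x σ

    W : List (V × L) → C
    W [] = 1#
    W ((v , x) ∷ σ) = row v x σ * W σ

    cross : List (V × L) → List (V × L) → C
    cross [] τ = 1#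
    cross ((v , x) ∷ σ) τ = row v x τ * cross σ τ

    row-++ : ∀ v x σ τ → row v x (σ ++ τ) ≈ row v x σ * row v x τ
    row-++ v x [] τ = sym (*-identityˡ _)
    row-++ v x (_ ∷ σ) τ = trans (*-congˡ (row-++ v x σ τ)) (sym (*-assoc _ _ _))

    W-++ : ∀ σ τ → W (σ ++ τ) ≈ W σ * (cross σ τ * W τ)
    W-++ [] τ = sym (trans (*-identityˡ _) (*-identityˡ _))
    W-++ ((v , x) ∷ σ) τ = trans (*-cong (row-++ v x σ τ) (W-++ σ τ)) (Ids.W-cons _ _ _ _ _)

    column : List (V × L) → V × L → C
    column [] _ = 1#
    column ((u , y) ∷ σ) (k , x) = wt (kind u k) (gt y x) * column σ (k , x)

    cross-∷ : ∀ σ c τ → cross σ (c ∷ τ) ≈ column σ c * cross σ τ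
    cross-∷ [] c τ = sym (*-identityˡ _)
    cross-∷ ((u , y) ∷ σ) c τ = trans (*-congˡ (cross-∷ σ c τ)) (Ids.shuffle _ _ _ _)

    cross-++ : ∀ σ σ' τ → cross (σ ++ σ') τ ≈ cross σ τ * cross σ' τ
    cross-++ [] σ' τ = sym (*-identityˡ _)
    cross-++ ((v , x) ∷ σ) σ' τ = trans (*-congˡ (cross-++ σ σ' τ)) (sym (*-assoc _ _ _))

  gt₂ : Bool → Bool → Bool
  gt₂ b b' = b ∧ not b'

  open Weight Bool gt₂

  S : List V → (List (V × Bool) → C) → C
  S [] F = F []
  S (v ∷ xs) F = S xs (λ σ → F ((v , false) ∷ σ)) + S xs (λ σ → F ((v , true) ∷ σ))

  S-cong : ∀ xs {F G} → (∀ σ → map proj₁ σ ≡ xs → F σ ≈ G σ) → S xs F ≈ S xs G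
  S-cong [] h = h [] ≡.refl
  S-cong (v ∷ xs) h = +-cong (S-cong xs (λ σ e → h _ (cong (v ∷_) e))) (S-cong xs (λ σ e → h _ (cong (v ∷_) e)))

  S-add : ∀ xs F G → S xs (λ σ → F σ + G σ) ≈ S xs F + S xs G
  S-add [] F G = refl
  S-add (v ∷ xs) F G = trans (+-cong (S-add xs _ _) (S-add xs _ _)) (+-mid _ _ _ _)

  S-* : ∀ c xs F → S xs (λ σ → c * F σ) ≈ c * S xs F
  S-* c [] F = refl
  S-* c (v ∷ xs) F = trans (+-cong (S-* c xs _) (S-* c xs _)) (sym (distribˡ c _ _))

  S-++ : ∀ xs ys F → S (xs ++ ys) F ≈ S xs (λ σ → S ys (λ τ → F (σ ++ τ)))
  S-++ [] ys F = refl
  S-++ (v ∷ xs) ys F = +-cong (S-++ xs ys _) (S-++ xs ys _)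

  count₀ count₁ : List (V × Bool) → ℕ
  count₀ [] = 0
  count₀ ((_ , b) ∷ σ) = if b then count₀ σ else suc (count₀ σ)
  count₁ [] = 0
  count₁ ((_ , b) ∷ σ) = if b then suc (count₁ σ) else count₁ σ

  count₀-insert : ∀ σ k τ → count₀ (σ ++ (k , false) ∷ τ) ≡ suc (count₀ (σ ++ τ))
  count₀-insert [] k τ = ≡.refl
  count₀-insert ((_ , true) ∷ σ) k τ = count₀-insert σ k τ
  count₀-insert ((_ , false) ∷ σ) k τ = cong suc (count₀-insert σ k τ)

  count₁-insert : ∀ σ k τ → count₁ (σ ++ (k , false) ∷ τ) ≡ count₁ (σ ++ τ)
  count₁-insert [] k τ = ≡.refl
  count₁-insert ((_ , true) ∷ σ) k τ = cong suc (count₁-insert σ k τ)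
  count₁-insert ((_ , false) ∷ σ) k τ = count₁-insert σ k τ

  -- The observable `g` plays the part of the two variables of a generating function: exchanging its
  -- arguments exchanges the letters 0 and 1.
  Z : List V → (ℕ → ℕ → C) → C
  Z xs g = S xs (λ σ → W σ * g (count₀ σ) (count₁ σ))

  low : V → List V → C
  low v [] = 1#
  low v (u ∷ xs) = wt (kind v u) false * low v xs

  low-++ : ∀ v xs ys → low v (xs ++ ys) ≈ low v xs * low v ys
  low-++ v [] ys = sym (*-identityˡ _)
  low-++ v (u ∷ xs) ys = trans (*-congˡ (low-++ v xs ys)) (sym (*-assoc _ _ _))

  row-false : ∀ v σ xs → map proj₁ σ ≡ xs → row v false σ ≈ low v xs
  row-false v [] .[] ≡.refl = refl
  row-false v ((u , y) ∷ σ) .(_ ∷ _) ≡.refl = *-congˡ (row-false v σ _ ≡.refl)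

  q^ : List V → C
  q^ [] = 1#
  q^ (_ ∷ xs) = q * q^ xs

  between : ∀ v k σ xs → map proj₁ σ ≡ xs → All (λ u → kind v u ≡ att × kind u k ≡ att) xs →
    row v true σ * column σ (k , false) ≈ q^ xs
  between v k [] .[] ≡.refl [] = *-identityˡ 1#
  between v k ((u , b) ∷ σ) .(_ ∷ _) ≡.refl ((e , e') ∷ h) =
    trans (Ids.shuffle _ _ _ _) (*-cong (one b) (between v k σ _ ≡.refl h))
    where
    one : ∀ b → wt (kind v u) (gt₂ true b) * wt (kind u k) (gt₂ b false) ≈ q
    one true rewrite e | e' = *-identityˡ q
    one false rewrite e | e' = *-identityʳ q

  Y : V → List V → List V → (ℕ → ℕ → C) → C
  Y v pre post g = S pre (λ σ → S post (λ τ →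
    row v true σ * (W (σ ++ τ) * g (count₀ (σ ++ τ)) (suc (count₁ (σ ++ τ))))))

  -- The configurations with v ↦ 1, k ↦ 0, when every vertex strictly between is attacked by v and attacks k:
  -- each such vertex then contributes exactly one inversion, whatever its label.
  D : V → V → List V → List V → (ℕ → ℕ → C) → C
  D v k pre post g = S pre (λ σ → S post (λ τ →
    row v true σ * (W (σ ++ (k , false) ∷ τ) * g (count₀ (σ ++ (k , false) ∷ τ)) (suc (count₁ (σ ++ (k , false) ∷ τ))))))

  D-delete : ∀ v k pre post g → All (λ u → kind v u ≡ att × kind u k ≡ att) pre →
    D v k pre post g ≈ (q^ pre * low k post) * Z (pre ++ post) (λ i j → g (suc i) (suc j))
  D-delete v k pre post g h = begin
    D v k pre post g
      ≈⟨ S-cong pre (λ σ eσ → S-cong post (λ τ eτ → pointwise σ τ eσ eτ)) ⟩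
    S pre (λ σ → S post (λ τ → K * F (σ ++ τ)))
      ≈⟨ sym (S-++ pre post (λ ρ → K * F ρ)) ⟩
    S (pre ++ post) (λ ρ → K * F ρ)
      ≈⟨ S-* K (pre ++ post) F ⟩
    K * Z (pre ++ post) (λ i j → g (suc i) (suc j)) ∎
    where
    K = q^ pre * low k post
    F : List (V × Bool) → C
    F ρ = W ρ * g (suc (count₀ ρ)) (suc (count₁ ρ))
    pointwise : ∀ σ τ → map proj₁ σ ≡ pre → map proj₁ τ ≡ post →
      row v true σ * (W (σ ++ (k , false) ∷ τ) * g (count₀ (σ ++ (k , false) ∷ τ)) (suc (count₁ (σ ++ (k , false) ∷ τ)))) ≈ K * F (σ ++ τ)
    pointwise σ τ eσ eτ rewrite count₀-insert σ k τ | count₁-insert σ k τ = begin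
      row v true σ * (W (σ ++ (k , false) ∷ τ) * G)
        ≈⟨ sym (*-assoc _ _ _) ⟩
      (row v true σ * W (σ ++ (k , false) ∷ τ)) * G
        ≈⟨ *-congʳ (*-congˡ (trans (W-++ σ _) (*-congˡ (*-congʳ (cross-∷ σ _ τ))))) ⟩
      (row v true σ * (W σ * ((column σ (k , false) * cross σ τ) * (row k false τ * W τ)))) * G
        ≈⟨ *-congʳ (Ids.delete _ _ _ _ _ _) ⟩
      (((row v true σ * column σ (k , false)) * row k false τ) * (W σ * (cross σ τ * W τ))) * G
        ≈⟨ *-congʳ (*-cong (*-cong (between v k σ pre eσ h) (row-false k τ post eτ)) (sym (W-++ σ τ))) ⟩
      (K * W (σ ++ τ)) * G
        ≈⟨ *-assoc _ _ _ ⟩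
      K * (W (σ ++ τ) * G) ∎
      where G = g (suc (count₀ (σ ++ τ))) (suc (count₁ (σ ++ τ)))

  -- With v labelled 1, the pair of v and k has the factor p' if k is labelled 1 and e + p' if k is
  -- labelled 0. Pulling out p' switches the pair off and leaves an error supported on k = 0.
  Y-snoc : ∀ v k pre post g e → wt (kind v k) true ≈ e + wt (kind v k) false →
    Y v (pre ++ k ∷ []) post g ≈ wt (kind v k) false * Y v pre (k ∷ post) g + e * D v k pre post g
  Y-snoc v k pre post g e he = begin
    Y v (pre ++ k ∷ []) post g
      ≈⟨ S-++ pre (k ∷ []) _ ⟩
    S pre (λ σ → S post (λ τ → F (σ ++ (k , false) ∷ []) τ) + S post (λ τ → F (σ ++ (k , true) ∷ []) τ))
      ≈⟨ S-cong pre (λ σ _ → +-cong (S-cong post (λ τ _ → zero' σ τ)) (S-cong post (λ τ _ → one' σ τ))) ⟩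
    S pre (λ σ → S post (λ τ → p' * H σ ((k , false) ∷ τ) + e * H σ ((k , false) ∷ τ)) + S post (λ τ → p' * H σ ((k , true) ∷ τ)))
      ≈⟨ S-cong pre (λ σ _ → trans (+-cong (trans (S-add post _ _) (+-cong (S-* p' post _) (S-* e post _))) (S-* p' post _)) (Ids.regroup _ _ _ _ _)) ⟩
    S pre (λ σ → p' * S (k ∷ post) (H σ) + e * S post (λ τ → H σ ((k , false) ∷ τ)))
      ≈⟨ trans (S-add pre _ _) (+-cong (S-* p' pre _) (S-* e pre _)) ⟩
    p' * Y v pre (k ∷ post) g + e * D v k pre post g ∎
    where
    p' = wt (kind v k) false
    G : List (V × Bool) → C
    G ρ = W ρ * g (count₀ ρ) (suc (count₁ ρ))
    F : List (V × Bool) → List (V × Bool) → C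
    F σ τ = row v true σ * G (σ ++ τ)
    H : List (V × Bool) → List (V × Bool) → C
    H σ τ = row v true σ * G (σ ++ τ)
    zero' : ∀ σ τ → F (σ ++ (k , false) ∷ []) τ ≈ p' * H σ ((k , false) ∷ τ) + e * H σ ((k , false) ∷ τ)
    zero' σ τ rewrite Lₚ.++-assoc σ ((k , false) ∷ []) τ =
      trans (*-congʳ (trans (row-++ v true σ _) (*-congˡ (trans (*-identityʳ _) he)))) (Ids.factor₂ _ _ _ _)
    one' : ∀ σ τ → F (σ ++ (k , true) ∷ []) τ ≈ p' * H σ ((k , true) ∷ τ)
    one' σ τ rewrite Lₚ.++-assoc σ ((k , true) ∷ []) τ =
      trans (*-congʳ (trans (row-++ v true σ _) (*-congˡ (*-identityʳ _)))) (Ids.factor₁ _ _ _)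

  AllPairs-split : ∀ v pre k post → AllPairs _≺_ (v ∷ pre ++ k ∷ post) →
    v ≺ k × All (λ u → v ≺ u × u ≺ k) pre × AllPairs _≺_ (v ∷ pre ++ post)
  AllPairs-split v [] k post ((vk ∷ h) ∷ (_ ∷ p)) = vk , [] , h ∷ p
  AllPairs-split v (u ∷ pre) k post ((vu ∷ h) ∷ (hu ∷ p))
    with AllPairs-split v pre k post (h ∷ p) | AllPairs-split u pre k post (hu ∷ p)
  ... | vk , a , (h' ∷ p') | uk , _ , (hu' ∷ _) = vk , (vu , uk) ∷ a , (vu ∷ h') ∷ (hu' ∷ p')

  Z-cong : ∀ xs {g g'} → (∀ i j → g i j ≈ g' i j) → Z xs g ≈ Z xs g'
  Z-cong xs h = S-cong xs (λ σ _ → *-congˡ (h _ _))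

  Symmetric : List V → Set
  Symmetric xs = ∀ g → Z xs g ≈ Z xs (flip g)

  module Step (n : ℕ) (ih : ∀ xs → length xs ≤ n → AllPairs _≺_ xs → Symmetric xs) (v : V) where
    -- The sum over all labellings of v, `pre` and `post` in which v interacts with `pre` only. It
    -- leads from the true sum (`post` empty) to a decoupled v (`pre` empty), one cell at a time.
    T' : List V → List V → (ℕ → ℕ → C) → C
    T' pre post g = low v pre * Z (pre ++ post) (λ i j → g (suc i) j) + Y v pre post g

    T-sym : ∀ {pre} → Reverse pre → ∀ post → length (pre ++ post) ≤ n → AllPairs _≺_ (v ∷ pre ++ post) →
      ∀ g → T' pre post g ≈ T' pre post (flip g)
    T-sym Reverse.[] post l (_ ∷ p) g = begin
      1# * Z post g₁ + Y v [] post g ≈⟨ +-cong (*-identityˡ _) (S-cong post (λ τ _ → *-identityˡ _)) ⟩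
      Z post g₁ + Z post g₂ ≈⟨ +-cong (ih post l p g₁) (ih post l p g₂) ⟩
      -- `flip g₁` is the observable that the label 1 at `v` produces from `flip g`, and `flip g₂`
      -- the one that the label 0 produces, so the two summands have changed places.
      Z post (flip g₁) + Z post (flip g₂) ≈⟨ +-comm _ _ ⟩
      Z post (flip g₂) + Z post (flip g₁) ≈⟨ sym (+-cong (*-identityˡ _) (S-cong post (λ τ _ → *-identityˡ _))) ⟩
      1# * Z post (flip g₂) + Y v [] post (flip g) ∎
      where
      g₁ g₂ : ℕ → ℕ → C
      g₁ i j = g (suc i) j
      g₂ i j = g i (suc j)
    T-sym (pre ∶ rv ∶ʳ k) post l p g rewrite Lₚ.++-assoc pre (k ∷ []) post = begin
      T'' g ≈⟨ expand g ⟩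
      p' * T' pre (k ∷ post) g + e * D v k pre post g
        ≈⟨ +-cong (*-congˡ (T-sym rv (k ∷ post) l p g)) (eD-sym (AllPairs-split v pre k post p)) ⟩
      p' * T' pre (k ∷ post) (flip g) + e * D v k pre post (flip g) ≈⟨ sym (expand (flip g)) ⟩
      T'' (flip g) ∎
      where
      p' = wt (kind v k) false
      e = wt (kind v k) true - p'
      T'' : (ℕ → ℕ → C) → C
      T'' g = low v (pre ++ k ∷ []) * Z (pre ++ k ∷ post) (λ i j → g (suc i) j) + Y v (pre ++ k ∷ []) post g
      he : wt (kind v k) true ≈ e + p'
      he = sym (trans (+-assoc _ _ _) (trans (+-congˡ (-‿inverseˡ p')) (+-identityʳ _)))
      expand : ∀ g → T'' g ≈ p' * T' pre (k ∷ post) g + e * D v k pre post g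
      expand g = trans (+-cong (*-congʳ (trans (low-++ v pre (k ∷ [])) (*-congˡ (*-identityʳ _)))) (Y-snoc v k pre post g e he))
                   (Ids.split' _ _ _ _ _)
      eD-sym : v ≺ k × All (λ u → v ≺ u × u ≺ k) pre × AllPairs _≺_ (v ∷ pre ++ post) →
        e * D v k pre post g ≈ e * D v k pre post (flip g)
      eD-sym (_ , btw , (_ ∷ p'')) = [ vanish , nonfree ]′ (free? (kind v k))
        where
        vanish : kind v k ≡ free → e * D v k pre post g ≈ e * D v k pre post (flip g)
        vanish eq = trans (*-congʳ e≈0) (trans (zeroˡ _) (sym (trans (*-congʳ e≈0) (zeroˡ _))))
          where
          e≈0 : e ≈ 0#
          e≈0 rewrite eq = -‿inverseʳ 1#
        shorter : ∀ (pre : List V) → length (pre ++ post) ≤ length (pre ++ k ∷ post)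
        shorter [] = ℕₚ.n≤1+n _
        shorter (_ ∷ pre) = s≤s (shorter pre)
        nonfree : kind v k ≢ free → e * D v k pre post g ≈ e * D v k pre post (flip g)
        nonfree nf = *-congˡ (trans (D-delete v k pre post g hb)
          (trans (*-congˡ (ih (pre ++ post) (ℕₚ.≤-trans (shorter pre) l) p'' (λ i j → g (suc i) (suc j))))
                 (sym (D-delete v k pre post (flip g) hb))))
          where
          hb = All.map (λ { (a , b) → chain a b nf }) btw

  -- The bound `n` makes the induction strong: decoupling v shortens the list by one cell, but the
  -- deletion of v and k shortens it by two.
  two-letter-symmetric : ∀ n xs → length xs ≤ n → AllPairs _≺_ xs → Symmetric xs
  two-letter-symmetric n [] l p g = refl
  two-letter-symmetric (suc n) (v ∷ xs) (s≤s l) p g = begin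
    Z (v ∷ xs) g ≈⟨ expand g ⟩
    T' xs [] g ≈⟨ T-sym (reverseView xs) [] (subst (λ z → length z ≤ n) (≡.sym (Lₚ.++-identityʳ xs)) l)
                    (subst (λ z → AllPairs _≺_ (v ∷ z)) (≡.sym (Lₚ.++-identityʳ xs)) p) g ⟩
    T' xs [] (flip g) ≈⟨ sym (expand (flip g)) ⟩
    Z (v ∷ xs) (flip g) ∎
    where
    open Step n (two-letter-symmetric n) v
    expand : ∀ g → Z (v ∷ xs) g ≈ T' xs [] g
    expand g rewrite Lₚ.++-identityʳ xs = +-cong
      (trans (S-cong xs (λ σ eσ → trans (*-congʳ (*-congʳ (row-false v σ xs eσ))) (*-assoc _ _ _))) (S-* (low v xs) xs _))
      (S-cong xs (λ σ _ → trans (*-assoc _ _ _) (sym (tail σ))))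
      where
      tail : ∀ σ → row v true σ * (W (σ ++ []) * g (count₀ (σ ++ [])) (suc (count₁ (σ ++ []))))
                 ≈ row v true σ * (W σ * g (count₀ σ) (suc (count₁ σ)))
      tail σ rewrite Lₚ.++-identityʳ σ = refl

  -- From two letters to arbitrary fillings

  gtN : ℕ → ℕ → Bool
  gtN x y = y <ᵇ x

  module N = Weight ℕ gtN

  SumAll : List ℕ → List V → (List (V × ℕ) → C) → C
  SumAll ls [] F = F []
  SumAll ls (v ∷ cs) F = sumL ls (λ x → SumAll ls cs (λ σ → F ((v , x) ∷ σ)))

  cnt : List (V × ℕ) → ℕ → ℕ
  cnt [] x = 0
  cnt ((_ , y) ∷ σ) x = if y ≡ᵇ x then suc (cnt σ x) else cnt σ x

  module _ (a : ℕ) where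
    -- A pattern records the letters other than a and a + 1; `nothing` stands for either of these two.
    Pattern : Set
    Pattern = List (V × Maybe ℕ)

    SumPattern : List ℕ → List V → (Pattern → C) → C
    SumPattern os [] H = H []
    SumPattern os (v ∷ cs) H =
      sumL os (λ x → SumPattern os cs (λ τ → H ((v , just x) ∷ τ))) + SumPattern os cs (λ τ → H ((v , nothing) ∷ τ))

    -- The summand receives the filling together with its 0-1 shadow (a as `false`, a + 1 as
    -- `true`), so that the two weights can be compared term by term.
    SumFill : Pattern → (List (V × ℕ) → List (V × Bool) → C) → C
    SumFill [] F = F [] []
    SumFill ((v , just x) ∷ τ) F = SumFill τ (λ σ w → F ((v , x) ∷ σ) w)
    SumFill ((v , nothing) ∷ τ) F =
      SumFill τ (λ σ w → F ((v , a) ∷ σ) ((v , false) ∷ w)) + SumFill τ (λ σ w → F ((v , suc a) ∷ σ) ((v , true) ∷ w))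

    SumPattern-add : ∀ os cs H H' → SumPattern os cs (λ τ → H τ + H' τ) ≈ SumPattern os cs H + SumPattern os cs H'
    SumPattern-add os [] H H' = refl
    SumPattern-add os (v ∷ cs) H H' = trans
      (+-cong (trans (sumL-cong os (λ x → SumPattern-add os cs _ _)) (sumL-add os _ _)) (SumPattern-add os cs _ _))
      (+-mid _ _ _ _)

    SumAll-patterns : ∀ {ls os} → ls ↭ a ∷ suc a ∷ os → ∀ cs F →
      SumAll ls cs F ≈ SumPattern os cs (λ τ → SumFill τ (λ σ _ → F σ))
    SumAll-patterns perm [] F = refl
    SumAll-patterns {ls} {os} perm (v ∷ cs) F = begin
      sumL ls (λ x → SumAll ls cs (F' x)) ≈⟨ sumL-cong ls (λ x → SumAll-patterns perm cs (F' x)) ⟩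
      sumL ls G ≈⟨ sumL-↭ G perm ⟩
      G a + (G (suc a) + sumL os G) ≈⟨ sym (+-assoc _ _ _) ⟩
      (G a + G (suc a)) + sumL os G ≈⟨ +-comm _ _ ⟩
      sumL os G + (G a + G (suc a)) ≈⟨ +-congˡ (sym (SumPattern-add os cs _ _)) ⟩
      SumPattern os (v ∷ cs) (λ τ → SumFill τ (λ σ _ → F σ)) ∎
      where
      F' : ℕ → List (V × ℕ) → C
      F' x σ = F ((v , x) ∷ σ)
      G : ℕ → C
      G x = SumPattern os cs (λ τ → SumFill τ (λ σ _ → F' x σ))

    Other : Maybe ℕ → Set
    Other nothing = ⊤
    Other (just x) = x ≢ a × x ≢ suc a

    SumPattern-cong : ∀ {os} → All (λ x → x ≢ a × x ≢ suc a) os → ∀ cs {H H'} →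
      (∀ τ → map proj₁ τ ≡ cs → All (Other ∘ proj₂) τ → H τ ≈ H' τ) → SumPattern os cs H ≈ SumPattern os cs H'
    SumPattern-cong ok [] h = h [] ≡.refl []
    SumPattern-cong ok (v ∷ cs) h = +-cong
      (sumL-cong-All (All.map (λ {x} o → SumPattern-cong ok cs (λ τ e oks → h _ (cong (v ∷_) e) (o ∷ oks))) ok))
      (SumPattern-cong ok cs (λ τ e oks → h _ (cong (v ∷_) e) (tt ∷ oks)))

    data Fills : Pattern → List (V × ℕ) → List (V × Bool) → Set where
      nil : Fills [] [] []
      other : ∀ {v x τ σ w} → Fills τ σ w → Fills ((v , just x) ∷ τ) ((v , x) ∷ σ) w
      lower : ∀ {v τ σ w} → Fills τ σ w → Fills ((v , nothing) ∷ τ) ((v , a) ∷ σ) ((v , false) ∷ w)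
      upper : ∀ {v τ σ w} → Fills τ σ w → Fills ((v , nothing) ∷ τ) ((v , suc a) ∷ σ) ((v , true) ∷ w)

    SumFill-cong : ∀ τ {F F'} → (∀ σ w → Fills τ σ w → F σ w ≈ F' σ w) → SumFill τ F ≈ SumFill τ F'
    SumFill-cong [] h = h [] [] nil
    SumFill-cong ((v , just x) ∷ τ) h = SumFill-cong τ (λ σ w f → h _ _ (other f))
    SumFill-cong ((v , nothing) ∷ τ) h =
      +-cong (SumFill-cong τ (λ σ w f → h _ _ (lower f))) (SumFill-cong τ (λ σ w f → h _ _ (upper f)))

    holes : Pattern → List V
    holes [] = []
    holes ((v , just x) ∷ τ) = holes τ
    holes ((v , nothing) ∷ τ) = v ∷ holes τ

    SumFill-S : ∀ τ F → SumFill τ (λ _ w → F w) ≈ S (holes τ) F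
    SumFill-S [] F = refl
    SumFill-S ((v , just x) ∷ τ) F = SumFill-S τ F
    SumFill-S ((v , nothing) ∷ τ) F = +-cong (SumFill-S τ _) (SumFill-S τ _)

    letter : Maybe ℕ → ℕ
    letter nothing = a
    letter (just x) = x

    patternRow : V → Maybe ℕ → Pattern → C
    patternRow v m [] = 1#
    patternRow v nothing ((u , nothing) ∷ τ) = patternRow v nothing τ
    patternRow v nothing ((u , just y) ∷ τ) = wt (kind v u) (gtN a y) * patternRow v nothing τ
    patternRow v (just x) ((u , m) ∷ τ) = wt (kind v u) (gtN x (letter m)) * patternRow v (just x) τ

    patternWeight : Pattern → C
    patternWeight [] = 1#
    patternWeight ((v , m) ∷ τ) = patternRow v m τ * patternWeight τ

    -- The letters a and a + 1 are adjacent integers, so no third letter separates them.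
    gtN-up : ∀ {y} → y ≢ a → gtN (suc a) y ≡ gtN a y
    gtN-up {y} y≢a with y ℕ.<? a
    ... | yes y<a = ≡.trans (<ᵇ-yes (ℕₚ.m≤n⇒m≤1+n y<a)) (≡.sym (<ᵇ-yes y<a))
    ... | no y≮a = ≡.trans (<ᵇ-no (ℕₚ.≤∧≢⇒< (ℕₚ.≮⇒≥ y≮a) (y≢a ∘ ≡.sym))) (≡.sym (<ᵇ-no (ℕₚ.≮⇒≥ y≮a)))

    gtN-down : ∀ {x} → x ≢ suc a → gtN x (suc a) ≡ gtN x a
    gtN-down {x} x≢ with a ℕ.<? x
    ... | yes a<x = ≡.trans (<ᵇ-yes (ℕₚ.≤∧≢⇒< a<x (x≢ ∘ ≡.sym))) (≡.sym (<ᵇ-yes a<x))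
    ... | no a≮x = ≡.trans (<ᵇ-no (ℕₚ.m≤n⇒m≤1+n (ℕₚ.≮⇒≥ a≮x))) (≡.sym (<ᵇ-no (ℕₚ.≮⇒≥ a≮x)))

    row-other : ∀ v x {τ σ w} → x ≢ suc a → Fills τ σ w → N.row v x σ ≈ patternRow v (just x) τ
    row-other v x x≢ nil = refl
    row-other v x x≢ (other f) = *-congˡ (row-other v x x≢ f)
    row-other v x x≢ (lower f) = *-congˡ (row-other v x x≢ f)
    row-other v x x≢ (upper {v = u} f) = *-cong (reflexive (cong (wt (kind v u)) (gtN-down x≢))) (row-other v x x≢ f)

    row-lower : ∀ v {τ σ w} → Fills τ σ w → N.row v a σ ≈ patternRow v nothing τ * row v false w
    row-lower v nil = sym (*-identityˡ _)
    row-lower v (other f) = trans (*-congˡ (row-lower v f)) (sym (*-assoc _ _ _))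
    row-lower v (lower {v = u} f) = trans (*-cong (reflexive (cong (wt (kind v u)) (<ᵇ-no (ℕₚ.≤-refl {a})))) (row-lower v f)) (Ids.move _ _ _)
    row-lower v (upper {v = u} f) = trans (*-cong (reflexive (cong (wt (kind v u)) (<ᵇ-no (ℕₚ.n≤1+n a)))) (row-lower v f)) (Ids.move _ _ _)

    row-upper : ∀ v {τ σ w} → All (Other ∘ proj₂) τ → Fills τ σ w → N.row v (suc a) σ ≈ patternRow v nothing τ * row v true w
    row-upper v ok nil = sym (*-identityˡ _)
    row-upper v ((y≢a , _) ∷ ok) (other {v = u} f) =
      trans (*-cong (reflexive (cong (wt (kind v u)) (gtN-up y≢a))) (row-upper v ok f)) (sym (*-assoc _ _ _))
    row-upper v (_ ∷ ok) (lower {v = u} f) =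
      trans (*-cong (reflexive (cong (wt (kind v u)) (<ᵇ-yes (ℕₚ.≤-refl {suc a})))) (row-upper v ok f)) (Ids.move _ _ _)
    row-upper v (_ ∷ ok) (upper {v = u} f) =
      trans (*-cong (reflexive (cong (wt (kind v u)) (<ᵇ-no (ℕₚ.≤-refl {suc a})))) (row-upper v ok f)) (Ids.move _ _ _)

    -- A pair with at least one fixed letter does not see which of a and a + 1 fills a hole. What
    -- remains are the pairs of holes, and there a + 1 exceeds a just as 1 exceeds 0.
    weight-split : ∀ {τ σ w} → All (Other ∘ proj₂) τ → Fills τ σ w → N.W σ ≈ patternWeight τ * W w
    weight-split ok nil = sym (*-identityˡ _)
    weight-split ((_ , x≢) ∷ ok) (other {v = v} {x} f) =
      trans (*-cong (row-other v x x≢ f) (weight-split ok f)) (sym (*-assoc _ _ _))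
    weight-split (_ ∷ ok) (lower {v = v} f) = trans (*-cong (row-lower v f) (weight-split ok f)) (Ids.shuffle _ _ _ _)
    weight-split (_ ∷ ok) (upper {v = v} f) = trans (*-cong (row-upper v ok f) (weight-split ok f)) (Ids.shuffle _ _ _ _)

    patternCount : Pattern → ℕ → ℕ
    patternCount [] x = 0
    patternCount ((_ , nothing) ∷ τ) x = patternCount τ x
    patternCount ((_ , just y) ∷ τ) x = if y ≡ᵇ x then suc (patternCount τ x) else patternCount τ x

    mix : Pattern → ℕ → ℕ → ℕ → ℕ
    mix τ i j x = if x ≡ᵇ a then i else (if x ≡ᵇ suc a then j else patternCount τ x)

    cnt-lower : ∀ {τ σ w} → All (Other ∘ proj₂) τ → Fills τ σ w → cnt σ a ≡ count₀ w
    cnt-lower ok nil = ≡.refl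
    cnt-lower ((x≢ , _) ∷ ok) (other f) rewrite ≡ᵇ-≢ x≢ = cnt-lower ok f
    cnt-lower (_ ∷ ok) (lower f) rewrite ≡ᵇ-yes a = cong suc (cnt-lower ok f)
    cnt-lower (_ ∷ ok) (upper f) rewrite ≡ᵇ-≢ {suc a} {a} (ℕₚ.1+n≢n) = cnt-lower ok f

    cnt-upper : ∀ {τ σ w} → All (Other ∘ proj₂) τ → Fills τ σ w → cnt σ (suc a) ≡ count₁ w
    cnt-upper ok nil = ≡.refl
    cnt-upper ((_ , x≢) ∷ ok) (other f) rewrite ≡ᵇ-≢ x≢ = cnt-upper ok f
    cnt-upper (_ ∷ ok) (lower f) rewrite ≡ᵇ-≢ {a} {suc a} (ℕₚ.1+n≢n ∘ ≡.sym) = cnt-upper ok f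
    cnt-upper (_ ∷ ok) (upper f) rewrite ≡ᵇ-yes a = cong suc (cnt-upper ok f)

    cnt-other : ∀ {τ σ w} x → x ≢ a → x ≢ suc a → Fills τ σ w → cnt σ x ≡ patternCount τ x
    cnt-other x p r nil = ≡.refl
    cnt-other x p r (other {x = y} f) with y ≡ᵇ x
    ... | true = cong suc (cnt-other x p r f)
    ... | false = cnt-other x p r f
    cnt-other x p r (lower f) rewrite ≡ᵇ-≢ (p ∘ ≡.sym) = cnt-other x p r f
    cnt-other x p r (upper f) rewrite ≡ᵇ-≢ (r ∘ ≡.sym) = cnt-other x p r f

    mix-lower : ∀ τ i j → mix τ i j a ≡ i
    mix-lower τ i j rewrite ≡ᵇ-yes a = ≡.refl

    mix-upper : ∀ τ i j → mix τ i j (suc a) ≡ j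
    mix-upper τ i j rewrite ≡ᵇ-≢ {suc a} {a} (ℕₚ.1+n≢n) | ≡ᵇ-yes a = ≡.refl

    mix-other : ∀ τ i j x → x ≢ a → x ≢ suc a → mix τ i j x ≡ patternCount τ x
    mix-other τ i j x p r rewrite ≡ᵇ-≢ p | ≡ᵇ-≢ r = ≡.refl

    cnt-mix : ∀ {τ σ w} → All (Other ∘ proj₂) τ → Fills τ σ w → ∀ x → cnt σ x ≡ mix τ (count₀ w) (count₁ w) x
    cnt-mix {τ} {σ} {w} ok f x with x ℕ.≟ a | x ℕ.≟ suc a
    ... | yes ≡.refl | _ = ≡.trans (cnt-lower ok f) (≡.sym (mix-lower τ (count₀ w) (count₁ w)))
    ... | no _ | yes ≡.refl = ≡.trans (cnt-upper ok f) (≡.sym (mix-upper τ (count₀ w) (count₁ w)))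
    ... | no p | no r = ≡.trans (cnt-other x p r f) (≡.sym (mix-other τ (count₀ w) (count₁ w) x p r))

    All-holes : ∀ {P : V → Set} τ → All P (map proj₁ τ) → All P (holes τ)
    All-holes [] [] = []
    All-holes ((v , nothing) ∷ τ) (h ∷ hs) = h ∷ All-holes τ hs
    All-holes ((v , just x) ∷ τ) (h ∷ hs) = All-holes τ hs

    AllPairs-holes : ∀ τ → AllPairs _≺_ (map proj₁ τ) → AllPairs _≺_ (holes τ)
    AllPairs-holes [] [] = []
    AllPairs-holes ((v , nothing) ∷ τ) (h ∷ hs) = All-holes τ h ∷ AllPairs-holes τ hs
    AllPairs-holes ((v , just x) ∷ τ) (h ∷ hs) = AllPairs-holes τ hs

    Swapped : (ℕ → ℕ) → (ℕ → ℕ) → Set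
    Swapped f f' = f a ≡ f' (suc a) × f (suc a) ≡ f' a × (∀ x → x ≢ a → x ≢ suc a → f x ≡ f' x)

    -- `h` and `h'` will be the indicators of an exponent and of its adjacent transposition. For
    -- each fixed pattern the sum is a two-letter sum over the holes, which inherit the order of the
    -- cells.
    swap-letters : ∀ {ls os} → ls ↭ a ∷ suc a ∷ os → All (λ x → x ≢ a × x ≢ suc a) os →
      ∀ (h h' : (ℕ → ℕ) → C) → (∀ f f' → Swapped f f' → h f ≈ h' f') → ∀ cs → AllPairs _≺_ cs →
      SumAll ls cs (λ σ → N.W σ * h (cnt σ)) ≈ SumAll ls cs (λ σ → N.W σ * h' (cnt σ))
    swap-letters {ls} {os} perm ok h h' hh cs ordered = begin
      SumAll ls cs (λ σ → N.W σ * h (cnt σ)) ≈⟨ SumAll-patterns perm cs _ ⟩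
      SumPattern os cs (λ τ → SumFill τ (λ σ _ → N.W σ * h (cnt σ))) ≈⟨ SumPattern-cong ok cs per-pattern ⟩
      SumPattern os cs (λ τ → SumFill τ (λ σ _ → N.W σ * h' (cnt σ))) ≈⟨ sym (SumAll-patterns perm cs _) ⟩
      SumAll ls cs (λ σ → N.W σ * h' (cnt σ)) ∎
      where
      reduce : ∀ (k : (ℕ → ℕ) → C) → (∀ f f' → (∀ x → f x ≡ f' x) → k f ≈ k f') → ∀ τ → All (Other ∘ proj₂) τ →
        SumFill τ (λ σ _ → N.W σ * k (cnt σ)) ≈ patternWeight τ * Z (holes τ) (λ i j → k (mix τ i j))
      reduce k ext τ okτ = begin
        SumFill τ (λ σ _ → N.W σ * k (cnt σ))
          ≈⟨ SumFill-cong τ (λ σ w f → trans (*-cong (weight-split okτ f) (ext _ _ (cnt-mix okτ f))) (*-assoc _ _ _)) ⟩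
        SumFill τ (λ _ w → patternWeight τ * (W w * k (mix τ (count₀ w) (count₁ w))))
          ≈⟨ SumFill-S τ _ ⟩
        S (holes τ) (λ w → patternWeight τ * (W w * k (mix τ (count₀ w) (count₁ w))))
          ≈⟨ S-* (patternWeight τ) (holes τ) _ ⟩
        patternWeight τ * Z (holes τ) (λ i j → k (mix τ i j)) ∎
      swapF : (ℕ → ℕ) → ℕ → ℕ
      swapF f x = if x ≡ᵇ a then f (suc a) else (if x ≡ᵇ suc a then f a else f x)
      swapF-lower : ∀ f → swapF f a ≡ f (suc a)
      swapF-lower f rewrite ≡ᵇ-yes a = ≡.refl
      swapF-upper : ∀ f → swapF f (suc a) ≡ f a
      swapF-upper f rewrite ≡ᵇ-≢ {suc a} {a} (ℕₚ.1+n≢n) | ≡ᵇ-yes a = ≡.refl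
      swapF-other : ∀ f x → x ≢ a → x ≢ suc a → f x ≡ swapF f x
      swapF-other f x p r rewrite ≡ᵇ-≢ p | ≡ᵇ-≢ r = ≡.refl
      -- Pointwise equal contents need not be equal as functions. Both are swapped with the same
      -- `swapF f`, so two applications of `hh` give the congruence.
      ext : ∀ f f' → (∀ x → f x ≡ f' x) → h f ≈ h f'
      ext f f' e = trans (hh f (swapF f) (≡.sym (swapF-upper f) , ≡.sym (swapF-lower f) , swapF-other f))
        (sym (hh f' (swapF f) (≡.trans (≡.sym (e a)) (≡.sym (swapF-upper f)) , ≡.trans (≡.sym (e (suc a))) (≡.sym (swapF-lower f))
             , λ x p r → ≡.trans (≡.sym (e x)) (swapF-other f x p r))))
      ext' : ∀ f f' → (∀ x → f x ≡ f' x) → h' f ≈ h' f'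
      ext' f f' e = trans (sym (hh (swapF f) f (swapF-lower f , swapF-upper f , λ x p r → ≡.sym (swapF-other f x p r))))
        (hh (swapF f) f' (≡.trans (swapF-lower f) (e _) , ≡.trans (swapF-upper f) (e _) , λ x p r → ≡.trans (≡.sym (swapF-other f x p r)) (e x)))
      per-pattern : ∀ τ → map proj₁ τ ≡ cs → All (Other ∘ proj₂) τ →
        SumFill τ (λ σ _ → N.W σ * h (cnt σ)) ≈ SumFill τ (λ σ _ → N.W σ * h' (cnt σ))
      per-pattern τ ≡.refl okτ = begin
        SumFill τ (λ σ _ → N.W σ * h (cnt σ)) ≈⟨ reduce h ext τ okτ ⟩
        patternWeight τ * Z (holes τ) (λ i j → h (mix τ i j))
          ≈⟨ *-congˡ (two-letter-symmetric _ (holes τ) ℕₚ.≤-refl (AllPairs-holes τ ordered) (λ i j → h (mix τ i j))) ⟩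
        patternWeight τ * Z (holes τ) (λ i j → h (mix τ j i))
          ≈⟨ *-congˡ (Z-cong (holes τ) (λ i j → hh (mix τ j i) (mix τ i j)
               ( ≡.trans (mix-lower τ j i) (≡.sym (mix-upper τ i j))
               , ≡.trans (mix-upper τ j i) (≡.sym (mix-lower τ i j))
               , λ x p r → ≡.trans (mix-other τ j i x p r) (≡.sym (mix-other τ i j x p r)) ))) ⟩
        patternWeight τ * Z (holes τ) (λ i j → h' (mix τ i j)) ≈⟨ sym (reduce h' ext' τ okτ) ⟩
        SumFill τ (λ σ _ → N.W σ * h' (cnt σ)) ∎

All-concatMap : ∀ {A B : Set} {Q : B → Set} (f : A → List B) {xs} → All (λ x → All Q (f x)) xs → All Q (concatMap f xs)
All-concatMap f h = Allₚ.concat⁺ (Allₚ.map⁺ h)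

-- Set partitions

NonEmpty : ∀ {A : Set} → List A → Set
NonEmpty B = 0 < length B

record IsSetPartition {A : Set} (xs : List A) (π : List (List A)) : Set where
  constructor _,_
  field
    covers : concat π ↭ xs
    nonempty : All NonEmpty π
open IsSetPartition public

insertEach-blocks : ∀ {A : Set} (x : A) π → All NonEmpty π →
  All (λ π' → concat π' ↭ x ∷ concat π × All NonEmpty π' × length π' ≡ length π) (insertEach x π)
insertEach-blocks x [] [] = []
insertEach-blocks x (B ∷ π) (b ∷ bs) = (Perm.refl , s≤s z≤n ∷ bs , ≡.refl) ∷
  Allₚ.map⁺ (All.map (λ { (p , ne , l) →
      ↭-trans (Permₚ.++⁺ˡ B p) (Permₚ.shift x B (concat π)) , b ∷ ne , cong suc l })
    (insertEach-blocks x π bs))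

setPartitions-valid : ∀ {A : Set} (xs : List A) → All (IsSetPartition xs) (setPartitions xs)
setPartitions-valid [] = (Perm.refl , []) ∷ []
setPartitions-valid (x ∷ xs) = All-concatMap _ (All.map
  (λ {π} v → (Perm.prep x (covers v) , s≤s z≤n ∷ nonempty v) ∷
    All.map (λ { (p , ne , _) → (↭-trans p (Perm.prep x (covers v))) , ne }) (insertEach-blocks x π (nonempty v)))
  (setPartitions-valid xs))

module _ (R : CommutativeRing 0ℓ 0ℓ) where
  open CommutativeRing R renaming (Carrier to C; _+_ to _+R_)
  open RingSums R

  -- The set partitions of `x ∷ xs` are grouped by the set partition of `xs` to which they restrict.
  -- A restriction with several blocks only has extensions with several blocks, so the induction
  -- applies to the sums over groups. The list is nonempty because the partition of the empty list
  -- has no block.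
  sum-setPartitions : ∀ {A : Set} (x : A) xs (h : List (List A) → C) →
    (∀ π → IsSetPartition (x ∷ xs) π → 2 ≤ length π → h π ≈ 0#) → sumL (setPartitions (x ∷ xs)) h ≈ h ((x ∷ xs) ∷ [])
  sum-setPartitions x [] h z = +-identityʳ _
  sum-setPartitions x (y ∷ ys) h z = trans (sumL-concatMap _ (setPartitions (y ∷ ys)) h)
    (trans (sum-setPartitions y ys g g-zero)
      (trans (+-cong (z (((x ∷ []) ∷ (y ∷ ys) ∷ [])) (covered , s≤s z≤n ∷ s≤s z≤n ∷ []) (s≤s (s≤s z≤n))) (+-identityʳ _))
        (+-identityˡ _)))
    where
    covered : x ∷ y ∷ ys ++ [] ↭ x ∷ y ∷ ys
    covered = Perm.↭-reflexive (cong (λ l → x ∷ y ∷ l) (Lₚ.++-identityʳ ys))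
    g : List (List _) → C
    g π = h ((x ∷ []) ∷ π) +R sumL (insertEach x π) h
    g-zero : ∀ π → IsSetPartition (y ∷ ys) π → 2 ≤ length π → g π ≈ 0#
    g-zero π v l = trans (+-cong (z _ (Perm.prep x (covers v) , s≤s z≤n ∷ nonempty v) (s≤s (ℕₚ.<⇒≤ l)))
      (sumL-zero-All (All.map (λ { (p , ne , e) → z _ (↭-trans p (Perm.prep x (covers v)) , ne) (subst (2 ≤_) (≡.sym e) l) })
        (insertEach-blocks x π (nonempty v))))) (+-identityˡ _)

-- Convolution of coefficient functions, and symmetric series of bounded degree

module SeriesRing (R : CommutativeRing 0ℓ 0ℓ) where
  open CommutativeRing R renaming (Carrier to C)
  open RingSums R

  Series : Set
  Series = List ℕ → C

  -- An arbitrary kernel replaces the product `F β * G γ`, so that exponents already chosen can be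
  -- absorbed into it and the variables peeled off one by one.
  conv : List ℕ → (List ℕ → List ℕ → C) → C
  conv α K = sumL (below α) (λ β → K β (zipWith _∸_ α β))

  part : (List ℕ → List ℕ → C) → ℕ → ℕ → List ℕ → List ℕ → C
  part K a b β γ = K (b ∷ β) (a ∸ b ∷ γ)

  conv-∷ : ∀ a α K → conv (a ∷ α) K ≈ sumL (upTo (suc a)) (λ b → conv α (part K a b))
  conv-∷ a α K = trans (sumL-concatMap (λ b → map (b ∷_) (below α)) (upTo (suc a)) F)
    (sumL-cong (upTo (suc a)) (λ b → reflexive (sumL-map (b ∷_) (below α) F)))
    where
    F : List ℕ → C
    F β = K β (zipWith _∸_ (a ∷ α) β)

  conv-cong : ∀ α {K K'} → (∀ β γ → K β γ ≈ K' β γ) → conv α K ≈ conv α K'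
  conv-cong α h = sumL-cong (below α) (λ β → h _ _)

  conv-swap : ∀ β x y γ {K K'} →
    (∀ β₁ β₂ i j k l γ₁ γ₂ → K (β₁ ++ i ∷ j ∷ γ₁) (β₂ ++ k ∷ l ∷ γ₂) ≈ K' (β₁ ++ j ∷ i ∷ γ₁) (β₂ ++ l ∷ k ∷ γ₂)) →
    conv (β ++ x ∷ y ∷ γ) K ≈ conv (β ++ y ∷ x ∷ γ) K'
  conv-swap [] x y γ {K} {K'} h = begin
    conv (x ∷ y ∷ γ) K
      ≈⟨ trans (conv-∷ x (y ∷ γ) K) (sumL-cong (upTo (suc x)) (λ b → conv-∷ y γ (part K x b))) ⟩
    sumL (upTo (suc x)) (λ b → sumL (upTo (suc y)) (λ c → conv γ (λ γ₁ γ₂ → K (b ∷ c ∷ γ₁) (x ∸ b ∷ y ∸ c ∷ γ₂))))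
      ≈⟨ sumL-swap (upTo (suc x)) (upTo (suc y)) _ ⟩
    sumL (upTo (suc y)) (λ c → sumL (upTo (suc x)) (λ b → conv γ (λ γ₁ γ₂ → K (b ∷ c ∷ γ₁) (x ∸ b ∷ y ∸ c ∷ γ₂))))
      ≈⟨ sumL-cong (upTo (suc y)) (λ c → sumL-cong (upTo (suc x)) (λ b → conv-cong γ (λ γ₁ γ₂ → h [] [] b c (x ∸ b) (y ∸ c) γ₁ γ₂))) ⟩
    sumL (upTo (suc y)) (λ c → sumL (upTo (suc x)) (λ b → conv γ (λ γ₁ γ₂ → K' (c ∷ b ∷ γ₁) (y ∸ c ∷ x ∸ b ∷ γ₂))))
      ≈⟨ sym (trans (conv-∷ y (x ∷ γ) K') (sumL-cong (upTo (suc y)) (λ b → conv-∷ x γ (part K' y b)))) ⟩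
    conv (y ∷ x ∷ γ) K' ∎
    where open import Relation.Binary.Reasoning.Setoid setoid
  conv-swap (a ∷ β) x y γ {K} {K'} h = trans (conv-∷ a (β ++ x ∷ y ∷ γ) K)
    (trans (sumL-cong (upTo (suc a)) (λ b → conv-swap β x y γ {part K a b} {part K' a b} (λ β₁ β₂ → h (b ∷ β₁) (a ∸ b ∷ β₂))))
      (sym (conv-∷ a (β ++ y ∷ x ∷ γ) K')))

  conv-∷ʳ0 : ∀ α {K} → conv (α ++ 0 ∷ []) K ≈ conv α (λ β γ → K (β ++ 0 ∷ []) (γ ++ 0 ∷ []))
  conv-∷ʳ0 [] = refl
  conv-∷ʳ0 (a ∷ α) {K} = trans (conv-∷ a (α ++ 0 ∷ []) K)
    (trans (sumL-cong (upTo (suc a)) (λ b → conv-∷ʳ0 α {part K a b})) (sym (conv-∷ a α (λ β γ → K (β ++ 0 ∷ []) (γ ++ 0 ∷ [])))))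

  upTo-≤ : ∀ n → All (_≤ n) (upTo (suc n))
  upTo-≤ n = All.map ℕₚ.≤-pred (Allₚ.applyUpTo⁺₁ id (suc n) id)

  conv-zero : ∀ α {K} → (∀ β γ → sum β ℕ.+ sum γ ≡ sum α → K β γ ≈ 0#) → conv α K ≈ 0#
  conv-zero [] h = trans (+-identityʳ _) (h [] [] ≡.refl)
  conv-zero (a ∷ α) {K} h = trans (conv-∷ a α K) (sumL-zero-All (All.map term (upTo-≤ a)))
    where
    term : ∀ {b} → b ≤ a → conv α (part K a b) ≈ 0#
    term {b} l = conv-zero α {part K a b} (λ β γ e → h (b ∷ β) (a ∸ b ∷ γ) (≡.trans
      (solve 4 (λ b s c t → (b :+ s) :+ (c :+ t) := (b :+ c) :+ (s :+ t)) ≡.refl b (sum β) (a ∸ b) (sum γ))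
      (cong₂ ℕ._+_ (ℕₚ.m+[n∸m]≡n l) e)))
      where
      open +-*-Solver

  sum-upTo-last : ∀ a f → (∀ b → b < a → f b ≈ 0#) → sumL (upTo (suc a)) f ≈ f a
  sum-upTo-last a f h = trans (reflexive (cong (λ l → sumL l f) (≡.sym (Lₚ.upTo-∷ʳ a))))
    (trans (sumL-++ (upTo a) (a ∷ []) f)
      (trans (+-cong (sumL-zero-All (All.map (h _) (Allₚ.applyUpTo⁺₁ id a id))) (+-identityʳ _)) (+-identityˡ _)))

  one : Series
  one α = if allZero α then 1# else 0#

  infixr 7 _⊛_
  _⊛_ : Series → Series → Series
  (F ⊛ G) α = conv α (λ β γ → F β * G γ)

  ⊛-one : ∀ F α → (F ⊛ one) α ≈ F α
  ⊛-one F [] = trans (+-identityʳ _) (*-identityʳ _)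
  ⊛-one F (a ∷ α) = trans (conv-∷ a α (λ β γ → F β * one γ)) (trans (sum-upTo-last a _ small)
    (trans (conv-cong α (λ β γ → *-congˡ (reflexive (cong (λ z → if (z ≡ᵇ 0) ∧ allZero γ then 1# else 0#) (ℕₚ.n∸n≡0 a)))))
      (⊛-one (λ β → F (a ∷ β)) α)))
    where
    small : ∀ b → b < a → conv α (λ β γ → F (b ∷ β) * one (a ∸ b ∷ γ)) ≈ 0#
    small b l = sumL-zero-All (All.universal (λ β → trans (*-congˡ (reflexive
      (cong (λ z → if z ∧ allZero (zipWith _∸_ α β) then 1# else 0#) (≡ᵇ-≢ (ℕₚ.m>n⇒m∸n≢0 l))))) (zeroʳ _)) (below α))

  prod : List Series → Series
  prod = foldr _⊛_ one

  -- Invariance is asked for adjacent transpositions only, which generate all permutations. The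
  -- explicit bound `d` makes the property additive under products.
  record InΛ≤ (d : ℕ) (F : Series) : Set where
    constructor mkΛ
    field
      swapΛ : ∀ β x y γ → F (β ++ x ∷ y ∷ γ) ≈ F (β ++ y ∷ x ∷ γ)
      trailΛ : ∀ α → F (α ++ 0 ∷ []) ≈ F α
      degreeΛ : ∀ α → d < sum α → F α ≈ 0#
  open InΛ≤ public

  allZero-swap : ∀ β x y γ → allZero (β ++ x ∷ y ∷ γ) ≡ allZero (β ++ y ∷ x ∷ γ)
  allZero-swap [] x y γ = sw (x ≡ᵇ 0) (y ≡ᵇ 0)
    where
    sw : ∀ a b → a ∧ b ∧ allZero γ ≡ b ∧ a ∧ allZero γ
    sw true true = ≡.refl
    sw true false = ≡.refl
    sw false true = ≡.refl
    sw false false = ≡.refl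
  allZero-swap (b ∷ β) x y γ = cong ((b ≡ᵇ 0) ∧_) (allZero-swap β x y γ)

  allZero-∷ʳ0 : ∀ α → allZero (α ++ 0 ∷ []) ≡ allZero α
  allZero-∷ʳ0 [] = ≡.refl
  allZero-∷ʳ0 (a ∷ α) = cong ((a ≡ᵇ 0) ∧_) (allZero-∷ʳ0 α)

  allZero-sum : ∀ α → 0 < sum α → allZero α ≡ false
  allZero-sum (zero ∷ α) l = allZero-sum α l
  allZero-sum (suc a ∷ α) l = ≡.refl

  one-Λ : InΛ≤ 0 one
  one-Λ = mkΛ (λ β x y γ → reflexive (cong (λ z → if z then 1# else 0#) (allZero-swap β x y γ)))
    (λ α → reflexive (cong (λ z → if z then 1# else 0#) (allZero-∷ʳ0 α)))
    (λ α l → reflexive (cong (λ z → if z then 1# else 0#) (allZero-sum α l)))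

  ⊛-Λ : ∀ {d e F G} → InΛ≤ d F → InΛ≤ e G → InΛ≤ (d ℕ.+ e) (F ⊛ G)
  ⊛-Λ {d} {e} {F} {G} f g = mkΛ
    (λ β x y γ → conv-swap β x y γ {K} {K} (λ β₁ β₂ i j k l γ₁ γ₂ → *-cong (swapΛ f β₁ i j γ₁) (swapΛ g β₂ k l γ₂)))
    (λ α → trans (conv-∷ʳ0 α {K}) (conv-cong α (λ β γ → *-cong (trailΛ f β) (trailΛ g γ))))
    (λ α l → conv-zero α {K} (λ β γ eq → split β γ (subst (d ℕ.+ e <_) (≡.sym eq) l)))
    where
    K : List ℕ → List ℕ → C
    K β γ = F β * G γ
    split : ∀ β γ → d ℕ.+ e < sum β ℕ.+ sum γ → F β * G γ ≈ 0#
    split β γ l with d ℕ.<? sum β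
    ... | yes d< = trans (*-congʳ (degreeΛ f β d<)) (zeroˡ _)
    ... | no d≮ = trans (*-congˡ (degreeΛ g γ (ℕₚ.+-cancelˡ-< d e (sum γ)
                    (ℕₚ.<-≤-trans l (ℕₚ.+-monoˡ-≤ (sum γ) (ℕₚ.≮⇒≥ d≮)))))) (zeroʳ _)

  prod-Λ : ∀ {A : Set} (F : A → Series) (deg : A → ℕ) {xs} → All (λ x → InΛ≤ (deg x) (F x)) xs → InΛ≤ (sum (map deg xs)) (prod (map F xs))
  prod-Λ F deg [] = one-Λ
  prod-Λ F deg (h ∷ hs) = ⊛-Λ h (prod-Λ F deg hs)

  scale-Λ : ∀ {d F} c → InΛ≤ d F → InΛ≤ d (λ α → c * F α)
  scale-Λ c f = mkΛ (λ β x y γ → *-congˡ (swapΛ f β x y γ)) (λ α → *-congˡ (trailΛ f α))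
    (λ α l → trans (*-congˡ (degreeΛ f α l)) (zeroʳ c))

  sum-Λ : ∀ {A : Set} {d} (F : A → Series) {xs} → All (λ x → InΛ≤ d (F x)) xs → InΛ≤ d (λ α → sumL xs (λ x → F x α))
  sum-Λ F h = mkΛ (λ β x y γ → sumL-cong-All (All.map (λ f → swapΛ f β x y γ) h))
    (λ α → sumL-cong-All (All.map (λ f → trailΛ f α) h))
    (λ α l → sumL-zero-All (All.map (λ f → degreeΛ f α l) h))

-- Fraction-free elimination over an integral domain

module Elimination (R : CommutativeRing 0ℓ 0ℓ)
  (zero? : ∀ x → CommutativeRing._≈_ R x (CommutativeRing.0# R) ⊎ ¬ CommutativeRing._≈_ R x (CommutativeRing.0# R))
  (domain : ∀ {x y} → CommutativeRing._≈_ R (CommutativeRing._*_ R x y) (CommutativeRing.0# R) →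
    ¬ CommutativeRing._≈_ R y (CommutativeRing.0# R) → CommutativeRing._≈_ R x (CommutativeRing.0# R))
  (1≉0 : ¬ CommutativeRing._≈_ R (CommutativeRing.1# R) (CommutativeRing.0# R)) where
  open CommutativeRing R renaming (Carrier to C; _+_ to infixl 6 _⊹_) hiding (zero)
  open RingSums R renaming (sumL to ∑)
  open import Algebra.Properties.Ring ring using (-‿distribˡ-*; -‿distribʳ-*; -‿involutive; -0#≈0#)
  open import Relation.Binary.Reasoning.Setoid setoid

  private module Laws where
    open import Algebra.Solver.Ring.NaturalCoefficients.Default commutativeSemiring using (solve; _:=_; _:+_; _:*_)
    linear : ∀ c a u v n → (c * (a * u ⊹ v * n)) ≈ (a * (c * u) ⊹ (c * v) * n)
    linear = solve 5 (λ c a u v n → (c :* (a :* u :+ v :* n)) := (a :* (c :* u) :+ (c :* v) :* n)) refl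
    collect : ∀ a u v n u' v' → (a * u ⊹ v * n) ⊹ (a * u' ⊹ v' * n) ≈ (a * (u ⊹ u') ⊹ (v ⊹ v') * n)
    collect = solve 6 (λ a u v n u' v' → (a :* u :+ v :* n) :+ (a :* u' :+ v' :* n) := (a :* (u :+ u') :+ (v :+ v') :* n)) refl
    expand : ∀ d a w x n p → ((d * a) * w ⊹ (d * x) * (n ⊹ p)) ≈ (d * (a * w ⊹ x * n) ⊹ (d * x) * p)
    expand = solve 6 (λ d a w x n p → ((d :* a) :* w :+ (d :* x) :* (n :+ p)) := (d :* (a :* w :+ x :* n) :+ (d :* x) :* p)) refl
    regroup' : ∀ s t m p → (s ⊹ t * p) ⊹ m * p ≈ (m ⊹ t) * p ⊹ s
    regroup' = solve 4 (λ s t m p → (s :+ t :* p) :+ m :* p := (m :+ t) :* p :+ s) refl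
    pivot-row : ∀ m t a s → (m ⊹ t) * a ⊹ a * s ≈ m * a ⊹ a * (t ⊹ s)
    pivot-row = solve 4 (λ m t a s → (m :+ t) :* a :+ a :* s := m :* a :+ a :* (t :+ s)) refl
    comm₃ : ∀ d a w → (d * a) * w ≈ (d * w) * a
    comm₃ = solve 3 (λ d a w → (d :* a) :* w := (d :* w) :* a) refl

  module _ {X V : Set} where

    comb : (V → X → C) → List (C × V) → X → C
    comb e L x = ∑ L (λ p → proj₁ p * e (proj₂ p) x)

    -- The combination lists every vector of `vs` exactly once, so one nonzero coefficient makes it
    -- a genuine relation. In the absence of division, spanning means that a nonzero multiple of
    -- each target is reached.
    Dependent Spanning : (V → X → C) → List X → List V → Set
    Dependent e xs vs = Σ (List (C × V)) λ L →
      map proj₂ L ↭ vs × Any (λ p → ¬ proj₁ p ≈ 0#) L × All (λ x → comb e L x ≈ 0#) xs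
    Spanning e xs vs = ∀ (w : X → C) → Σ C λ d → Σ (List (C × V)) λ L →
      map proj₂ L ↭ vs × ¬ d ≈ 0# × All (λ x → d * w x ≈ comb e L x) xs

    pivot? : ∀ (f : V → C) vs → All (λ v → f v ≈ 0#) vs ⊎ (Σ V λ p → Σ (List V) λ vs' → vs ↭ p ∷ vs' × ¬ f p ≈ 0#)
    pivot? f [] = inj₁ []
    pivot? f (v ∷ vs) with zero? (f v)
    ... | inj₂ nz = inj₂ (v , vs , Perm.refl , nz)
    ... | inj₁ z with pivot? f vs
    ...   | inj₁ zs = inj₁ (z ∷ zs)
    ...   | inj₂ (p , vs' , perm , nz) = inj₂ (p , v ∷ vs' , ↭-trans (Perm.prep v perm) (Perm.swap v p Perm.refl) , nz)

    scale : C → List (C × V) → List (C × V)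
    scale a = map (λ p → a * proj₁ p , proj₂ p)

    scale-keys : ∀ a L → map proj₂ (scale a L) ≡ map proj₂ L
    scale-keys a L = ≡.sym (Lₚ.map-∘ L)

    comb-scale : ∀ e a L x → comb e (scale a L) x ≈ a * comb e L x
    comb-scale e a L x = trans (reflexive (sumL-map _ L _)) (trans (sumL-cong L (λ p → *-assoc a _ _)) (sumL-*ˡ a L _))

    comb-zero : ∀ e x L → All (λ v → e v x ≈ 0#) (map proj₂ L) → comb e L x ≈ 0#
    comb-zero e x L h = sumL-zero-All (All.map (λ z → trans (*-congˡ z) (zeroʳ _)) (Allₚ.map⁻ h))

    -- The Gaussian row operation multiplied through by the pivot `e p x`; the result vanishes at
    -- `x` without any division.
    eliminate : (V → X → C) → V → X → V → X → C
    eliminate e p x v y = e p x * e v y ⊹ e v x * - e p y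

    comb-eliminate : ∀ e p x L y → comb (eliminate e p x) L y ≈ e p x * comb e L y ⊹ comb e L x * - e p y
    comb-eliminate e p x [] y = sym (trans (+-cong (zeroʳ _) (zeroˡ _)) (+-identityʳ 0#))
    comb-eliminate e p x ((c , v) ∷ L) y = trans (+-cong (Laws.linear c _ _ _ _) (comb-eliminate e p x L y)) (Laws.collect _ _ _ _ _ _)

    neg-swap : ∀ s p → s * - p ≈ - s * p
    neg-swap s p = trans (sym (-‿distribʳ-* s p)) (-‿distribˡ-* s p)

    nonzero-* : ∀ {a c} → ¬ a ≈ 0# → ¬ c ≈ 0# → ¬ a * c ≈ 0#
    nonzero-* na nc z = na (domain z nc)

    -- Induction on the points. Each step discards one point and one vector, which preserves the
    -- inequality between the lengths. The dichotomy takes the place of a rank: independent vectors,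
    -- at least as many as the points, interpolate all values.
    gauss : ∀ (xs : List X) (vs : List V) (e : V → X → C) → length xs ≤ length vs → Dependent e xs vs ⊎ Spanning e xs vs
    gauss [] vs e l = inj₂ (λ w → 1# , map (0# ,_) vs , Perm.↭-reflexive (≡.trans (≡.sym (Lₚ.map-∘ vs)) (Lₚ.map-id vs)) , 1≉0 , [])
    gauss (x ∷ xs) vs e l with pivot? (λ v → e v x) vs
    -- All vectors vanish at `x`, so `x` is dropped and `v` is sacrificed. If the others are not
    -- dependent, they span and express a nonzero multiple of `v` itself on `xs`, which is a
    -- dependence.
    gauss (x ∷ xs) (v ∷ vs) e (s≤s l) | inj₁ zs@(z ∷ zs') with gauss xs vs e l
    ... | inj₁ (L , perm , nz , h) = inj₁ ((0# , v) ∷ L , Perm.prep v perm , there nz ,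
            comb-zero e x _ (Permₚ.All-resp-↭ (↭-sym (Perm.prep v perm)) zs) ∷
            All.map (λ r → trans (+-cong (zeroˡ _) r) (+-identityʳ 0#)) h)
    ... | inj₂ sp with sp (e v)
    ...   | d , L , perm , d≉0 , h = inj₁ ((- d , v) ∷ L , Perm.prep v perm ,
            here (λ z → d≉0 (trans (sym (-‿involutive d)) (trans (-‿cong z) -0#≈0#))) ,
            comb-zero e x _ (Permₚ.All-resp-↭ (↭-sym (Perm.prep v perm)) zs) ∷
            All.map (λ r → trans (+-cong (sym (-‿distribˡ-* d _)) (sym r)) (-‿inverseˡ _)) h)
    gauss (x ∷ xs) vs e l | inj₂ (p , vs' , perm , a≉0)
      with gauss xs vs' (eliminate e p x) (ℕₚ.≤-pred (subst (suc (length xs) ≤_) (Permₚ.↭-length perm) l))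
    -- In a relation between eliminated vectors the multiples of the pivot vector add up to the
    -- coefficient `- comb e L x`; this is also the coefficient that makes the relation hold at `x`.
    ... | inj₁ (L , permL , nz , h) = inj₁ ((- comb e L x , p) ∷ scale a L , keys ,
            there (Anyₚ.map⁺ (Any.map (nonzero-* a≉0) nz)) ,
            at-pivot ∷ All.map elsewhere h)
      where
      a = e p x
      keys : p ∷ map proj₂ (scale a L) ↭ vs
      keys = ↭-trans (Perm.prep p (↭-trans (Perm.↭-reflexive (scale-keys a L)) permL)) (↭-sym perm)
      at-pivot : - comb e L x * a ⊹ comb e (scale a L) x ≈ 0#
      at-pivot = trans (+-cong (sym (-‿distribˡ-* _ a)) (trans (comb-scale e a L x) (*-comm a _))) (-‿inverseˡ _)
      elsewhere : ∀ {y} → comb (eliminate e p x) L y ≈ 0# → - comb e L x * e p y ⊹ comb e (scale a L) y ≈ 0#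
      elsewhere {y} r = begin
        - comb e L x * e p y ⊹ comb e (scale a L) y ≈⟨ +-cong (sym (neg-swap _ _)) (comb-scale e a L y) ⟩
        comb e L x * - e p y ⊹ a * comb e L y ≈⟨ +-comm _ _ ⟩
        a * comb e L y ⊹ comb e L x * - e p y ≈⟨ sym (comb-eliminate e p x L y) ⟩
        comb (eliminate e p x) L y ≈⟨ r ⟩
        0# ∎
    ... | inj₂ sp = inj₂ solution
      where
      a = e p x
      solution : Spanning e (x ∷ xs) vs
      -- The target is reduced at `x` in the same way as the vectors. Undoing the reduction
      -- multiplies the other coefficients by `a`, gives the pivot `d * w x` minus `s`, and turns
      -- the multiplier into `d * a`.
      solution w with sp (λ y → a * w y ⊹ w x * - e p y)
      ... | d , L , permL , d≉0 , h = d * a , (m , p) ∷ scale a L ,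
            ↭-trans (Perm.prep p (↭-trans (Perm.↭-reflexive (scale-keys a L)) permL)) (↭-sym perm) ,
            nonzero-* d≉0 a≉0 , at-pivot ∷ All.map elsewhere h
        where
        s = comb e L x
        m = d * w x ⊹ - s
        at-pivot : (d * a) * w x ≈ m * a ⊹ comb e (scale a L) x
        at-pivot = sym (begin
          m * a ⊹ comb e (scale a L) x ≈⟨ +-congˡ (comb-scale e a L x) ⟩
          m * a ⊹ a * s ≈⟨ Laws.pivot-row _ _ _ _ ⟩
          (d * w x) * a ⊹ a * (- s ⊹ s) ≈⟨ +-congˡ (trans (*-congˡ (-‿inverseˡ s)) (zeroʳ a)) ⟩
          (d * w x) * a ⊹ 0# ≈⟨ +-identityʳ _ ⟩
          (d * w x) * a ≈⟨ sym (Laws.comm₃ d a (w x)) ⟩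
          (d * a) * w x ∎)
        elsewhere : ∀ {y} → d * (a * w y ⊹ w x * - e p y) ≈ comb (eliminate e p x) L y →
          (d * a) * w y ≈ m * e p y ⊹ comb e (scale a L) y
        elsewhere {y} r = begin
          (d * a) * w y
            ≈⟨ sym (trans (+-congˡ (trans (*-congˡ (-‿inverseˡ (e p y))) (zeroʳ _))) (+-identityʳ _)) ⟩
          (d * a) * w y ⊹ (d * w x) * (- e p y ⊹ e p y)
            ≈⟨ Laws.expand _ _ _ _ _ _ ⟩
          d * (a * w y ⊹ w x * - e p y) ⊹ (d * w x) * e p y
            ≈⟨ +-congʳ (trans r (trans (comb-eliminate e p x L y) (+-congˡ (neg-swap _ _)))) ⟩
          (a * comb e L y ⊹ - s * e p y) ⊹ (d * w x) * e p y
            ≈⟨ Laws.regroup' _ _ _ _ ⟩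
          m * e p y ⊹ a * comb e L y
            ≈⟨ +-congˡ (sym (comb-scale e a L y)) ⟩
          m * e p y ⊹ comb e (scale a L) y ∎

-- Rearrangements for sums and quotients of fractions

module FractionLaws (R : CommutativeRing 0ℓ 0ℓ) where
  open CommutativeRing R renaming (_+_ to infixl 6 _⊹_)
  open import Algebra.Solver.Ring.NaturalCoefficients.Default commutativeSemiring using (solve; _:=_; _:+_; _:*_)
  swap₁ : ∀ a b c → (a * b) * c ≈ (a * c) * b
  swap₁ = solve 3 (λ a b c → (a :* b) :* c := (a :* c) :* b) refl
  swap₂ : ∀ a b c → a * (b * c) ≈ b * (a * c)
  swap₂ = solve 3 (λ a b c → a :* (b :* c) := b :* (a :* c)) refl
  sum-num : ∀ c k d e s → ((c * k) * d ⊹ e * s) ≈ ((c * d) * k ⊹ s * e)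
  sum-num = solve 5 (λ c k d e s → (c :* k) :* d :+ e :* s := (c :* d) :* k :+ s :* e) refl
  frac-sum : ∀ a b x y s → (a * y ⊹ b * x) * s ≈ ((a * s) * y ⊹ (b * s) * x)
  frac-sum = solve 5 (λ a b x y s → (a :* y :+ b :* x) :* s := (a :* s) :* y :+ (b :* s) :* x) refl
  frac-sum' : ∀ p r x y → (p * x) * y ⊹ (r * y) * x ≈ (p ⊹ r) * (x * y)
  frac-sum' = solve 4 (λ p r x y → (p :* x) :* y :+ (r :* y) :* x := (p :+ r) :* (x :* y)) refl
  entry : ∀ c d k s → ((c * d) * k) * s ≈ (c * k) * (s * d)
  entry = solve 4 (λ c d k s → ((c :* d) :* k) :* s := (c :* k) :* (s :* d)) refl
  quotient : ∀ e f d c → (e * f) * (d * c) ≈ e * (d * (f * c))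
  quotient = solve 4 (λ e f d c → (e :* f) :* (d :* c) := e :* (d :* (f :* c))) refl
  quotient' : ∀ d w c f → (d * (w * c)) * f ≈ (w * f) * (d * c)
  quotient' = solve 4 (λ d w c f → (d :* (w :* c)) :* f := (w :* f) :* (d :* c)) refl

-- The ring ℤ[q,t]

module PolynomialRing where
  open ≡ using (refl; sym; trans; module ≡-Reasoning)
  open import Data.Integer using (+_)

  -- A formal sum read as a linear functional on test functions. Ring laws become exchanges of
  -- finite sums, with no comparison of term lists; the coefficients are the values at the test
  -- functions `δ a b`.
  pair : Pqt → (ℕ → ℕ → ℤ) → ℤ
  pair [] φ = + 0
  pair ((c , i , j) ∷ p) φ = c ℤ.* φ i j ℤ.+ pair p φ

  δ : ℕ → ℕ → ℕ → ℕ → ℤ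
  δ a b i j = if (i ≡ᵇ a) ∧ (j ≡ᵇ b) then + 1 else + 0

  if-scale : ∀ c (b : Bool) → (if b then c else + 0) ≡ c ℤ.* (if b then + 1 else + 0)
  if-scale c true  = sym (ℤₚ.*-identityʳ c)
  if-scale c false = sym (ℤₚ.*-zeroʳ c)

  coeff-pair : ∀ p a b → coeffP p a b ≡ pair p (δ a b)
  coeff-pair [] a b = refl
  coeff-pair ((c , i , j) ∷ p) a b =
    cong₂ ℤ._+_ (if-scale c ((i ≡ᵇ a) ∧ (j ≡ᵇ b))) (coeff-pair p a b)

  pair-cong : ∀ p {φ ψ} → (∀ i j → φ i j ≡ ψ i j) → pair p φ ≡ pair p ψ
  pair-cong [] h = refl
  pair-cong ((c , i , j) ∷ p) h = cong₂ ℤ._+_ (cong (c ℤ.*_) (h i j)) (pair-cong p h)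

  pair-++ : ∀ p r φ → pair (p ++ r) φ ≡ pair p φ ℤ.+ pair r φ
  pair-++ [] r φ = sym (ℤₚ.+-identityˡ _)
  pair-++ ((c , i , j) ∷ p) r φ =
    trans (cong (ℤ._+_ (c ℤ.* φ i j)) (pair-++ p r φ)) (sym (ℤₚ.+-assoc (c ℤ.* φ i j) _ _))

  pair-0 : ∀ p → pair p (λ _ _ → + 0) ≡ + 0
  pair-0 [] = refl
  pair-0 ((c , i , j) ∷ p) = cong₂ ℤ._+_ (ℤₚ.*-zeroʳ c) (pair-0 p)

  private
    lin-step : ∀ c d x y u v → c ℤ.* (x ℤ.+ d ℤ.* y) ℤ.+ (u ℤ.+ d ℤ.* v) ≡ (c ℤ.* x ℤ.+ u) ℤ.+ d ℤ.* (c ℤ.* y ℤ.+ v)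
    lin-step = ℤS.solve-∀

  pair-lin : ∀ p d φ ψ → pair p (λ i j → φ i j ℤ.+ d ℤ.* ψ i j) ≡ pair p φ ℤ.+ d ℤ.* pair p ψ
  pair-lin [] d φ ψ = sym (trans (ℤₚ.+-identityˡ _) (ℤₚ.*-zeroʳ d))
  pair-lin ((c , i , j) ∷ p) d φ ψ =
    trans (cong (ℤ._+_ (c ℤ.* (φ i j ℤ.+ d ℤ.* ψ i j))) (pair-lin p d φ ψ)) (lin-step c d (φ i j) (ψ i j) (pair p φ) (pair p ψ))

  pair-scale : ∀ p d ψ → pair p (λ i j → d ℤ.* ψ i j) ≡ d ℤ.* pair p ψ
  pair-scale p d ψ =
    trans (pair-cong p (λ i j → sym (ℤₚ.+-identityˡ _)))
      (trans (pair-lin p d (λ _ _ → + 0) ψ)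
        (trans (cong (ℤ._+ d ℤ.* pair p ψ) (pair-0 p)) (ℤₚ.+-identityˡ _)))

  pair-add : ∀ p φ ψ → pair p (λ i j → φ i j ℤ.+ ψ i j) ≡ pair p φ ℤ.+ pair p ψ
  pair-add p φ ψ =
    trans (pair-cong p (λ i j → cong (ℤ._+_ (φ i j)) (sym (ℤₚ.*-identityˡ _))))
      (trans (pair-lin p (+ 1) φ ψ) (cong (ℤ._+_ (pair p φ)) (ℤₚ.*-identityˡ _)))

  pair-swap : ∀ p r (ψ : ℕ → ℕ → ℕ → ℕ → ℤ) →
    pair p (λ i j → pair r (ψ i j)) ≡ pair r (λ k l → pair p (λ i j → ψ i j k l))
  pair-swap [] r ψ = sym (pair-0 r)
  pair-swap ((c , i , j) ∷ p) r ψ = begin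
    c ℤ.* pair r (ψ i j) ℤ.+ pair p (λ i j → pair r (ψ i j))
      ≡⟨ cong₂ ℤ._+_ (sym (pair-scale r c (ψ i j))) (pair-swap p r ψ) ⟩
    pair r (λ k l → c ℤ.* ψ i j k l) ℤ.+ pair r (λ k l → pair p (λ i j → ψ i j k l))
      ≡⟨ sym (pair-add r _ _) ⟩
    pair r (λ k l → pair ((c , i , j) ∷ p) (λ i j → ψ i j k l)) ∎
    where open ≡-Reasoning

  shift : (ℕ → ℕ → ℤ) → ℕ → ℕ → ℕ → ℕ → ℤ
  shift φ i j k l = φ (i ℕ.+ k) (j ℕ.+ l)

  pair-monomial : ∀ c i j r φ →
    pair (map (λ { (d , a' , b') → (c ℤ.* d , i ℕ.+ a' , j ℕ.+ b') }) r) φ ≡ c ℤ.* pair r (shift φ i j)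
  pair-monomial c i j [] φ = sym (ℤₚ.*-zeroʳ c)
  pair-monomial c i j ((d , k , l) ∷ r) φ =
    trans (cong₂ ℤ._+_ (ℤₚ.*-assoc c d _) (pair-monomial c i j r φ)) (sym (ℤₚ.*-distribˡ-+ c _ _))

  pair-* : ∀ p r φ → pair (p *P r) φ ≡ pair p (λ i j → pair r (shift φ i j))
  pair-* [] r φ = refl
  pair-* ((c , i , j) ∷ p) r φ =
    trans (pair-++ (map _ r) (p *P r) φ) (cong₂ ℤ._+_ (pair-monomial c i j r φ) (pair-* p r φ))

  range : ℕ → (ℕ → ℤ) → ℤ
  range zero f = + 0
  range (suc n) f = f n ℤ.+ range n f

  range-0 : ∀ n f → (∀ i → i < n → f i ≡ + 0) → range n f ≡ + 0
  range-0 zero f h = refl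
  range-0 (suc n) f h = cong₂ ℤ._+_ (h n ℕₚ.≤-refl) (range-0 n f (λ i l → h i (ℕₚ.m≤n⇒m≤1+n l)))

  range-add : ∀ n f g → range n (λ i → f i ℤ.+ g i) ≡ range n f ℤ.+ range n g
  range-add zero f g = refl
  range-add (suc n) f g = trans (cong (ℤ._+_ (f n ℤ.+ g n)) (range-add n f g)) (mid (f n) (g n) _ _)
    where
    mid : ∀ a b c d → (a ℤ.+ b) ℤ.+ (c ℤ.+ d) ≡ (a ℤ.+ c) ℤ.+ (b ℤ.+ d)
    mid = ℤS.solve-∀

  range-cong : ∀ n {f g} → (∀ i → f i ≡ g i) → range n f ≡ range n g
  range-cong zero h = refl
  range-cong (suc n) h = cong₂ ℤ._+_ (h n) (range-cong n h)

  range-pick : ∀ n i (f : ℕ → ℤ) → i < n → (∀ k → ¬ i ≡ k → f k ≡ + 0) → range n f ≡ f i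
  range-pick (suc n) i f i<n h with i ℕ.≟ n
  ... | yes refl = trans (cong (ℤ._+_ (f n)) (range-0 n f (λ k k<n → h k (λ e → ℕₚ.<-irrefl (sym e) k<n)))) (ℤₚ.+-identityʳ _)
  ... | no i≢n = trans (cong₂ ℤ._+_ (h n i≢n) (range-pick n i f (ℕₚ.≤∧≢⇒< (ℕₚ.≤-pred i<n) i≢n) h)) (ℤₚ.+-identityˡ _)

  InBox : ℕ → ℕ → Pqt → Set
  InBox A B = All (λ { (c , i , j) → i < A × j < B })

  -- A term list may repeat exponents and contain cancelling terms. Inside a finite box the pairing
  -- can be regrouped by exponents, and then only the coefficients are left.
  box-sum : ∀ A B p φ → InBox A B p → pair p φ ≡ range A (λ a → range B (λ b → coeffP p a b ℤ.* φ a b))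
  box-sum A B [] φ [] = sym (range-0 A _ (λ i _ → range-0 B _ (λ j _ → refl)))
  box-sum A B ((c , i , j) ∷ p) φ ((i<A , j<B) ∷ h) = begin
    c ℤ.* φ i j ℤ.+ pair p φ
      ≡⟨ cong₂ ℤ._+_ (sym single) (box-sum A B p φ h) ⟩
    range A (λ a → range B (g a)) ℤ.+ range A (λ a → range B (λ b → coeffP p a b ℤ.* φ a b))
      ≡⟨ sym (range-add A _ _) ⟩
    range A (λ a → range B (g a) ℤ.+ range B (λ b → coeffP p a b ℤ.* φ a b))
      ≡⟨ range-cong A (λ a → sym (range-add B _ _)) ⟩
    range A (λ a → range B (λ b → g a b ℤ.+ coeffP p a b ℤ.* φ a b))
      ≡⟨ range-cong A (λ a → range-cong B (λ b → sym (ℤₚ.*-distribʳ-+ (φ a b) (if (i ≡ᵇ a) ∧ (j ≡ᵇ b) then c else + 0) (coeffP p a b)))) ⟩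
    range A (λ a → range B (λ b → coeffP ((c , i , j) ∷ p) a b ℤ.* φ a b)) ∎
    where
    open ≡-Reasoning
    g : ℕ → ℕ → ℤ
    g a b = (if (i ≡ᵇ a) ∧ (j ≡ᵇ b) then c else + 0) ℤ.* φ a b
    single : range A (λ a → range B (g a)) ≡ c ℤ.* φ i j
    single = trans (range-pick A i _ i<A (λ k i≢k → range-0 B _ (λ b _ →
                 cong (λ z → (if z ∧ (j ≡ᵇ b) then c else + 0) ℤ.* φ k b) (≡ᵇ-≢ i≢k))))
             (trans (range-pick B j _ j<B (λ k j≢k →
                 trans (cong₂ (λ y z → (if y ∧ z then c else + 0) ℤ.* φ i k) (≡ᵇ-yes i) (≡ᵇ-≢ j≢k)) refl))
               (cong₂ (λ y z → (if y ∧ z then c else + 0) ℤ.* φ i j) (≡ᵇ-yes i) (≡ᵇ-yes j)))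

  inBox-mono : ∀ {A B A' B'} p → A ≤ A' → B ≤ B' → InBox A B p → InBox A' B' p
  inBox-mono [] _ _ [] = []
  inBox-mono (_ ∷ p) hA hB ((x , y) ∷ h) = (ℕₚ.≤-trans x hA , ℕₚ.≤-trans y hB) ∷ inBox-mono p hA hB h

  box : ∀ p → Σ ℕ λ A → Σ ℕ λ B → InBox A B p
  box [] = 0 , 0 , []
  box ((c , i , j) ∷ p) with box p
  ... | A , B , h = suc i ℕ.+ A , suc j ℕ.+ B ,
        (ℕₚ.m≤m+n (suc i) A , ℕₚ.m≤m+n (suc j) B) ∷ inBox-mono p (ℕₚ.m≤n+m A (suc i)) (ℕₚ.m≤n+m B (suc j)) h

  pair-local : ∀ p φ ψ → (∀ i j → coeffP p i j ≡ + 0 ⊎ φ i j ≡ ψ i j) → pair p φ ≡ pair p ψ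
  pair-local p φ ψ h with box p
  ... | A , B , inb = trans (box-sum A B p φ inb)
          (trans (range-cong A (λ a → range-cong B (λ b → eq a b))) (sym (box-sum A B p ψ inb)))
    where
    eq : ∀ a b → coeffP p a b ℤ.* φ a b ≡ coeffP p a b ℤ.* ψ a b
    eq a b with h a b
    ... | inj₁ z = trans (cong (ℤ._* φ a b) z) (sym (cong (ℤ._* ψ a b) z))
    ... | inj₂ e = cong (coeffP p a b ℤ.*_) e

  coeff-outside : ∀ p A B → InBox A B p → ∀ i j → A ≤ i ⊎ B ≤ j → coeffP p i j ≡ + 0
  coeff-outside [] A B [] i j o = refl
  coeff-outside ((c , i' , j') ∷ p) A B ((x , y) ∷ h) i j o =
    cong₂ ℤ._+_ (head o) (coeff-outside p A B h i j o)
    where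
    head : A ≤ i ⊎ B ≤ j → (if (i' ≡ᵇ i) ∧ (j' ≡ᵇ j) then c else + 0) ≡ + 0
    head (inj₁ A≤i) = cong (λ z → if z ∧ (j' ≡ᵇ j) then c else + 0) (≡ᵇ-≢ (ℕₚ.<⇒≢ (ℕₚ.≤-trans x A≤i)))
    head (inj₂ B≤j) = trans (cong (λ z → if (i' ≡ᵇ i) ∧ z then c else + 0) (≡ᵇ-≢ (ℕₚ.<⇒≢ (ℕₚ.≤-trans y B≤j))))
                        (cong (λ z → if z then c else + 0) (𝔹ₚ.∧-zeroʳ (i' ≡ᵇ i)))

  coeff-++ : ∀ p r a b → coeffP (p ++ r) a b ≡ coeffP p a b ℤ.+ coeffP r a b
  coeff-++ p r a b = trans (coeff-pair (p ++ r) a b)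
    (trans (pair-++ p r (δ a b)) (sym (cong₂ ℤ._+_ (coeff-pair p a b) (coeff-pair r a b))))

  negP : Pqt → Pqt
  negP = map (λ { (c , i , j) → (ℤ.- c , i , j) })

  pair-neg : ∀ p φ → pair (negP p) φ ≡ ℤ.- pair p φ
  pair-neg [] φ = refl
  pair-neg ((c , i , j) ∷ p) φ =
    trans (cong₂ ℤ._+_ (sym (ℤₚ.neg-distribˡ-* c (φ i j))) (pair-neg p φ)) (sym (ℤₚ.neg-distrib-+ (c ℤ.* φ i j) _))

  -- All coefficients of the difference vanish, so `pair-local` allows it to be tested against the
  -- zero function instead of φ.
  ≈P-pair : ∀ {p r} → p ≈P r → ∀ φ → pair p φ ≡ pair r φ
  ≈P-pair {p} {r} h φ = ℤₚ.i-j≡0⇒i≡j (pair p φ) (pair r φ) (begin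
    pair p φ ℤ.- pair r φ ≡⟨ cong (ℤ._+_ (pair p φ)) (sym (pair-neg r φ)) ⟩
    pair p φ ℤ.+ pair (negP r) φ ≡⟨ sym (pair-++ p (negP r) φ) ⟩
    pair (p ++ negP r) φ ≡⟨ pair-local (p ++ negP r) φ (λ _ _ → + 0) (λ i j → inj₁ (z i j)) ⟩
    pair (p ++ negP r) (λ _ _ → + 0) ≡⟨ pair-0 (p ++ negP r) ⟩
    + 0 ∎)
    where
    open ≡-Reasoning
    z : ∀ i j → coeffP (p ++ negP r) i j ≡ + 0
    z i j = trans (coeff-++ p (negP r) i j)
      (trans (cong₂ ℤ._+_ (h i j) (trans (coeff-pair (negP r) i j) (trans (pair-neg r _) (cong ℤ.-_ (sym (coeff-pair r i j))))))
        (ℤₚ.+-inverseʳ (coeffP r i j)))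

  pair-≈P : ∀ {p r} → (∀ φ → pair p φ ≡ pair r φ) → p ≈P r
  pair-≈P {p} {r} h a b = trans (coeff-pair p a b) (trans (h (δ a b)) (sym (coeff-pair r a b)))

  *P-cong : ∀ {p p' r r'} → p ≈P p' → r ≈P r' → (p *P r) ≈P (p' *P r')
  *P-cong {p} {p'} {r} {r'} hp hr = pair-≈P {p *P r} {p' *P r'} λ φ →
    trans (pair-* p r φ) (trans (≈P-pair {p} {p'} hp _)
      (trans (pair-cong p' (λ i j → ≈P-pair {r} {r'} hr _)) (sym (pair-* p' r' φ))))

  *P-comm : ∀ p r → (p *P r) ≈P (r *P p)
  *P-comm p r = pair-≈P {p *P r} {r *P p} λ φ →
    trans (pair-* p r φ) (trans (pair-swap p r (shift φ))
      (trans (pair-cong r (λ k l → pair-cong p (λ i j → cong₂ φ (ℕₚ.+-comm i k) (ℕₚ.+-comm j l)))) (sym (pair-* r p φ))))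

  *P-assoc : ∀ p r s → ((p *P r) *P s) ≈P (p *P (r *P s))
  *P-assoc p r s = pair-≈P {(p *P r) *P s} {p *P (r *P s)} λ φ →
    trans (pair-* (p *P r) s φ) (trans (pair-* p r _)
      (trans (pair-cong p (λ i j → trans (pair-cong r (λ k l → pair-cong s (λ m n → cong₂ φ (ℕₚ.+-assoc i k m) (ℕₚ.+-assoc j l n))))
                                      (sym (pair-* r s (shift φ i j)))))
        (sym (pair-* p (r *P s) φ))))

  *P-distribʳ : ∀ s p r → ((p ++ r) *P s) ≈P ((p *P s) ++ (r *P s))
  *P-distribʳ s p r = pair-≈P {(p ++ r) *P s} {(p *P s) ++ (r *P s)} λ φ →
    trans (pair-* (p ++ r) s φ) (trans (pair-++ p r _)
      (sym (trans (pair-++ (p *P s) (r *P s) φ) (cong₂ ℤ._+_ (pair-* p s φ) (pair-* r s φ)))))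

  *P-identityˡ : ∀ p → (constP (+ 1) *P p) ≈P p
  *P-identityˡ p = pair-≈P {constP (+ 1) *P p} {p} λ φ →
    trans (pair-* (constP (+ 1)) p φ) (trans (ℤₚ.+-identityʳ _) (ℤₚ.*-identityˡ _))

  +P-cong : ∀ {p p' r r'} → p ≈P p' → r ≈P r' → (p ++ r) ≈P (p' ++ r')
  +P-cong {p} {p'} {r} {r'} hp hr a b =
    trans (coeff-++ p r a b) (trans (cong₂ ℤ._+_ (hp a b) (hr a b)) (sym (coeff-++ p' r' a b)))

  +P-comm : ∀ p r → (p ++ r) ≈P (r ++ p)
  +P-comm p r a b = trans (coeff-++ p r a b) (trans (ℤₚ.+-comm (coeffP p a b) _) (sym (coeff-++ r p a b)))

  coeff-neg : ∀ p a b → coeffP (negP p) a b ≡ ℤ.- coeffP p a b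
  coeff-neg p a b = trans (coeff-pair (negP p) a b) (trans (pair-neg p _) (cong ℤ.-_ (sym (coeff-pair p a b))))

  negP-inverseˡ : ∀ p → (negP p ++ p) ≈P []
  negP-inverseˡ p a b = trans (coeff-++ (negP p) p a b)
    (trans (cong (ℤ._+ coeffP p a b) (coeff-neg p a b)) (ℤₚ.+-inverseˡ (coeffP p a b)))

  -- A record rather than _≈P_ itself, so that the two sides can be inferred from a proof.
  infix 4 _≋_
  record _≋_ (p r : Pqt) : Set where
    constructor eqP
    field coeffs : p ≈P r
  open _≋_ public

  polyRing : CommutativeRing 0ℓ 0ℓ
  polyRing = record
    { Carrier = Pqt ; _≈_ = _≋_ ; _+_ = _+P_ ; _*_ = _*P_ ; -_ = negP ; 0# = [] ; 1# = constP (+ 1)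
    ; isCommutativeRing = record
      { isRing = record
        { +-isAbelianGroup = record
          { isGroup = record
            { isMonoid = record
              { isSemigroup = record
                { isMagma = record
                  { isEquivalence = record
                    { refl = eqP λ _ _ → refl
                    ; sym = λ h → eqP λ a b → sym (coeffs h a b)
                    ; trans = λ h k → eqP λ a b → trans (coeffs h a b) (coeffs k a b) }
                  ; ∙-cong = λ {p} {p'} {r} {r'} h k → eqP (+P-cong {p} {p'} {r} {r'} (coeffs h) (coeffs k)) }
                ; assoc = λ p r s → eqP λ a b → cong (λ z → coeffP z a b) (Lₚ.++-assoc p r s) }
              ; identity = (λ p → eqP λ a b → refl) , (λ p → eqP λ a b → trans (coeff-++ p [] a b) (ℤₚ.+-identityʳ _)) }
            ; inverse = (λ p → eqP (negP-inverseˡ p)) , (λ p → eqP λ a b → trans (+P-comm p (negP p) a b) (negP-inverseˡ p a b))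
            ; ⁻¹-cong = λ {p} {r} h → eqP λ a b → trans (coeff-neg p a b) (trans (cong ℤ.-_ (coeffs h a b)) (sym (coeff-neg r a b))) }
          ; comm = λ p r → eqP (+P-comm p r) }
        ; *-cong = λ {p} {p'} {r} {r'} h k → eqP (*P-cong {p} {p'} {r} {r'} (coeffs h) (coeffs k))
        ; *-assoc = λ p r s → eqP (*P-assoc p r s)
        ; *-identity = (λ p → eqP (*P-identityˡ p))
                     , (λ p → eqP λ a b → trans (*P-comm p (constP (+ 1)) a b) (*P-identityˡ p a b))
        ; distrib = (λ s p r → eqP λ a b → trans (*P-comm s (p ++ r) a b) (trans (*P-distribʳ s p r a b)
                        (+P-cong {p *P s} {s *P p} {r *P s} {s *P r} (*P-comm p s) (*P-comm r s) a b)))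
                  , (λ s p r → eqP (*P-distribʳ s p r)) }
      ; *-comm = λ p r → eqP (*P-comm p r) } }

  -- Coefficients of products, and the absence of zero divisors

  δ-shift : ∀ i j k₀ l₀ k l → δ (i ℕ.+ k₀) (j ℕ.+ l₀) (i ℕ.+ k) (j ℕ.+ l) ≡ δ k₀ l₀ k l
  δ-shift zero zero k₀ l₀ k l = refl
  δ-shift zero (suc j) k₀ l₀ k l = δ-shift zero j k₀ l₀ k l
  δ-shift (suc i) j k₀ l₀ k l = δ-shift i j k₀ l₀ k l

  shifted-coeff : ∀ r i j k l → pair r (shift (δ (i ℕ.+ k) (j ℕ.+ l)) i j) ≡ coeffP r k l
  shifted-coeff r i j k l = trans (pair-cong r (δ-shift i j k l)) (sym (coeff-pair r k l))

  private
    overshoot : ∀ {a i} → a < i → ∀ k → (i ℕ.+ k ≡ᵇ a) ≡ false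
    overshoot {a} {i} a<i k = ≡ᵇ-≢ (λ e → ℕₚ.<⇒≱ a<i (subst (i ≤_) e (ℕₚ.m≤m+n i k)))

  shifted-coeff-0ˡ : ∀ r a b i j → a < i → pair r (shift (δ a b) i j) ≡ + 0
  shifted-coeff-0ˡ r a b i j a<i = trans (pair-cong r (λ k l →
    cong (λ z → if z ∧ (j ℕ.+ l ≡ᵇ b) then + 1 else + 0) (overshoot a<i k))) (pair-0 r)

  shifted-coeff-0ʳ : ∀ r a b i j → b < j → pair r (shift (δ a b) i j) ≡ + 0
  shifted-coeff-0ʳ r a b i j b<j = trans (pair-cong r (λ k l →
    trans (cong (λ z → if (i ℕ.+ k ≡ᵇ a) ∧ z then + 1 else + 0) (overshoot b<j l))
          (cong (λ z → if z then + 1 else + 0) (𝔹ₚ.∧-zeroʳ (i ℕ.+ k ≡ᵇ a))))) (pair-0 r)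

  coeff-* : ∀ p r a b → coeffP (p *P r) a b ≡ pair p (λ i j → pair r (shift (δ a b) i j))
  coeff-* p r a b = trans (coeff-pair (p *P r) a b) (pair-* p r (δ a b))

  shifted-case : ∀ r a b i j →
    (a < i ⊎ b < j) × pair r (shift (δ a b) i j) ≡ + 0
    ⊎ (Σ ℕ λ k → Σ ℕ λ l → i ℕ.+ k ≡ a × j ℕ.+ l ≡ b × pair r (shift (δ a b) i j) ≡ coeffP r k l)
  shifted-case r a b i j with i ℕ.≤? a | j ℕ.≤? b
  ... | no i≰a | _ = inj₁ (inj₁ (ℕₚ.≰⇒> i≰a) , shifted-coeff-0ˡ r a b i j (ℕₚ.≰⇒> i≰a))
  ... | yes _ | no j≰b = inj₁ (inj₂ (ℕₚ.≰⇒> j≰b) , shifted-coeff-0ʳ r a b i j (ℕₚ.≰⇒> j≰b))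
  ... | yes i≤a | yes j≤b = inj₂ (a ∸ i , b ∸ j , ea , eb ,
      trans (cong₂ (λ x y → pair r (shift (δ x y) i j)) (sym ea) (sym eb)) (shifted-coeff r i j (a ∸ i) (b ∸ j)))
    where
    ea = ℕₚ.m+[n∸m]≡n i≤a
    eb = ℕₚ.m+[n∸m]≡n j≤b

  -- With Q saying that coefficients vanish and n taken from a box, this finds the largest exponent
  -- present: first among the powers of q, then among the powers of t beside that power of q.
  last-failure : ∀ (Q : ℕ → Set) → (∀ a → Q a ⊎ ¬ Q a) → ∀ n → (∀ a → n ≤ a → Q a) →
    (∀ a → Q a) ⊎ (Σ ℕ λ A → ¬ Q A × (∀ a → A < a → Q a))
  last-failure Q Q? zero h = inj₁ (λ a → h a z≤n)
  last-failure Q Q? (suc n) h with Q? n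
  ... | inj₂ ¬q = inj₂ (n , ¬q , h)
  ... | inj₁ q = last-failure Q Q? n (λ a n≤a → split n≤a (n ℕ.≟ a))
    where
    split : ∀ {a} → n ≤ a → Dec (n ≡ a) → Q a
    split n≤a (yes refl) = q
    split n≤a (no n≢a) = h _ (ℕₚ.≤∧≢⇒< n≤a n≢a)

  -- The leading term for the lexicographic order on exponents.
  Leading : Pqt → Set
  Leading p = Σ ℕ λ A → Σ ℕ λ B →
    ¬ coeffP p A B ≡ + 0 × (∀ a b → A < a → coeffP p a b ≡ + 0) × (∀ b → B < b → coeffP p A b ≡ + 0)

  zero-or-leading : ∀ p → p ≈P [] ⊎ Leading p
  zero-or-leading p with box p
  ... | A₀ , B₀ , inb = result (last-failure (λ a → ∀ b → coeffP p a b ≡ + 0) row-dec A₀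
                                  (λ a le b → coeff-outside p A₀ B₀ inb a b (inj₁ le)))
    where
    row : ∀ a → (∀ b → coeffP p a b ≡ + 0) ⊎ (Σ ℕ λ B → ¬ coeffP p a B ≡ + 0 × (∀ b → B < b → coeffP p a b ≡ + 0))
    row a = last-failure (λ b → coeffP p a b ≡ + 0) (λ b → dec (coeffP p a b ℤ.≟ + 0)) B₀
              (λ b le → coeff-outside p A₀ B₀ inb a b (inj₂ le))
      where
      dec : ∀ {X : Set} → Dec X → X ⊎ ¬ X
      dec (yes x) = inj₁ x
      dec (no x) = inj₂ x
    row-dec : ∀ a → (∀ b → coeffP p a b ≡ + 0) ⊎ ¬ (∀ b → coeffP p a b ≡ + 0)
    row-dec a with row a
    ... | inj₁ z = inj₁ z
    ... | inj₂ (B , nz , _) = inj₂ (λ z → nz (z B))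
    result : _ → p ≈P [] ⊎ Leading p
    result (inj₁ z) = inj₁ z
    result (inj₂ (A , nz , above)) with row A
    ... | inj₁ z = ⊥-elim (nz z)
    ... | inj₂ (B , nzB , aboveB) = inj₂ (A , B , nzB , (λ a b l → above a l b) , aboveB)

  ≈P0? : ∀ p → p ≈P [] ⊎ ¬ (p ≈P [])
  ≈P0? p with zero-or-leading p
  ... | inj₁ z = inj₁ z
  ... | inj₂ (A , B , nz , _) = inj₂ (λ z → nz (z A B))

  -- At the sum of the leading exponents only the two leading terms meet: a lexicographically
  -- smaller term of p would need a term of r beyond the leading one.
  leading-* : ∀ p r (lp : Leading p) (lr : Leading r) →
    coeffP (p *P r) (proj₁ lp ℕ.+ proj₁ lr) (proj₁ (proj₂ lp) ℕ.+ proj₁ (proj₂ lr))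
      ≡ coeffP r (proj₁ lr) (proj₁ (proj₂ lr)) ℤ.* coeffP p (proj₁ lp) (proj₁ (proj₂ lp))
  leading-* p r (A , B , _ , p₁ , p₂) (A' , B' , _ , r₁ , r₂) =
    trans (coeff-* p r _ _) (trans (pair-local p _ (λ i j → coeffP r A' B' ℤ.* δ A B i j) local)
      (trans (pair-scale p (coeffP r A' B') (δ A B)) (cong (ℤ._*_ (coeffP r A' B')) (sym (coeff-pair p A B)))))
    where
    off : ∀ i j → (i ≡ᵇ A) ∧ (j ≡ᵇ B) ≡ false → coeffP r A' B' ℤ.* δ A B i j ≡ + 0
    off i j e = trans (cong (λ z → coeffP r A' B' ℤ.* (if z then + 1 else + 0)) e) (ℤₚ.*-zeroʳ (coeffP r A' B'))
    offˡ : ∀ i j → ¬ i ≡ A → (i ≡ᵇ A) ∧ (j ≡ᵇ B) ≡ false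
    offˡ i j h = cong (_∧ (j ≡ᵇ B)) (≡ᵇ-≢ h)
    offʳ : ∀ i j → ¬ j ≡ B → (i ≡ᵇ A) ∧ (j ≡ᵇ B) ≡ false
    offʳ i j h = trans (cong ((i ≡ᵇ A) ∧_) (≡ᵇ-≢ h)) (𝔹ₚ.∧-zeroʳ (i ≡ᵇ A))
    on : ∀ k l → coeffP r k l ≡ coeffP r A' B' → coeffP r k l ≡ coeffP r A' B' ℤ.* δ A B A B
    on k l e = trans e (sym (trans (cong₂ (λ y z → coeffP r A' B' ℤ.* (if y ∧ z then + 1 else + 0)) (≡ᵇ-yes A) (≡ᵇ-yes B)) (ℤₚ.*-identityʳ _)))
    local : ∀ i j → coeffP p i j ≡ + 0 ⊎ pair r (shift (δ (A ℕ.+ A') (B ℕ.+ B')) i j) ≡ coeffP r A' B' ℤ.* δ A B i j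
    local i j with ℕₚ.<-cmp i A
    ... | tri> _ _ A<i = inj₁ (p₁ i j A<i)

    ... | tri< i<A i≢A _ with shifted-case r (A ℕ.+ A') (B ℕ.+ B') i j
    ...   | inj₁ (_ , z) = inj₂ (trans z (sym (off i j (offˡ i j i≢A))))
    ...   | inj₂ (k , l , ek , el , e) = inj₂ (trans e (trans (r₁ k l A'<k) (sym (off i j (offˡ i j i≢A)))))
      where
      A'<k : A' < k
      A'<k = ℕₚ.+-cancelˡ-< i A' k (subst (i ℕ.+ A' <_) (sym ek) (ℕₚ.+-monoˡ-< A' i<A))
    local i j | tri≈ _ refl _ with ℕₚ.<-cmp j B
    ... | tri> _ _ B<j = inj₁ (p₂ j B<j)
    ... | tri< j<B j≢B _ with shifted-case r (A ℕ.+ A') (B ℕ.+ B') i j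
    ...   | inj₁ (_ , z) = inj₂ (trans z (sym (off i j (offʳ i j j≢B))))
    ...   | inj₂ (k , l , ek , el , e) = inj₂ (trans e (trans (cong (λ z → coeffP r z l) (ℕₚ.+-cancelˡ-≡ i k A' ek))
                                            (trans (r₂ l B'<l) (sym (off i j (offʳ i j j≢B))))))
      where
      B'<l : B' < l
      B'<l = ℕₚ.+-cancelˡ-< j B' l (subst (j ℕ.+ B' <_) (sym el) (ℕₚ.+-monoˡ-< B' j<B))
    local i j | tri≈ _ refl _ | tri≈ _ refl _ = inj₂ (trans (shifted-coeff r i j A' B') (on A' B' refl))

  *P-domain : ∀ p r → (p *P r) ≈P [] → ¬ (r ≈P []) → p ≈P []
  *P-domain p r h r≉0 with zero-or-leading p | zero-or-leading r
  ... | inj₁ z | _ = z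
  ... | inj₂ lp | inj₁ z = ⊥-elim (r≉0 z)
  ... | inj₂ lp | inj₂ lr with ℤₚ.i*j≡0⇒i≡0∨j≡0 (coeffP r _ _) (trans (sym (leading-* p r lp lr)) (h _ _))
  ...   | inj₁ z = ⊥-elim (proj₁ (proj₂ (proj₂ lr)) z)
  ...   | inj₂ z = ⊥-elim (proj₁ (proj₂ (proj₂ lp)) z)

  ≋-domain : ∀ {p r} → p *P r ≋ [] → ¬ r ≋ [] → p ≋ []
  ≋-domain {p} {r} h r≉0 = eqP (*P-domain p r (coeffs h) (r≉0 ∘ eqP))

  ≋0? : ∀ p → p ≋ [] ⊎ ¬ p ≋ []
  ≋0? p with ≈P0? p
  ... | inj₁ z = inj₁ (eqP z)
  ... | inj₂ nz = inj₂ (nz ∘ coeffs)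

  -- This removes the power of q by which the product over pairs differs from the weight of a
  -- filling.
  shift-cancel : ∀ c {p r} → qt^ c 0 *P p ≋ qt^ c 0 *P r → p ≋ r
  shift-cancel c {p} {r} (eqP h) = eqP λ a b → trans (sym (lower p a b)) (trans (h (c ℕ.+ a) b) (lower r a b))
    where
    lower : ∀ p a b → coeffP (qt^ c 0 *P p) (c ℕ.+ a) b ≡ coeffP p a b
    lower p a b = trans (coeff-* (qt^ c 0) p (c ℕ.+ a) b)
      (trans (ℤₚ.+-identityʳ _) (trans (ℤₚ.*-identityˡ _) (shifted-coeff p c 0 a b)))

open ≡ using (refl; sym; trans)
open import Data.Nat using (_+_; _*_)
open import Data.Integer using () renaming (+_ to int)
open PolynomialRing
module P = CommutativeRing polyRing
open P using (_≈_)
open RingSums polyRing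
open SeriesRing polyRing
open import Algebra.Properties.Ring P.ring using (-‿distribˡ-*; x∙y⁻¹≈ε⇒x≈y)

-- Cells and their attacking pairs

-- A cell is (column, row counted from the top, leg + 1, arm).
Cell : Set
Cell = ℕ × ℕ × ℕ × ℕ

-- The reading order: rows from the top down, each from left to right.
_≺_ : Cell → Cell → Set
(i , h , _) ≺ (i' , h' , _) = h < h' ⊎ (h ≡ h' × i < i')

-- The factor q^arm of a non-descent compensates the subtraction of arms in inv,
-- at the price of an overall power of q that depends on the shape only.
kind : Cell → Cell → Kind Pqt
kind (i , h , leg , arm) (i' , h' , _) =
  if h ≡ᵇ h' then att else
  if suc h ≡ᵇ h' then (if i' <ᵇ i then att else if i' ≡ᵇ i then gen (qt^ 0 leg) (qt^ arm 0) else free) else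
  free

kind-row : ∀ {u v : Cell} → proj₁ (proj₂ u) ≡ proj₁ (proj₂ v) → kind u v ≡ att
kind-row {_ , h , _} refl rewrite ≡ᵇ-yes h = refl

suc-≢ : ∀ h → (h ≡ᵇ suc h) ≡ false
suc-≢ h = ≡ᵇ-≢ {h} {suc h} (ℕₚ.1+n≢n ∘ sym)

kind-left : ∀ {u v : Cell} → suc (proj₁ (proj₂ u)) ≡ proj₁ (proj₂ v) → proj₁ v < proj₁ u → kind u v ≡ att
kind-left {i , h , _} {i' , _} refl l rewrite suc-≢ h | ≡ᵇ-yes h | <ᵇ-yes l = refl

kind-below : ∀ i h leg arm r → kind (i , h , leg , arm) (i , suc h , r) ≡ gen (qt^ 0 leg) (qt^ arm 0)
kind-below i h leg arm r rewrite suc-≢ h | ≡ᵇ-yes h | <ᵇ-no (ℕₚ.≤-refl {i}) | ≡ᵇ-yes i = refl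

kind-right : ∀ {u v : Cell} → suc (proj₁ (proj₂ u)) ≡ proj₁ (proj₂ v) → proj₁ u < proj₁ v → kind u v ≡ free
kind-right {i , h , _} {i' , _} refl l
  rewrite suc-≢ h | ≡ᵇ-yes h | <ᵇ-no (ℕₚ.<⇒≤ l) | ≡ᵇ-≢ {i'} {i} (λ e → ℕₚ.<-irrefl (sym e) l) = refl

kind-far : ∀ {u v : Cell} → suc (proj₁ (proj₂ u)) < proj₁ (proj₂ v) → kind u v ≡ free
kind-far {i , h , _} {i' , h' , _} l
  rewrite ≡ᵇ-≢ {h} {h'} (ℕₚ.<⇒≢ (ℕₚ.<-trans (ℕₚ.n<1+n h) l)) | ≡ᵇ-≢ {suc h} {h'} (ℕₚ.<⇒≢ l) = refl

nonfree : ∀ {u w : Cell} → u ≺ w → kind u w ≢ free →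
  proj₁ (proj₂ u) ≡ proj₁ (proj₂ w) ⊎ (suc (proj₁ (proj₂ u)) ≡ proj₁ (proj₂ w) × proj₁ w ≤ proj₁ u)
nonfree (inj₂ (e , _)) nf = inj₁ e
nonfree {u} {w} (inj₁ l) nf with suc (proj₁ (proj₂ u)) ℕ.≟ proj₁ (proj₂ w)
... | no ne = ⊥-elim (nf (kind-far {u} {w} (ℕₚ.≤∧≢⇒< l ne)))
... | yes e with proj₁ w ℕ.≤? proj₁ u
...   | yes le = inj₂ (e , le)
...   | no nle = ⊥-elim (nf (kind-right {u} {w} e (ℕₚ.≰⇒> nle)))

-- By `nonfree`, w lies in the row of u, or in the next row weakly left of u. In the first case v
-- lies in that row too. In the second, v lies either right of u in its row, hence strictly right of
-- w, or left of w in the row of w, hence strictly left of u.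
chain : ∀ {u v w} → u ≺ v → v ≺ w → kind u w ≢ free → kind u v ≡ att × kind v w ≡ att
chain {u} {v} {w} uv vw nf with nonfree {u} {w} (≺-trans uv vw) nf
  where
  ≺-trans : u ≺ v → v ≺ w → u ≺ w
  ≺-trans (inj₁ a) (inj₁ b) = inj₁ (ℕₚ.<-trans a b)
  ≺-trans (inj₁ a) (inj₂ (refl , _)) = inj₁ a
  ≺-trans (inj₂ (refl , _)) (inj₁ b) = inj₁ b
  ≺-trans (inj₂ (refl , a)) (inj₂ (refl , b)) = inj₂ (refl , ℕₚ.<-trans a b)
chain {u} {v} {w} (inj₁ a) (inj₁ b) nf | inj₁ refl = ⊥-elim (ℕₚ.<-asym a b)
chain {u} {v} {w} (inj₁ a) (inj₂ (refl , _)) nf | inj₁ refl = ⊥-elim (ℕₚ.<-irrefl refl a)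
chain {u} {v} {w} (inj₂ (refl , _)) (inj₁ b) nf | inj₁ refl = ⊥-elim (ℕₚ.<-irrefl refl b)
chain {u} {v} {w} (inj₂ (e , _)) (inj₂ (e' , _)) nf | inj₁ _ = kind-row {u} {v} e , kind-row {v} {w} e'
chain {u} {v} {w} (inj₁ a) (inj₁ b) nf | inj₂ (refl , _) = ⊥-elim (ℕₚ.<⇒≱ b a)
chain {u} {v} {w} (inj₁ a) (inj₂ (refl , l)) nf | inj₂ (e , le) =
  kind-left {u} {v} e (ℕₚ.<-≤-trans l le) , kind-row {v} {w} refl
chain {u} {v} {w} (inj₂ (refl , l)) (inj₁ b) nf | inj₂ (e , le) =
  kind-row {u} {v} refl , kind-left {v} {w} e (ℕₚ.≤-<-trans le l)
chain {u} {v} {w} (inj₂ (refl , _)) (inj₂ (refl , _)) nf | inj₂ (e , _) = ⊥-elim (ℕₚ.1+n≢n e)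

qP : Pqt
qP = qt^ 1 0

open LLT polyRing Cell _≺_ qP kind (λ {u} {v} {w} → chain {u} {v} {w})
  using (wt; SumAll; cnt; Swapped; swap-letters; module N)
open N using (W; cross; column) renaming (row to rowWeight)

rowCells : ℕ → (ℕ → ℕ) → ℕ → ℕ → List Cell
rowCells h leg i zero = []
rowCells h leg i (suc n) = (i , h , leg 0 , n) ∷ rowCells h (leg ∘ suc) (suc i) n

legs : List ℕ → ℕ → ℕ
legs la i = conjAt la (suc i)

-- Shapes list the bottom row first, whereas the reading order starts at the top, so each row goes
-- after the rows above it. Its index `length la` counts the rows above and is unaffected by rows
-- added below.
cells : List ℕ → List Cell
cells [] = []
cells (r ∷ la) = cells la ++ rowCells (length la) (legs (r ∷ la)) 0 r

rowCells-row : ∀ h leg i n → All (λ c → proj₁ (proj₂ c) ≡ h × i ≤ proj₁ c) (rowCells h leg i n)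
rowCells-row h leg i zero = []
rowCells-row h leg i (suc n) = (refl , ℕₚ.≤-refl) ∷
  All.map (λ { (e , l) → e , ℕₚ.<⇒≤ l }) (rowCells-row h (leg ∘ suc) (suc i) n)

rowCells-ordered : ∀ h leg i n → AllPairs _≺_ (rowCells h leg i n)
rowCells-ordered h leg i zero = []
rowCells-ordered h leg i (suc n) =
  All.map (λ { (e , l) → inj₂ (sym e , l) }) (rowCells-row h (leg ∘ suc) (suc i) n)
  ∷ rowCells-ordered h (leg ∘ suc) (suc i) n

cells-row : ∀ la → All (λ c → proj₁ (proj₂ c) < length la) (cells la)
cells-row [] = []
cells-row (r ∷ la) = Allₚ.++⁺ (All.map ℕₚ.m≤n⇒m≤1+n (cells-row la))
  (All.map (λ { (refl , _) → ℕₚ.≤-refl }) (rowCells-row (length la) _ 0 r))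

cells-ordered : ∀ la → AllPairs _≺_ (cells la)
cells-ordered [] = []
cells-ordered (r ∷ la) = AllPairsₚ.++⁺ (cells-ordered la) (rowCells-ordered (length la) _ 0 r)
  (All.map (λ l → All.map (λ { (refl , _) → inj₁ l }) (rowCells-row (length la) _ 0 r)) (cells-row la))

flat : List ℕ → Filling → List (Cell × ℕ)
flat (r ∷ la) (w ∷ σ) = flat la σ ++ zip (rowCells (length la) (legs (r ∷ la)) 0 r) w
flat _ _ = []

data Shaped (n : ℕ) : List ℕ → Filling → Set where
  [] : Shaped n [] []
  _∷_ : ∀ {r la w σ} → length w ≡ r × All (λ x → 1 ≤ x × x ≤ n) w → Shaped n la σ → Shaped n (r ∷ la) (w ∷ σ)

upTo-bound : ∀ n → All (_< n) (upTo n)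
upTo-bound n = Allₚ.applyUpTo⁺₁ id n id

oneTo-bound : ∀ n → All (λ x → 1 ≤ x × x ≤ n) (oneTo n)
oneTo-bound n = Allₚ.map⁺ (All.map (λ l → s≤s z≤n , l) (upTo-bound n))

words-shaped : ∀ l n → All (λ w → length w ≡ l × All (λ x → 1 ≤ x × x ≤ n) w) (words l n)
words-shaped zero n = (refl , []) ∷ []
words-shaped (suc l) n = All-concatMap _ (All.map
  (λ b → Allₚ.map⁺ (All.map (λ { (e , h) → cong suc e , b ∷ h }) (words-shaped l n))) (oneTo-bound n))

fillings-shaped : ∀ la n → All (Shaped n la) (fillings la n)
fillings-shaped [] n = [] ∷ []
fillings-shaped (r ∷ la) n = All-concatMap _ (All.map
  (λ b → Allₚ.map⁺ (All.map (b ∷_) (fillings-shaped la n))) (words-shaped r n))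

length-rowCells : ∀ h leg i n → length (rowCells h leg i n) ≡ n
length-rowCells h leg i zero = refl
length-rowCells h leg i (suc n) = cong suc (length-rowCells h (leg ∘ suc) (suc i) n)

sum-words : ∀ cs n (F : List (Cell × ℕ) → Pqt) → sumL (words (length cs) n) (λ w → F (zip cs w)) ≈ SumAll (oneTo n) cs F
sum-words [] n F = P.+-identityʳ _
sum-words (c ∷ cs) n F = P.trans (sumL-concatMap (λ x → map (x ∷_) (words (length cs) n)) (oneTo n) _)
  (sumL-cong (oneTo n) (λ x → P.trans (P.reflexive (sumL-map (x ∷_) (words (length cs) n) _)) (sum-words cs n (λ u → F ((c , x) ∷ u)))))

SumAll-++ : ∀ ls cs ds F → SumAll ls (cs ++ ds) F ≈ SumAll ls cs (λ σ → SumAll ls ds (λ τ → F (σ ++ τ)))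
SumAll-++ ls [] ds F = P.refl
SumAll-++ ls (c ∷ cs) ds F = sumL-cong ls (λ x → SumAll-++ ls cs ds (λ σ → F ((c , x) ∷ σ)))

sum-fillings : ∀ la n F → sumL (fillings la n) (λ σ → F (flat la σ)) ≈ SumAll (oneTo n) (cells la) F
sum-fillings [] n F = P.+-identityʳ _
sum-fillings (r ∷ la) n F = begin
  sumL (fillings (r ∷ la) n) (λ σ → F (flat (r ∷ la) σ))
    ≈⟨ sumL-concatMap (λ w → map (w ∷_) (fillings la n)) (words r n) _ ⟩
  sumL (words r n) (λ w → sumL (map (w ∷_) (fillings la n)) (λ σ → F (flat (r ∷ la) σ)))
    ≈⟨ sumL-cong (words r n) (λ w → P.reflexive (sumL-map (w ∷_) (fillings la n) _)) ⟩
  sumL (words r n) (λ w → sumL (fillings la n) (λ σ → F (flat la σ ++ zip cs w)))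
    ≈⟨ sumL-swap (words r n) (fillings la n) _ ⟩
  sumL (fillings la n) (λ σ → sumL (words r n) (λ w → F (flat la σ ++ zip cs w)))
    ≈⟨ sumL-cong (fillings la n) (λ σ → rowsum (λ u → F (flat la σ ++ u))) ⟩
  sumL (fillings la n) (λ σ → SumAll (oneTo n) cs (λ u → F (flat la σ ++ u)))
    ≈⟨ sum-fillings la n (λ v → SumAll (oneTo n) cs (λ u → F (v ++ u))) ⟩
  SumAll (oneTo n) (cells la) (λ v → SumAll (oneTo n) cs (λ u → F (v ++ u)))
    ≈⟨ P.sym (SumAll-++ (oneTo n) (cells la) cs F) ⟩
  SumAll (oneTo n) (cells (r ∷ la)) F ∎
  where
  open import Relation.Binary.Reasoning.Setoid P.setoid
  cs = rowCells (length la) (legs (r ∷ la)) 0 r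
  rowsum : ∀ G → sumL (words r n) (λ w → G (zip cs w)) ≈ SumAll (oneTo n) cs G
  rowsum G = subst (λ k → sumL (words k n) (λ w → G (zip cs w)) ≈ SumAll (oneTo n) cs G)
    (length-rowCells (length la) (legs (r ∷ la)) 0 r) (sum-words cs n G)

-- Exponents

lsum : (ℕ → ℕ) → List ℕ → ℕ
lsum f [] = 0
lsum f (y ∷ ys) = f y + lsum f ys

-- The binomial coefficient C(n, 2): the number of pairs in a row of n cells, and also the sum of
-- the arms of that row.
tri : ℕ → ℕ
tri zero = 0
tri (suc n) = n + tri n

rowInversions : List ℕ → ℕ
rowInversions [] = 0
rowInversions (x ∷ w) = lsum (λ y → ind (y <ᵇ x)) w + rowInversions w

-- Here x' lies directly above x. A non-descent contributes the arm `length w'` of x'; the sum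
-- counts the entries right of x' that exceed x, that is, the inversions of these cells with the
-- cell of x.
qExponent : List ℕ → List ℕ → ℕ
qExponent [] _ = 0
qExponent (x' ∷ w') [] = 0
qExponent (x' ∷ w') (x ∷ w) =
  (if x <ᵇ x' then 0 else length w') + lsum (λ y → ind (x <ᵇ y)) w' + qExponent w' w

tExponent : (ℕ → ℕ) → List ℕ → List ℕ → ℕ
tExponent leg [] _ = 0
tExponent leg (x' ∷ w') [] = (if 0 <ᵇ x' then leg 0 else 0) + tExponent (leg ∘ suc) w' []
tExponent leg (x' ∷ w') (x ∷ w) = (if x <ᵇ x' then leg 0 else 0) + tExponent (leg ∘ suc) w' w

triples : List ℕ → List ℕ → ℕ
triples [] _ = 0
triples (x' ∷ w') [] = lsum (λ y → ind (invCond x' y 0)) w' + triples w' []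
triples (x' ∷ w') (x ∷ w) = lsum (λ y → ind (invCond x' y x)) w' + triples w' w

invAbove : List ℕ → Filling → ℕ
invAbove b [] = 0
invAbove b (w ∷ σ) = triples w b + invAbove w σ

majAbove : List ℕ → List ℕ → Filling → ℕ
majAbove w (r ∷ la) (w' ∷ σ) = tExponent (legs (r ∷ la)) w' w + majAbove w' la σ
majAbove w _ _ = 0

data Cmp (x y : ℕ) : Set where
  lt : (x <ᵇ y) ≡ true → (y ≤ᵇ x) ≡ false → x < y → Cmp x y
  ge : (x <ᵇ y) ≡ false → (y ≤ᵇ x) ≡ true → y ≤ x → Cmp x y

≤ᵇ-yes : ∀ {m n} → m ≤ n → (m ≤ᵇ n) ≡ true
≤ᵇ-yes {zero} l = refl
≤ᵇ-yes {suc m} l = <ᵇ-yes l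

≤ᵇ-no : ∀ {m n} → n < m → (m ≤ᵇ n) ≡ false
≤ᵇ-no {suc m} (s≤s l) = <ᵇ-no l

cmp : ∀ x y → Cmp x y
cmp x y with x ℕ.<? y
... | yes l = lt (<ᵇ-yes l) (≤ᵇ-no l) l
... | no nl = ge (<ᵇ-no (ℕₚ.≮⇒≥ nl)) (≤ᵇ-yes (ℕₚ.≮⇒≥ nl)) (ℕₚ.≮⇒≥ nl)

-- The last indicator marks a non-descent. The three conditions cannot all hold and cannot all fail,
-- since either would close a cycle of inequalities; two of them hold exactly when `invCond` does.
triple-identity : ∀ s₁ s₂ s₃ →
  ind (s₂ <ᵇ s₁) + ind (s₃ <ᵇ s₂) + (if s₃ <ᵇ s₁ then 0 else 1) ≡ ind (invCond s₁ s₂ s₃) + 1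
triple-identity s₁ s₂ s₃ with cmp s₂ s₁ | cmp s₃ s₂ | cmp s₃ s₁
... | lt a a' a″ | lt b b' b″ | lt c c' c″ rewrite a | b | c | c' = refl
... | lt a a' a″ | lt b b' b″ | ge c c' c″ = ⊥-elim (ℕₚ.<⇒≱ (ℕₚ.<-trans b″ a″) c″)
... | lt a a' a″ | ge b b' b″ | lt c c' c″ rewrite a | b | c | c' = refl
... | lt a a' a″ | ge b b' b″ | ge c c' c″ rewrite a | b | c | c' = refl
... | ge a a' a″ | lt b b' b″ | lt c c' c″ rewrite a | b | c | c' = refl
... | ge a a' a″ | lt b b' b″ | ge c c' c″ rewrite a | b | c | c' = refl
... | ge a a' a″ | ge b b' b″ | lt c c' c″ = ⊥-elim (ℕₚ.<⇒≱ c″ (ℕₚ.≤-trans a″ b″))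
... | ge a a' a″ | ge b b' b″ | ge c c' c″ rewrite a | b | c | c' = refl

triple-identity-sum : ∀ x' x w' →
  lsum (λ y → ind (y <ᵇ x')) w' + lsum (λ y → ind (x <ᵇ y)) w' + (if x <ᵇ x' then 0 else length w')
    ≡ lsum (λ y → ind (invCond x' y x)) w' + length w'
triple-identity-sum x' x [] with x <ᵇ x'
... | true = refl
... | false = refl
triple-identity-sum x' x (y ∷ w') with triple-identity x' y x | triple-identity-sum x' x w'
... | h | hs with x <ᵇ x'
...   | true = trans (solve 4 (λ a b c d → (a :+ b) :+ (c :+ d) :+ con 0 := (a :+ c :+ con 0) :+ (b :+ d :+ con 0)) refl
                   (ind (y <ᵇ x')) (lsum (λ y → ind (y <ᵇ x')) w') (ind (x <ᵇ y)) (lsum (λ y → ind (x <ᵇ y)) w'))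
             (trans (cong₂ _+_ h hs) (solve 3 (λ a b c → (a :+ con 1) :+ (b :+ c) := (a :+ b) :+ (con 1 :+ c)) refl
                   (ind (invCond x' y x)) (lsum (λ y → ind (invCond x' y x)) w') (length w')))
  where open +-*-Solver
...   | false = trans (solve 5 (λ a b c d l → (a :+ b) :+ (c :+ d) :+ (con 1 :+ l) := (a :+ c :+ con 1) :+ (b :+ d :+ l)) refl
                   (ind (y <ᵇ x')) (lsum (λ y → ind (y <ᵇ x')) w') (ind (x <ᵇ y)) (lsum (λ y → ind (x <ᵇ y)) w') (length w'))
             (trans (cong₂ _+_ h hs) (solve 3 (λ a b c → (a :+ con 1) :+ (b :+ c) := (a :+ b) :+ (con 1 :+ c)) refl
                   (ind (invCond x' y x)) (lsum (λ y → ind (invCond x' y x)) w') (length w')))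
  where open +-*-Solver

-- `triple-identity` summed over the pairs of the upper row. The non-descent indicator of a cell
-- occurs once for each cell to its right and so adds up to the arm; the number of pairs remains as
-- a constant.
row-exponents : ∀ w' w → length w' ≤ length w → rowInversions w' + qExponent w' w ≡ triples w' w + tri (length w')
row-exponents [] w l = refl
row-exponents (x' ∷ w') (x ∷ w) (s≤s l) =
  trans (solve 5 (λ a b c d e → (a :+ b) :+ (c :+ d :+ e) := (a :+ d :+ c) :+ (b :+ e)) refl
      (lsum (λ y → ind (y <ᵇ x')) w') (rowInversions w') (if x <ᵇ x' then 0 else length w') (lsum (λ y → ind (x <ᵇ y)) w') (qExponent w' w))
    (trans (cong₂ _+_ (triple-identity-sum x' x w') (row-exponents w' w l))
      (solve 4 (λ a b c d → (a :+ b) :+ (c :+ d) := (a :+ c) :+ (b :+ d)) refl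
        (lsum (λ y → ind (invCond x' y x)) w') (length w') (triples w' w) (tri (length w'))))
  where open +-*-Solver

lsum-cong : ∀ {f g} w → All (λ y → f y ≡ g y) w → lsum f w ≡ lsum g w
lsum-cong [] [] = refl
lsum-cong (y ∷ w) (h ∷ hs) = cong₂ _+_ h (lsum-cong w hs)

invCond-bottom : ∀ x y → 1 ≤ x → 1 ≤ y → invCond x y 0 ≡ (y <ᵇ x)
invCond-bottom (suc x) (suc y) _ _ with y <ᵇ x
... | true = refl
... | false = refl

-- The virtual entry 0 below the bottom row turns the triple condition into an ordinary inversion,
-- so this row needs no correction by a power of q.
bottom-exponents : ∀ w → All (1 ≤_) w → rowInversions w ≡ triples w []
bottom-exponents [] [] = refl
bottom-exponents (x ∷ w) (h ∷ hs) = cong₂ _+_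
  (lsum-cong w (All.map (λ l → cong ind (sym (invCond-bottom x _ h l))) hs)) (bottom-exponents w hs)

zipRow : ℕ → (ℕ → ℕ) → ℕ → List ℕ → List (Cell × ℕ)
zipRow h leg i w = zip (rowCells h leg i (length w)) w

All-zipRow : ∀ h leg i w → All (λ c → proj₁ (proj₂ (proj₁ c)) ≡ h × i ≤ proj₁ (proj₁ c)) (zipRow h leg i w)
All-zipRow h leg i [] = []
All-zipRow h leg i (x ∷ w) = (refl , ℕₚ.≤-refl) ∷ All.map (λ { (e , l) → e , ℕₚ.<⇒≤ l }) (All-zipRow h (leg ∘ suc) (suc i) w)

att-wt : ∀ b → wt att b ≡ qt^ (ind b) 0
att-wt true = refl
att-wt false = refl

row-att : ∀ v x h leg i w → (∀ c → proj₁ (proj₂ c) ≡ h → kind v c ≡ att) →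
  rowWeight v x (zipRow h leg i w) ≡ qt^ (lsum (λ y → ind (y <ᵇ x)) w) 0
row-att v x h leg i [] k = refl
row-att v x h leg i (y ∷ w) k rewrite k (i , h , leg 0 , length w) refl | att-wt (y <ᵇ x)
  | row-att v x h (leg ∘ suc) (suc i) w k = refl

row-free : ∀ v x σ → All (λ c → kind v (proj₁ c) ≡ free) σ → rowWeight v x σ ≈ P.1#
row-free v x [] [] = P.refl
row-free v x ((u , y) ∷ σ) (h ∷ hs) rewrite h = P.trans (P.*-identityˡ _) (row-free v x σ hs)

W-row : ∀ h leg i w → W (zipRow h leg i w) ≡ qt^ (rowInversions w) 0
W-row h leg i [] = refl
W-row h leg i (x ∷ w)
  rewrite row-att (i , h , leg 0 , length w) x h (leg ∘ suc) (suc i) w (λ c e → kind-row {i , h , leg 0 , length w} {c} (sym e))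
  | W-row h (leg ∘ suc) (suc i) w = refl

column-att : ∀ c x h leg i w → (∀ u → proj₁ (proj₂ u) ≡ h → i ≤ proj₁ u → kind u c ≡ att) →
  column (zipRow h leg i w) (c , x) ≡ qt^ (lsum (λ y → ind (x <ᵇ y)) w) 0
column-att c x h leg i [] k = refl
column-att c x h leg i (y ∷ w) k rewrite k (i , h , leg 0 , length w) refl ℕₚ.≤-refl | att-wt (x <ᵇ y)
  | column-att c x h (leg ∘ suc) (suc i) w (λ u e l → k u e (ℕₚ.<⇒≤ l)) = refl

gen-wt : ∀ leg arm b → wt (gen (qt^ 0 leg) (qt^ arm 0)) b ≡ qt^ (if b then 0 else arm) (if b then leg else 0)
gen-wt leg arm true = refl
gen-wt leg arm false = refl

-- Column by column: the upper cell has a `gen` factor with the cell below it and is free of the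
-- cells further right, while the lower cell is attacked by all upper cells further right. The
-- surplus of a longer lower row is free.
cross-rows : ∀ h leg leg' i w' w → length w' ≤ length w →
  cross (zipRow h leg i w') (zipRow (suc h) leg' i w) ≈ qt^ (qExponent w' w) (tExponent leg w' w)
cross-rows h leg leg' i [] w l = P.refl
cross-rows h leg leg' i (x' ∷ w') (x ∷ w) (s≤s l) = begin
  (wt (kind u c) (x <ᵇ x') *P rowWeight u x' L) *P cross U ((c , x) ∷ L)
    ≈⟨ P.*-cong (P.*-cong (P.reflexive (trans (cong (λ k → wt k (x <ᵇ x')) (kind-below i h (leg 0) (length w') (leg' 0 , length w))) (gen-wt (leg 0) (length w') (x <ᵇ x'))))
                  (row-free u x' L (All.map (λ { {c' , _} (e , l') → kind-right {u} {c'} (sym e) l' }) (All-zipRow (suc h) (leg' ∘ suc) (suc i) w))))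
        (N.cross-∷ U (c , x) L) ⟩
  (qt^ e₁ e₂ *P P.1#) *P (column U (c , x) *P cross U L)
    ≈⟨ P.*-cong (P.*-identityʳ (qt^ e₁ e₂)) (P.*-cong (P.reflexive (column-att c x h (leg ∘ suc) (suc i) w'
          (λ u' e l' → kind-left {u'} {c} (cong suc e) l'))) (cross-rows h (leg ∘ suc) (leg' ∘ suc) (suc i) w' w l)) ⟩
  qt^ e₁ e₂ *P (qt^ (lsum (λ y → ind (x <ᵇ y)) w') 0 *P qt^ (qExponent w' w) (tExponent (leg ∘ suc) w' w))
    ≈⟨ P.reflexive (cong (λ e → qt^ e (e₂ + tExponent (leg ∘ suc) w' w)) (sym (ℕₚ.+-assoc e₁ _ _))) ⟩
  qt^ (qExponent (x' ∷ w') (x ∷ w)) (tExponent leg (x' ∷ w') (x ∷ w)) ∎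
  where
  open import Relation.Binary.Reasoning.Setoid P.setoid
  u c : Cell
  u = i , h , leg 0 , length w'
  c = i , suc h , leg' 0 , length w
  U = zipRow h (leg ∘ suc) (suc i) w'
  L = zipRow (suc h) (leg' ∘ suc) (suc i) w
  e₁ = if x <ᵇ x' then 0 else length w'
  e₂ = if x <ᵇ x' then leg 0 else 0

cross-far : ∀ σ τ h → All (λ c → proj₁ (proj₂ (proj₁ c)) < h) σ → All (λ c → proj₁ (proj₂ (proj₁ c)) ≡ suc h) τ → cross σ τ ≈ P.1#
cross-far [] τ h [] k = P.refl
cross-far ((v , x) ∷ σ) τ h (l ∷ ls) k = P.trans
  (P.*-cong (row-free v x τ (All.map (λ { {c , _} refl → kind-far {v} {c} (s≤s l) }) k)) (cross-far σ τ h ls k)) (P.*-identityˡ _)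

All-zip : ∀ {Q : Cell → Set} cs (w : List ℕ) → All Q cs → All (Q ∘ proj₁) (zip cs w)
All-zip [] w h = []
All-zip (c ∷ cs) [] h = []
All-zip (c ∷ cs) (x ∷ w) (h ∷ hs) = h ∷ All-zip cs w hs

flat-rows : ∀ la σ → All (λ c → proj₁ (proj₂ (proj₁ c)) < length la) (flat la σ)
flat-rows [] σ = []
flat-rows (r ∷ la) [] = []
flat-rows (r ∷ la) (w ∷ σ) = Allₚ.++⁺ (All.map ℕₚ.m≤n⇒m≤1+n (flat-rows la σ))
  (All-zip _ w (All.map (λ { (refl , _) → ℕₚ.≤-refl }) (rowCells-row (length la) (legs (r ∷ la)) 0 r)))

triTail : List ℕ → ℕ
triTail la = lsum tri la

Desc : List ℕ → Set
Desc = AllPairs _≥_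

-- The inversions within the bottom row `w` stay in raw form: their conversion into triples needs
-- the row beneath, which only the next step of the induction provides.
W-flat' : ∀ {n} r la w σ → Desc (r ∷ la) → Shaped n (r ∷ la) (w ∷ σ) →
  W (flat (r ∷ la) (w ∷ σ)) ≈ qt^ (rowInversions w + (invAbove w σ + triTail la)) (majAbove w la σ)
W-flat' r [] w [] d ((refl , _) ∷ []) =
  P.reflexive (trans (W-row 0 (legs (r ∷ [])) 0 w) (cong (λ e → qt^ e 0) (sym (ℕₚ.+-identityʳ _))))
W-flat' .(length w) (.(length w') ∷ la) w (w' ∷ σ) ((w≥w' ∷ _) ∷ d) ((refl , _) ∷ sh@((refl , _) ∷ _)) = begin
  W (flat la⁺ (w' ∷ σ) ++ Rw) ≈⟨ N.W-++ (flat la⁺ (w' ∷ σ)) Rw ⟩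
  W (flat la⁺ (w' ∷ σ)) *P (cross (flat la⁺ (w' ∷ σ)) Rw *P W Rw)
    ≈⟨ P.*-cong (W-flat' (length w') la w' σ d sh) (P.*-cong crossing (P.reflexive (W-row (length la⁺) _ 0 w))) ⟩
  qt^ A M *P (qt^ (qExponent w' w) T *P qt^ (rowInversions w) 0)
    ≈⟨ P.reflexive (cong₂ qt^ exponents (trans (cong (λ z → M + z) (ℕₚ.+-identityʳ T)) (ℕₚ.+-comm M T))) ⟩
  qt^ (rowInversions w + (invAbove w (w' ∷ σ) + triTail la⁺)) (majAbove w la⁺ (w' ∷ σ)) ∎
  where
  open import Relation.Binary.Reasoning.Setoid P.setoid
  la⁺ = length w' ∷ la
  Rw = zip (rowCells (length la⁺) (legs (length w ∷ la⁺)) 0 (length w)) w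
  A = rowInversions w' + (invAbove w' σ + triTail la)
  M = majAbove w' la σ
  T = tExponent (legs la⁺) w' w
  crossing : cross (flat la⁺ (w' ∷ σ)) Rw ≈ qt^ (qExponent w' w) T
  crossing = P.trans (N.cross-++ (flat la σ) _ Rw)
    (P.trans (P.*-cong (cross-far (flat la σ) Rw (length la) (flat-rows la σ)
                         (All-zip _ w (All.map proj₁ (rowCells-row (length la⁺) (legs (length w ∷ la⁺)) 0 (length w)))))
                       (cross-rows (length la) _ _ 0 w' w w≥w'))
      (P.*-identityˡ _))
  exponents : A + (qExponent w' w + rowInversions w) ≡ rowInversions w + (invAbove w (w' ∷ σ) + triTail la⁺)
  exponents = trans (solve 5 (λ a b c d e → (a :+ (b :+ c)) :+ (d :+ e) := e :+ ((a :+ d) :+ (b :+ c))) refl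
                  (rowInversions w') (invAbove w' σ) (triTail la) (qExponent w' w) (rowInversions w))
    (trans (cong (λ z → rowInversions w + (z + (invAbove w' σ + triTail la))) (row-exponents w' w w≥w'))
      (solve 5 (λ e a b c d → e :+ ((a :+ b) :+ (c :+ d)) := e :+ ((a :+ c) :+ (b :+ d))) refl
        (rowInversions w) (triples w' w) (tri (length w')) (invAbove w' σ) (triTail la)))
    where open +-*-Solver

normalisation : List ℕ → ℕ
normalisation [] = 0
normalisation (r ∷ la) = triTail la

maj : List ℕ → Filling → ℕ
maj (r ∷ la) (w ∷ σ) = majAbove w la σ
maj _ _ = 0

W-flat : ∀ {n} la σ → Desc la → Shaped n la σ → W (flat la σ) ≈ qt^ (normalisation la) 0 *P qt^ (invAbove [] σ) (maj la σ)
W-flat [] [] d [] = P.refl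
W-flat (r ∷ la) (w ∷ σ) d sh@((_ , h) ∷ _) = P.trans (W-flat' r la w σ d sh)
  (P.reflexive (cong (λ e → qt^ e (majAbove w la σ))
    (trans (cong (_+ (invAbove w σ + triTail la)) (bottom-exponents w (All.map proj₁ h)))
      (solve 3 (λ a b c → a :+ (b :+ c) := c :+ (a :+ b)) refl (triples w []) (invAbove w σ) (triTail la)))))
  where open +-*-Solver

-- Agreement of the recursive statistics with `invF` and `majF`

su : ℕ → (ℕ → ℕ) → ℕ
su zero f = 0
su (suc n) f = f 0 + su n (f ∘ suc)

sumOver-oneTo : ∀ n f → sumOver (oneTo n) f ≡ su n (f ∘ suc)
sumOver-oneTo n f = go n id
  where
  go : ∀ n g → sum (map f (map suc (applyUpTo g n))) ≡ su n (λ k → f (suc (g k)))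
  go zero g = refl
  go (suc n) g = cong (_ +_) (go n (g ∘ suc))

su-cong : ∀ n {f g} → (∀ i → i < n → f i ≡ g i) → su n f ≡ su n g
su-cong zero h = refl
su-cong (suc n) h = cong₂ _+_ (h 0 (s≤s z≤n)) (su-cong n (λ i l → h (suc i) (s≤s l)))

su-add : ∀ n f g → su n (λ i → f i + g i) ≡ su n f + su n g
su-add zero f g = refl
su-add (suc n) f g = trans (cong ((f 0 + g 0) +_) (su-add n (f ∘ suc) (g ∘ suc)))
  (solve 4 (λ a b c d → (a :+ b) :+ (c :+ d) := (a :+ c) :+ (b :+ d)) refl (f 0) (g 0) (su n (f ∘ suc)) (su n (g ∘ suc)))
  where open +-*-Solver

su-list : ∀ w g → su (length w) (λ i → g (nth1 0 w (suc i))) ≡ lsum g w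
su-list [] g = refl
su-list (x ∷ w) g = cong (g x +_) (su-list w g)

rowTerm : ℕ → List ℕ → List ℕ → ℕ
rowTerm r w b = su r (λ i₂ → su i₂ (λ i₁ → ind (invCond (nth1 0 w (suc i₁)) (nth1 0 w (suc i₂)) (nth1 0 b (suc i₁)))))

rowTerm-triples : ∀ w b → rowTerm (length w) w b ≡ triples w b
rowTerm-triples [] b = refl
rowTerm-triples (x' ∷ w') [] = trans (su-add (length w') _ _)
  (cong₂ _+_ (su-list w' (λ y → ind (invCond x' y 0))) (rowTerm-triples w' []))
rowTerm-triples (x' ∷ w') (x ∷ w) = trans (su-add (length w') _ _)
  (cong₂ _+_ (su-list w' (λ y → ind (invCond x' y x))) (rowTerm-triples w' w))

invAbove-rows : ∀ {n la σ} b → Shaped n la σ →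
  su (length la) (λ j → rowTerm (nth1 0 la (suc j)) (nth1 [] σ (suc j)) (nth1 [] (b ∷ σ) (suc j))) ≡ invAbove b σ
invAbove-rows b [] = refl
invAbove-rows b (_∷_ {w = w} (refl , _) sh) = cong₂ _+_ (rowTerm-triples w b) (invAbove-rows w sh)

invF-structural : ∀ {n la σ} → Shaped n la σ → invF la σ ≡ invAbove [] σ
invF-structural {n} {la} {σ} sh = trans (sumOver-oneTo (length la) _)
  (trans (su-cong (length la) (λ j _ → row j)) (invAbove-rows [] sh))
  where
  -- Row 0 is read as the empty row, whose entries default to 0, the value below all letters.
  below-row : ∀ j → nth1 [] σ j ≡ nth1 [] ([] ∷ σ) (suc j)
  below-row zero = refl
  below-row (suc j) = refl
  row : ∀ j → sumOver (oneTo (nth1 0 la (suc j))) (λ i₂ → sumOver (oneTo (i₂ ∸ 1)) (λ i₁ →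
                ind (invCond (val σ i₁ (suc j)) (val σ i₂ (suc j)) (val σ i₁ j))))
            ≡ rowTerm (nth1 0 la (suc j)) (nth1 [] σ (suc j)) (nth1 [] ([] ∷ σ) (suc j))
  row j = trans (sumOver-oneTo (nth1 0 la (suc j)) _)
    (trans (su-cong (nth1 0 la (suc j)) (λ i₂ _ → sumOver-oneTo i₂ _))
      (cong (rowTerm (nth1 0 la (suc j)) (nth1 [] σ (suc j))) (below-row j)))

conjAt-∷ : ∀ r la i → i < r → conjAt (r ∷ la) (suc i) ≡ suc (conjAt la (suc i))
conjAt-∷ r la i l rewrite <ᵇ-yes l = refl

nth1-All : ∀ {Q : ℕ → Set} {la} → Q 0 → All Q la → ∀ j → Q (nth1 0 la (suc j))
nth1-All z [] j = z
nth1-All z (h ∷ hs) zero = h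
nth1-All z (h ∷ hs) (suc j) = nth1-All z hs j

tExponent-rows : ∀ leg w' w →
  su (length w') (λ i → if nth1 0 w (suc i) <ᵇ nth1 0 w' (suc i) then leg i else 0) ≡ tExponent leg w' w
tExponent-rows leg [] w = refl
tExponent-rows leg (x' ∷ w') [] = cong (_ +_) (tExponent-rows (leg ∘ suc) w' [])
tExponent-rows leg (x' ∷ w') (x ∷ w) = cong (_ +_) (tExponent-rows (leg ∘ suc) w' w)

majAbove-rows : ∀ {n la σ} w → Desc la → Shaped n la σ →
  su (length la) (λ j → su (nth1 0 la (suc j)) (λ i →
    if nth1 0 (nth1 [] (w ∷ σ) (suc j)) (suc i) <ᵇ nth1 0 (nth1 [] σ (suc j)) (suc i) then legs la i ∸ j else 0))
  ≡ majAbove w la σ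
majAbove-rows w d [] = refl
majAbove-rows w (b ∷ d) (_∷_ {la = la} {w = w'} {σ = σ} (refl , _) sh) = cong₂ _+_
  (tExponent-rows (legs (length w' ∷ la)) w' w)
  -- Removing the bottom row lowers the column heights by one, which is absorbed by lowering the row
  -- index in the subtraction.
  (trans (su-cong (length la) (λ j _ → su-cong (nth1 0 la (suc j)) (λ i l →
     cong (λ z → if nth1 0 (nth1 [] (w' ∷ σ) (suc j)) (suc i) <ᵇ nth1 0 (nth1 [] σ (suc j)) (suc i) then z ∸ suc j else 0)
       (conjAt-∷ (length w') la i (ℕₚ.<-≤-trans l (nth1-All z≤n b j))))))
    (majAbove-rows w' d sh))

majF-structural : ∀ {n la σ} → Desc la → Shaped n la σ → majF la σ ≡ maj la σ
majF-structural d [] = refl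
majF-structural (b ∷ d) (_∷_ {la = la} {w = w} {σ = σ} (refl , _) sh) =
  trans (sumOver-oneTo (length la) _)
   (trans (su-cong (length la) (λ j _ → trans (sumOver-oneTo (nth1 0 la (suc j)) _)
      (su-cong (nth1 0 la (suc j)) (λ i l →
     cong (λ z → if nth1 0 (nth1 [] (w ∷ σ) (suc j)) (suc i) <ᵇ nth1 0 (nth1 [] σ (suc j)) (suc i) then z ∸ suc j else 0)
       (conjAt-∷ (length w) la i (ℕₚ.<-≤-trans l (nth1-All z≤n b j)))))))
    (majAbove-rows w d sh))

-- Contents

occ : ℕ → List ℕ → ℕ
occ k l = lsum (λ y → ind (y ≡ᵇ k)) l

occ-filter : ∀ k l → length (filterᵇ (λ x → x ≡ᵇ k) l) ≡ occ k l
occ-filter k [] = refl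
occ-filter k (y ∷ l) with y ≡ᵇ k
... | true = cong suc (occ-filter k l)
... | false = occ-filter k l

lsum-++ : ∀ f l m → lsum f (l ++ m) ≡ lsum f l + lsum f m
lsum-++ f [] m = refl
lsum-++ f (x ∷ l) m = trans (cong (f x +_) (lsum-++ f l m)) (sym (ℕₚ.+-assoc (f x) _ _))

cnt-++ : ∀ σ τ k → cnt (σ ++ τ) k ≡ cnt σ k + cnt τ k
cnt-++ [] τ k = refl
cnt-++ ((_ , y) ∷ σ) τ k with y ≡ᵇ k
... | true = cong suc (cnt-++ σ τ k)
... | false = cnt-++ σ τ k

cnt-zip : ∀ cs w k → length w ≡ length cs → cnt (zip cs w) k ≡ occ k w
cnt-zip [] [] k e = refl
cnt-zip (c ∷ cs) (y ∷ w) k e with y ≡ᵇ k | cnt-zip cs w k (ℕₚ.suc-injective e)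
... | true | h = cong suc h
... | false | h = h

cnt-flat : ∀ {n la σ} → Shaped n la σ → ∀ k → cnt (flat la σ) k ≡ occ k (concat σ)
cnt-flat [] k = refl
cnt-flat (_∷_ {r} {la} {w} {σ} (e , _) sh) k = trans (cnt-++ (flat la σ) _ k)
  (trans (cong₂ _+_ (cnt-flat sh k) (cnt-zip cs w k (trans e (sym (length-rowCells (length la) _ 0 r)))))
    (trans (ℕₚ.+-comm (occ k (concat σ)) (occ k w)) (sym (lsum-++ _ w (concat σ)))))
  where cs = rowCells (length la) (legs (r ∷ la)) 0 r

content-occ : ∀ n σ → content n σ ≡ map (λ k → occ k (concat σ)) (oneTo n)
content-occ n σ = Lₚ.map-cong (λ k → occ-filter k (concat σ)) (oneTo n)

-- This replaces `map f (oneTo n)` in inductions where the start of the interval has to vary.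
vals : (ℕ → ℕ) → ℕ → ℕ → List ℕ
vals f s zero = []
vals f s (suc n) = f s ∷ vals f (suc s) n

map-oneTo : ∀ f n → map f (oneTo n) ≡ vals f 1 n
map-oneTo f n = go id n 1 (λ k → refl)
  where
  go : ∀ g n s → (∀ k → suc (g k) ≡ s + k) → map f (map suc (applyUpTo g n)) ≡ vals f s n
  go g zero s h = refl
  go g (suc n) s h = cong₂ _∷_ (cong f (trans (h 0) (ℕₚ.+-identityʳ s)))
    (go (g ∘ suc) n (suc s) (λ k → trans (h (suc k)) (ℕₚ.+-suc s k)))

vals-cong : ∀ {f g} s n → (∀ k → s ≤ k → f k ≡ g k) → vals f s n ≡ vals g s n
vals-cong s zero h = refl
vals-cong s (suc n) h = cong₂ _∷_ (h s ℕₚ.≤-refl) (vals-cong (suc s) n (λ k l → h k (ℕₚ.<⇒≤ l)))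

hasContent : List ℕ → (ℕ → ℕ) → Bool
hasContent α f = eqListᵇ (map f (oneTo (length α))) α

∧-swap : ∀ a b c → a ∧ (b ∧ c) ≡ b ∧ (a ∧ c)
∧-swap true true c = refl
∧-swap true false c = refl
∧-swap false true c = refl
∧-swap false false c = refl

hasContent-swap : ∀ β x y γ f f' → Swapped (suc (length β)) f f' →
  hasContent (β ++ x ∷ y ∷ γ) f ≡ hasContent (β ++ y ∷ x ∷ γ) f'
hasContent-swap β x y γ f f' (p , r , o) = trans (cong (λ z → eqListᵇ z (β ++ x ∷ y ∷ γ)) (map-oneTo f (length (β ++ x ∷ y ∷ γ))))
  (trans (go 1 β refl) (cong (λ z → eqListᵇ z (β ++ y ∷ x ∷ γ)) (sym (map-oneTo f' (length (β ++ y ∷ x ∷ γ))))))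
  where
  a = suc (length β)
  go : ∀ s β' → s + length β' ≡ a →
    eqListᵇ (vals f s (length (β' ++ x ∷ y ∷ γ))) (β' ++ x ∷ y ∷ γ) ≡ eqListᵇ (vals f' s (length (β' ++ y ∷ x ∷ γ))) (β' ++ y ∷ x ∷ γ)
  go s [] e rewrite trans (sym (ℕₚ.+-identityʳ s)) e | p | r
    | vals-cong {f} {f'} (suc (suc a)) (length γ) (λ k l → o k (λ z → ℕₚ.<-irrefl (sym z) (ℕₚ.<⇒≤ l)) (λ z → ℕₚ.<-irrefl (sym z) l))
    = ∧-swap (f' (suc a) ≡ᵇ x) (f' a ≡ᵇ y) _
  go s (b ∷ β') e = cong₂ (λ u v → (u ≡ᵇ b) ∧ v)
    (o s (λ z → ℕₚ.<-irrefl z s<a) (λ z → ℕₚ.<-irrefl z (ℕₚ.m≤n⇒m≤1+n s<a)))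
    (go (suc s) β' (trans (sym (ℕₚ.+-suc s (length β'))) e))
    where
    s<a : s < a
    s<a = subst (s <_) e (ℕₚ.m<m+n s {suc (length β')} (s≤s z≤n))

hasContent-∷ʳ : ∀ α f → hasContent (α ++ 0 ∷ []) f ≡ hasContent α f ∧ (f (suc (length α)) ≡ᵇ 0)
hasContent-∷ʳ α f = trans (cong (λ z → eqListᵇ z (α ++ 0 ∷ [])) (map-oneTo f (length (α ++ 0 ∷ []))))
  (trans (go 1 α) (cong (λ z → eqListᵇ z α ∧ (f (suc (length α)) ≡ᵇ 0)) (sym (map-oneTo f (length α)))))
  where
  go : ∀ s α → eqListᵇ (vals f s (length (α ++ 0 ∷ []))) (α ++ 0 ∷ []) ≡ eqListᵇ (vals f s (length α)) α ∧ (f (s + length α) ≡ᵇ 0)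
  go s [] rewrite ℕₚ.+-identityʳ s = 𝔹ₚ.∧-identityʳ _
  go s (x ∷ α) rewrite go (suc s) α | ℕₚ.+-suc s (length α) = sym (𝔹ₚ.∧-assoc (f s ≡ᵇ x) _ _)

eqListᵇ-sound : ∀ xs ys → eqListᵇ xs ys ≡ true → xs ≡ ys
eqListᵇ-sound [] [] e = refl
eqListᵇ-sound (x ∷ xs) (y ∷ ys) e with x ℕ.≟ y
... | yes refl rewrite ≡ᵇ-yes x = cong (x ∷_) (eqListᵇ-sound xs ys e)
... | no ne rewrite ≡ᵇ-≢ ne with e
...   | ()

eqListᵇ-refl : ∀ xs → eqListᵇ xs xs ≡ true
eqListᵇ-refl [] = refl
eqListᵇ-refl (x ∷ xs) rewrite ≡ᵇ-yes x = eqListᵇ-refl xs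

-- Modified Macdonald polynomials with coefficients in ℤ[q,t]

select : Bool → Pqt → Pqt
select b p = if b then p else []

H : List ℕ → List ℕ → Pqt
H la α = sumL (fillings la (length α)) (λ σ → select (eqListᵇ (content (length α) σ) α) (qt^ (invF la σ) (majF la σ)))

δP : Bool → Pqt
δP b = if b then constP (int 1) else []

-- Brings `H` into the form of `swap-letters`: a sum over labelled cells in reading order, with the
-- condition on the content as an indicator factor. The power of q stays on the left until
-- `shift-cancel` removes it.
H-flat : ∀ la → Desc la → ∀ α →
  qt^ (normalisation la) 0 *P H la α ≈ SumAll (oneTo (length α)) (cells la) (λ fl → W fl *P δP (hasContent α (cnt fl)))
H-flat la d α = P.trans (P.sym (sumL-*ˡ (qt^ (normalisation la) 0) (fillings la n) _))
  (P.trans (sumL-cong-All (All.map pointwise (fillings-shaped la n)))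
    (sum-fillings la n (λ fl → W fl *P δP (hasContent α (cnt fl)))))
  where
  n = length α
  pointwise : ∀ {σ} → Shaped n la σ →
    qt^ (normalisation la) 0 *P select (eqListᵇ (content n σ) α) (qt^ (invF la σ) (majF la σ))
      ≈ W (flat la σ) *P δP (hasContent α (cnt (flat la σ)))
  pointwise {σ} sh rewrite content-occ n σ
    | Lₚ.map-cong (λ k → sym (cnt-flat sh k)) (oneTo n)
    | invF-structural sh | majF-structural d sh with hasContent α (cnt (flat la σ))
  ... | true = P.trans (P.sym (W-flat la σ d sh)) (P.sym (P.*-identityʳ _))
  ... | false = P.trans (P.zeroʳ (qt^ (normalisation la) 0)) (P.sym (P.zeroʳ (W (flat la σ))))

unique-↭ : ∀ {A : Set} {xs ys : List A} → xs ↭ ys → Unique xs → Unique ys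
unique-↭ Perm.refl u = u
unique-↭ (Perm.prep x p) (h ∷ u) = Permₚ.All-resp-↭ p h ∷ unique-↭ p u
unique-↭ (Perm.swap x y p) ((xy ∷ hx) ∷ hy ∷ u) =
  ((xy ∘ sym) ∷ Permₚ.All-resp-↭ p hy) ∷ Permₚ.All-resp-↭ p hx ∷ unique-↭ p u
unique-↭ (Perm.trans p r) u = unique-↭ r (unique-↭ p u)

extract : ∀ {A : Set} {x : A} {xs} → x ∈ xs → Σ (List A) λ ys → xs ↭ x ∷ ys
extract x∈ with ∈ₚ.∈-∃++ x∈
... | ys , zs , refl = ys ++ zs , Permₚ.shift _ ys zs

split-letters : ∀ {a b ls} → Unique ls → a ∈ ls → b ∈ ls → a ≢ b →
  Σ (List ℕ) λ os → ls ↭ a ∷ b ∷ os × All (λ x → x ≢ a × x ≢ b) os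
split-letters {a} {b} u a∈ b∈ a≢b with extract a∈
... | ls' , p with Permₚ.∈-resp-↭ p b∈
...   | here e = ⊥-elim (a≢b (sym e))
...   | there b∈' with extract b∈'
...     | os , p' with unique-↭ (Perm.trans p (Perm.prep a p')) u
...       | ((_ ∷ ha) ∷ hb ∷ _) = os , Perm.trans p (Perm.prep a p') ,
              All.zipWith (λ { (f , g) → f ∘ sym , g ∘ sym }) (ha , hb)

oneTo-unique : ∀ n → Unique (oneTo n)
oneTo-unique n = Uniqueₚ.map⁺ ℕₚ.suc-injective (Uniqueₚ.upTo⁺ n)

∈-oneTo : ∀ {n i} → i < n → suc i ∈ oneTo n
∈-oneTo l = ∈ₚ.∈-map⁺ suc (∈ₚ.∈-upTo⁺ l)

H-swap : ∀ la → Desc la → ∀ β x y γ → H la (β ++ x ∷ y ∷ γ) ≈ H la (β ++ y ∷ x ∷ γ)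
H-swap la d β x y γ = shift-cancel (normalisation la)
  (P.trans (H-flat la d (β ++ x ∷ y ∷ γ)) (P.trans swapped (P.sym (H-flat la d (β ++ y ∷ x ∷ γ)))))
  where
  a = suc (length β)
  n = length (β ++ x ∷ y ∷ γ)
  n≡ : n ≡ length β + suc (suc (length γ))
  n≡ = Lₚ.length-++ β
  lens : n ≡ length (β ++ y ∷ x ∷ γ)
  lens = trans n≡ (sym (Lₚ.length-++ β))
  a<n : a < n
  a<n = subst (a <_) (sym n≡) (subst (_≤ length β + suc (suc (length γ))) (ℕₚ.+-comm (length β) 2) (ℕₚ.+-monoʳ-≤ (length β) (s≤s (s≤s z≤n))))
  swapped : SumAll (oneTo n) (cells la) (λ fl → W fl *P δP (hasContent (β ++ x ∷ y ∷ γ) (cnt fl)))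
          ≈ SumAll (oneTo (length (β ++ y ∷ x ∷ γ))) (cells la) (λ fl → W fl *P δP (hasContent (β ++ y ∷ x ∷ γ) (cnt fl)))
  swapped with split-letters {a} {suc a} (oneTo-unique n) (∈-oneTo (ℕₚ.<⇒≤ a<n)) (∈-oneTo a<n) (ℕₚ.1+n≢n ∘ sym)
  ... | os , perm , ok = P.trans
    (swap-letters a perm ok (λ f → δP (hasContent (β ++ x ∷ y ∷ γ) f)) (λ f → δP (hasContent (β ++ y ∷ x ∷ γ) f))
      (λ f f' s → P.reflexive (cong δP (hasContent-swap β x y γ f f' s))) (cells la) (cells-ordered la))
    (P.reflexive (cong (λ m → SumAll (oneTo m) (cells la) (λ fl → W fl *P δP (hasContent (β ++ y ∷ x ∷ γ) (cnt fl)))) lens))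

SumAll-zero : ∀ ls cs {F} → (∀ σ → F σ ≈ []) → SumAll ls cs F ≈ []
SumAll-zero ls [] h = h []
SumAll-zero ls (c ∷ cs) h = sumL-zero-All (All.universal (λ x → SumAll-zero ls cs (λ σ → h _)) ls)

SumAll-restrict : ∀ ls m cs F → (∀ σ → 0 < cnt σ m → F σ ≈ []) → SumAll (ls ++ m ∷ []) cs F ≈ SumAll ls cs F
SumAll-restrict ls m [] F h = P.refl
SumAll-restrict ls m (c ∷ cs) F h = P.trans (sumL-++ ls (m ∷ []) _)
  (P.trans (P.+-cong (sumL-cong ls (λ x → SumAll-restrict ls m cs (λ σ → F ((c , x) ∷ σ)) (λ σ l → h _ (more x σ l))))
                     (P.trans (P.+-identityʳ _) (SumAll-zero (ls ++ m ∷ []) cs (λ σ → h _ (hit σ)))))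
    (P.+-identityʳ _))
  where
  more : ∀ x σ → 0 < cnt σ m → 0 < cnt ((c , x) ∷ σ) m
  more x σ l with x ≡ᵇ m
  ... | true = s≤s z≤n
  ... | false = l
  hit : ∀ σ → 0 < cnt ((c , m) ∷ σ) m
  hit σ rewrite ≡ᵇ-yes m = s≤s z≤n

SumAll-cong-letters : ∀ {Q : ℕ → Set} ls → All Q ls → ∀ cs {F G} → (∀ σ → All (Q ∘ proj₂) σ → F σ ≈ G σ) →
  SumAll ls cs F ≈ SumAll ls cs G
SumAll-cong-letters ls q [] h = h [] []
SumAll-cong-letters ls q (c ∷ cs) h =
  sumL-cong-All (All.map (λ qx → SumAll-cong-letters ls q cs (λ σ qσ → h _ (qx ∷ qσ))) q)

cnt-absent : ∀ m σ → All (λ c → proj₂ c ≢ m) σ → cnt σ m ≡ 0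
cnt-absent m [] [] = refl
cnt-absent m ((_ , x) ∷ σ) (h ∷ hs) rewrite ≡ᵇ-≢ h = cnt-absent m σ hs

-- A final exponent 0 only enlarges the alphabet by a letter that no contributing filling uses.
H-∷ʳ0 : ∀ la → Desc la → ∀ α → H la (α ++ 0 ∷ []) ≈ H la α
H-∷ʳ0 la d α = shift-cancel (normalisation la)
  (P.trans (H-flat la d (α ++ 0 ∷ [])) (P.trans same (P.sym (H-flat la d α))))
  where
  n = length α
  F : List (Cell × ℕ) → Pqt
  F fl = W fl *P δP (hasContent (α ++ 0 ∷ []) (cnt fl))
  letters≡ : oneTo (length (α ++ 0 ∷ [])) ≡ oneTo n ++ suc n ∷ []
  letters≡ = trans (cong oneTo (trans (Lₚ.length-++ α) (ℕₚ.+-comm n 1)))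
    (trans (cong (map suc) (sym (Lₚ.upTo-∷ʳ n))) (Lₚ.map-++ suc (upTo n) (n ∷ [])))
  vanish : ∀ σ → 0 < cnt σ (suc n) → F σ ≈ []
  vanish σ l rewrite hasContent-∷ʳ α (cnt σ) with cnt σ (suc n)
  vanish σ () | zero
  ... | suc _ rewrite 𝔹ₚ.∧-zeroʳ (hasContent α (cnt σ)) = P.zeroʳ (W σ)
  same : SumAll (oneTo (length (α ++ 0 ∷ []))) (cells la) F ≈ SumAll (oneTo n) (cells la) (λ fl → W fl *P δP (hasContent α (cnt fl)))
  same = P.trans (P.reflexive (cong (λ ls → SumAll ls (cells la) F) letters≡))
    (P.trans (SumAll-restrict (oneTo n) (suc n) (cells la) F vanish)
    (SumAll-cong-letters (oneTo n) (All.map (λ { (_ , l) e → ℕₚ.<-irrefl e (s≤s l) }) (oneTo-bound n)) (cells la)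
      (λ σ q → P.*-congˡ {W σ} (P.reflexive (cong δP (trans (hasContent-∷ʳ α (cnt σ))
        (trans (cong (λ z → hasContent α (cnt σ) ∧ (z ≡ᵇ 0)) (cnt-absent (suc n) σ q)) (𝔹ₚ.∧-identityʳ _))))))))

-- Double counting of the entries of a filling

su-0 : ∀ n (g : ℕ → ℕ) → su n (λ i → g (suc i) * 0) ≡ 0
su-0 zero g = refl
su-0 (suc n) g = cong₂ _+_ (ℕₚ.*-zeroʳ (g 1)) (su-0 n (g ∘ suc))

su-pick : ∀ n (g : ℕ → ℕ) y → 1 ≤ y → y ≤ n → su n (λ i → g (suc i) * ind (y ≡ᵇ suc i)) ≡ g y
su-pick (suc n) g (suc zero) _ _ = trans (cong₂ _+_ (ℕₚ.*-identityʳ (g 1)) (su-0 n (g ∘ suc))) (ℕₚ.+-identityʳ (g 1))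
su-pick (suc n) g (suc (suc y)) _ (s≤s l) = trans (cong (_+ su n (λ i → g (suc (suc i)) * ind (suc y ≡ᵇ suc i))) (ℕₚ.*-zeroʳ (g 1))) (su-pick n (g ∘ suc) (suc y) (s≤s z≤n) l)

-- Used with g constant 1 for the number of cells and with the identity for the sum of the entries:
-- both are determined by the content.
double-count : ∀ n (g : ℕ → ℕ) l → All (λ x → 1 ≤ x × x ≤ n) l → su n (λ i → g (suc i) * occ (suc i) l) ≡ lsum g l
double-count n g [] [] = su-0 n g
double-count n g (y ∷ l) ((y₁ , y₂) ∷ h) = trans (su-cong n (λ i _ → ℕₚ.*-distribˡ-+ (g (suc i)) (ind (y ≡ᵇ suc i)) _))
  (trans (su-add n _ _) (cong₂ _+_ (su-pick n g y y₁ y₂) (double-count n g l h)))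

shaped-entries : ∀ {n la σ} → Shaped n la σ → All (λ x → 1 ≤ x × x ≤ n) (concat σ)
shaped-entries [] = []
shaped-entries ((_ , h) ∷ sh) = Allₚ.++⁺ h (shaped-entries sh)

lsum-1 : ∀ l → lsum (λ _ → 1) l ≡ length l
lsum-1 [] = refl
lsum-1 (x ∷ l) = cong suc (lsum-1 l)

length-concat : ∀ {n la σ} → Shaped n la σ → length (concat σ) ≡ sum la
length-concat [] = refl
length-concat (_∷_ {w = w} (refl , _) sh) = trans (Lₚ.length-++ w) (cong (length w +_) (length-concat sh))

sum-content : ∀ {n la σ} → Shaped n la σ → sum (content n σ) ≡ sum la
sum-content {n} {la} {σ} sh = trans (cong sum (content-occ n σ))
  (trans (sumOver-oneTo n (λ k → occ k (concat σ)))
    (trans (su-cong n (λ i _ → sym (ℕₚ.*-identityˡ (occ (suc i) (concat σ)))))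
      (trans (double-count n (λ _ → 1) (concat σ) (shaped-entries sh))
        (trans (lsum-1 (concat σ)) (length-concat sh)))))

H-degree : ∀ la α → sum la ≢ sum α → H la α ≈ []
H-degree la α ne = sumL-zero-All (All.map zero-term (fillings-shaped la (length α)))
  where
  zero-term : ∀ {σ} → Shaped (length α) la σ → select (eqListᵇ (content (length α) σ) α) (qt^ (invF la σ) (majF la σ)) ≈ []
  zero-term {σ} sh with eqListᵇ (content (length α) σ) α | eqListᵇ-sound (content (length α) σ) α
  ... | false | _ = P.refl
  ... | true | h = ⊥-elim (ne (trans (sym (sum-content sh)) (cong sum (h refl))))

-- The sum of partitions

⊕-identityʳ : ∀ xs → xs ⊕ [] ≡ xs
⊕-identityʳ [] = refl
⊕-identityʳ (x ∷ xs) = refl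

⊕-comm : ∀ xs ys → xs ⊕ ys ≡ ys ⊕ xs
⊕-comm [] ys = sym (⊕-identityʳ ys)
⊕-comm (x ∷ xs) [] = refl
⊕-comm (x ∷ xs) (y ∷ ys) = cong₂ _∷_ (ℕₚ.+-comm x y) (⊕-comm xs ys)

⊕-assoc : ∀ xs ys zs → (xs ⊕ ys) ⊕ zs ≡ xs ⊕ (ys ⊕ zs)
⊕-assoc [] ys zs = refl
⊕-assoc (x ∷ xs) [] zs = refl
⊕-assoc (x ∷ xs) (y ∷ ys) [] = refl
⊕-assoc (x ∷ xs) (y ∷ ys) (z ∷ zs) = cong₂ _∷_ (ℕₚ.+-assoc x y z) (⊕-assoc xs ys zs)

⊕all-++ : ∀ B π → ⊕all (B ++ π) ≡ ⊕all B ⊕ ⊕all π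
⊕all-++ [] π = refl
⊕all-++ (x ∷ B) π = trans (cong (x ⊕_) (⊕all-++ B π)) (sym (⊕-assoc x _ _))

⊕all-↭ : ∀ {xs ys} → xs ↭ ys → ⊕all xs ≡ ⊕all ys
⊕all-↭ Perm.refl = refl
⊕all-↭ (Perm.prep x p) = cong (x ⊕_) (⊕all-↭ p)
⊕all-↭ (Perm.swap x y p) = trans (sym (⊕-assoc x y _)) (trans (cong₂ _⊕_ (⊕-comm x y) (⊕all-↭ p)) (⊕-assoc y x _))
⊕all-↭ (Perm.trans p r) = trans (⊕all-↭ p) (⊕all-↭ r)

lsum-⊕ : ∀ {f : ℕ → ℕ} → (∀ a b → f a + f b ≤ f (a + b)) → ∀ xs ys → lsum f xs + lsum f ys ≤ lsum f (xs ⊕ ys)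
lsum-⊕ h [] ys = ℕₚ.≤-refl
lsum-⊕ h (x ∷ xs) [] = ℕₚ.≤-reflexive (ℕₚ.+-identityʳ _)
lsum-⊕ {f} h (x ∷ xs) (y ∷ ys) = ℕₚ.≤-trans (ℕₚ.≤-reflexive
  (solve 4 (λ a b c d → (a :+ b) :+ (c :+ d) := (a :+ c) :+ (b :+ d)) refl (f x) (lsum f xs) (f y) (lsum f ys)))
  (ℕₚ.+-mono-≤ (h x y) (lsum-⊕ h xs ys))
  where open +-*-Solver

-- Pairs in a disjoint union lie inside one of the parts or run across.
tri-+ : ∀ a b → tri (a + b) ≡ tri a + tri b + a * b
tri-+ zero b = sym (ℕₚ.+-identityʳ (tri b))
tri-+ (suc a) b = trans (cong (a + b +_) (tri-+ a b))
  (solve 5 (λ a b s t p → a :+ b :+ (s :+ t :+ p) := a :+ s :+ t :+ (b :+ p)) refl a b (tri a) (tri b) (a * b))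
  where open +-*-Solver

tri-super : ∀ a b → tri a + tri b ≤ tri (a + b)
tri-super a b = subst (tri a + tri b ≤_) (sym (tri-+ a b)) (ℕₚ.m≤m+n _ _)

Rows : List ℕ → Set
Rows la = 1 ≤ nth1 0 la 1

-- The gain comes from the first rows, where the cross term of `tri-+` is positive. This is what
-- puts every other set partition behind the one with a single block.
triTail-⊕-strict : ∀ xs ys → Rows xs → Rows ys → triTail xs + triTail ys < triTail (xs ⊕ ys)
triTail-⊕-strict (suc x ∷ xs) (suc y ∷ ys) _ _ = ℕₚ.≤-trans (s≤s (ℕₚ.≤-reflexive
  (solve 4 (λ a b c d → (a :+ b) :+ (c :+ d) := (a :+ c) :+ (b :+ d)) refl (tri (suc x)) (triTail xs) (tri (suc y)) (triTail ys))))
  (ℕₚ.+-mono-<-≤ (subst (tri (suc x) + tri (suc y) <_) (sym (tri-+ (suc x) (suc y))) (ℕₚ.m<m+n _ (s≤s z≤n))) (lsum-⊕ tri-super xs ys))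
  where open +-*-Solver

⊕-rows : ∀ xs ys → Rows xs → Rows (xs ⊕ ys)
⊕-rows (x ∷ xs) [] r = r
⊕-rows (x ∷ xs) (y ∷ ys) r = ℕₚ.≤-trans r (ℕₚ.m≤m+n x y)

⊕all-rows : ∀ B → NonEmpty B → All Rows B → Rows (⊕all B)
⊕all-rows (x ∷ B) _ (r ∷ _) = ⊕-rows x (⊕all B) r

-- A bound for the q-degree of the product of the `H` over the blocks, as each row of length r has
-- at most `tri r` inversions.
blockTri : List (List (List ℕ)) → ℕ
blockTri π = sum (map (λ B → triTail (⊕all B)) π)

blockTri-≤ : ∀ π → blockTri π ≤ triTail (⊕all (concat π))
blockTri-≤ [] = z≤n
blockTri-≤ (B ∷ π) = subst (λ z → blockTri (B ∷ π) ≤ triTail z) (sym (⊕all-++ B (concat π)))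
  (ℕₚ.≤-trans (ℕₚ.+-monoʳ-≤ (triTail (⊕all B)) (blockTri-≤ π)) (lsum-⊕ tri-super (⊕all B) _))

blockTri-< : ∀ π → 2 ≤ length π → All NonEmpty π → All (All Rows) π → blockTri π < triTail (⊕all (concat π))
blockTri-< (B ∷ []) (s≤s ()) _ _
blockTri-< (B ∷ B' ∷ π) _ (b ∷ b' ∷ _) (r ∷ r' ∷ _) =
  subst (λ z → blockTri (B ∷ B' ∷ π) < triTail z) (sym (⊕all-++ B (concat (B' ∷ π))))
    (ℕₚ.≤-<-trans (ℕₚ.+-monoʳ-≤ (triTail (⊕all B)) (blockTri-≤ (B' ∷ π)))
      (triTail-⊕-strict (⊕all B) _ (⊕all-rows B b r)
        (subst Rows (sym (⊕all-++ B' (concat π))) (⊕-rows (⊕all B') _ (⊕all-rows B' b' r')))))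

All-⊕ : ∀ {x y} xs ys → All (_≤ x) xs → All (_≤ y) ys → All (_≤ x + y) (xs ⊕ ys)
All-⊕ {x} {y} [] ys [] k = All.map (λ l → ℕₚ.≤-trans l (ℕₚ.m≤n+m y x)) k
All-⊕ {x} {y} (a ∷ xs) [] h [] = All.map (λ l → ℕₚ.≤-trans l (ℕₚ.m≤m+n x y)) h
All-⊕ (a ∷ xs) (b ∷ ys) (l ∷ h) (m ∷ k) = ℕₚ.+-mono-≤ l m ∷ All-⊕ xs ys h k

⊕-desc : ∀ {xs ys} → Desc xs → Desc ys → Desc (xs ⊕ ys)
⊕-desc [] e = e
⊕-desc (h ∷ d) [] = h ∷ d
⊕-desc {_ ∷ xs} {_ ∷ ys} (h ∷ d) (k ∷ e) = All-⊕ xs ys h k ∷ ⊕-desc d e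

⊕all-desc : ∀ {B} → All Desc B → Desc (⊕all B)
⊕all-desc [] = []
⊕all-desc (d ∷ ds) = ⊕-desc d (⊕all-desc ds)

col-desc : ∀ k → Desc (col k)
col-desc zero = []
col-desc (suc k) = Allₚ.replicate⁺ k ℕₚ.≤-refl ∷ col-desc k

col-rows : ∀ k → 1 ≤ k → Rows (col k)
col-rows (suc k) l = ℕₚ.≤-refl

-- Conjugation

conjAt-0 : ∀ la i → All (_≤ i) la → conjAt la (suc i) ≡ 0
conjAt-0 [] i [] = refl
conjAt-0 (r ∷ la) i (l ∷ h) rewrite <ᵇ-no l = conjAt-0 la i h

vals-split : ∀ f s m k → vals f s (m + k) ≡ vals f s m ++ vals f (s + m) k
vals-split f s zero k = cong (λ z → vals f z k) (sym (ℕₚ.+-identityʳ s))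
vals-split f s (suc m) k = cong (f s ∷_) (trans (vals-split f (suc s) m k)
  (cong (λ z → vals f (suc s) m ++ vals f z k) (sym (ℕₚ.+-suc s m))))

vals-All : ∀ {Q : ℕ → Set} f s m → (∀ i → s ≤ i → i < s + m → Q (f i)) → All Q (vals f s m)
vals-All f s zero h = []
vals-All {Q} f s (suc m) h = h s ℕₚ.≤-refl (ℕₚ.m<m+n s (s≤s z≤n)) ∷
  vals-All f (suc s) m (λ i l u → h i (ℕₚ.<⇒≤ l) (subst (i <_) (sym (ℕₚ.+-suc s m)) u))

length-vals : ∀ f s m → length (vals f s m) ≡ m
length-vals f s zero = refl
length-vals f s (suc m) = cong suc (length-vals f (suc s) m)

columns-0 : ∀ cs → All (_≡ 0) cs → ⊕all (map col cs) ≡ []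
columns-0 [] [] = refl
columns-0 (.0 ∷ cs) (refl ∷ h) = columns-0 cs h

columns-suc : ∀ c cs → ⊕all (map col (map suc (c ∷ cs))) ≡ suc (length cs) ∷ ⊕all (map col (c ∷ cs))
columns-suc c [] = cong (1 ∷_) (sym (⊕-identityʳ (col c)))
columns-suc c (c' ∷ cs) rewrite columns-suc c' cs = refl

vals-map : ∀ (g f : ℕ → ℕ) s m → (∀ i → s ≤ i → i < s + m → g i ≡ suc (f i)) → vals g s m ≡ map suc (vals f s m)
vals-map g f s zero h = refl
vals-map g f s (suc m) h = cong₂ _∷_ (h s ℕₚ.≤-refl (ℕₚ.m<m+n s (s≤s z≤n)))
  (vals-map g f (suc s) m (λ i l u → h i (ℕₚ.<⇒≤ l) (subst (i <_) (sym (ℕₚ.+-suc s m)) u)))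

-- Surplus columns beyond the first part are empty and add nothing. This slack in `n` is what the
-- induction needs for the shorter rows above, and it lets two partitions be compared over a common
-- range.
columns-conjugate : ∀ la n → All (1 ≤_) la → Desc la → nth1 0 la 1 ≤ n → ⊕all (map col (vals (conjAt la) 1 n)) ≡ la
columns-conjugate [] n _ _ _ = columns-0 _ (vals-All (conjAt []) 1 n (λ _ _ _ → refl))
columns-conjugate (suc r ∷ la) n (_ ∷ pos) (h ∷ d) l =
  subst (λ m → ⊕all (map col (vals (conjAt (suc r ∷ la)) 1 m)) ≡ suc r ∷ la) (ℕₚ.m+[n∸m]≡n l) (begin
    ⊕all (map col (vals g 1 (suc r + k)))
      ≡⟨ cong (⊕all ∘ map col) (vals-split g 1 (suc r) k) ⟩
    ⊕all (map col (vals g 1 (suc r) ++ vals g (1 + suc r) k))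
      ≡⟨ cong ⊕all (Lₚ.map-++ col (vals g 1 (suc r)) _) ⟩
    ⊕all (map col (vals g 1 (suc r)) ++ map col (vals g (1 + suc r) k))
      ≡⟨ ⊕all-++ (map col (vals g 1 (suc r))) _ ⟩
    ⊕all (map col (vals g 1 (suc r))) ⊕ ⊕all (map col (vals g (1 + suc r) k))
      ≡⟨ cong (⊕all (map col (vals g 1 (suc r))) ⊕_) (columns-0 _ (vals-All g (1 + suc r) k beyond)) ⟩
    ⊕all (map col (vals g 1 (suc r))) ⊕ []
      ≡⟨ ⊕-identityʳ _ ⟩
    ⊕all (map col (vals g 1 (suc r)))
      ≡⟨ cong (⊕all ∘ map col) (vals-map g (conjAt la) 1 (suc r) within) ⟩
    ⊕all (map col (map suc (vals (conjAt la) 1 (suc r))))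
      ≡⟨ columns-suc (conjAt la 1) (vals (conjAt la) 2 r) ⟩
    suc (length (vals (conjAt la) 2 r)) ∷ ⊕all (map col (vals (conjAt la) 1 (suc r)))
      ≡⟨ cong₂ _∷_ (cong suc (length-vals (conjAt la) 2 r)) (columns-conjugate la (suc r) pos d (nth1-All z≤n h 0)) ⟩
    suc r ∷ la ∎)
  where
  open ≡.≡-Reasoning
  g = conjAt (suc r ∷ la)
  k = n ∸ suc r
  beyond : ∀ i → 1 + suc r ≤ i → i < 1 + suc r + k → g i ≡ 0
  beyond (suc i) (s≤s b) _ = conjAt-0 (suc r ∷ la) i (b ∷ All.map (λ z → ℕₚ.≤-trans z b) h)
  within : ∀ i → 1 ≤ i → i < 1 + suc r → g i ≡ suc (conjAt la i)
  within (suc i) _ (s≤s u) = conjAt-∷ (suc r) la i u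

conjugate-vals : ∀ la → conjugate la ≡ vals (conjAt la) 1 (nth1 0 la 1)
conjugate-vals la = map-oneTo (conjAt la) (nth1 0 la 1)

conjAt-injective : ∀ la mu → All (1 ≤_) la → Desc la → All (1 ≤_) mu → Desc mu →
  (∀ i → conjAt la (suc i) ≡ conjAt mu (suc i)) → la ≡ mu
conjAt-injective la mu pl dl pm dm h = begin
  la ≡⟨ sym (columns-conjugate la n pl dl (ℕₚ.m≤m⊔n _ _)) ⟩
  ⊕all (map col (vals (conjAt la) 1 n)) ≡⟨ cong (⊕all ∘ map col) (vals-cong 1 n (λ { (suc k) _ → h k })) ⟩
  ⊕all (map col (vals (conjAt mu) 1 n)) ≡⟨ columns-conjugate mu n pm dm (ℕₚ.m≤n⊔m (nth1 0 la 1) _) ⟩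
  mu ∎
  where
  open ≡.≡-Reasoning
  n = nth1 0 la 1 ⊔ nth1 0 mu 1

-- Rows all of whose pairs are inversions

down : ℕ → List ℕ
down zero = []
down (suc k) = suc k ∷ down k

lsum-↭ : ∀ f {xs ys} → xs ↭ ys → lsum f xs ≡ lsum f ys
lsum-↭ f Perm.refl = refl
lsum-↭ f (Perm.prep x p) = cong (f x +_) (lsum-↭ f p)
lsum-↭ f (Perm.swap {xs} x y p) = trans (sym (ℕₚ.+-assoc (f x) (f y) _))
  (trans (cong₂ _+_ (ℕₚ.+-comm (f x) (f y)) (lsum-↭ f p)) (ℕₚ.+-assoc (f y) (f x) _))
lsum-↭ f (Perm.trans p r) = trans (lsum-↭ f p) (lsum-↭ f r)

insertDesc : ∀ x xs → AllPairs _>_ xs → All (x ≢_) xs → Σ (List ℕ) λ ys → ys ↭ x ∷ xs × AllPairs _>_ ys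
insertDesc x [] [] [] = x ∷ [] , Perm.refl , [] ∷ []
insertDesc x (y ∷ xs) (h ∷ d) (ne ∷ nes) with y ℕ.<? x
... | yes y<x = x ∷ y ∷ xs , Perm.refl , (y<x ∷ All.map (λ l → ℕₚ.<-trans l y<x) h) ∷ h ∷ d
... | no y≮x with insertDesc x xs d nes
...   | ys , p , d' = y ∷ ys , ↭-trans (Perm.prep y p) (Perm.swap y x Perm.refl) ,
        Permₚ.All-resp-↭ (↭-sym p) (ℕₚ.≤∧≢⇒< (ℕₚ.≮⇒≥ y≮x) ne ∷ h) ∷ d'

sortDesc : ∀ xs → Unique xs → Σ (List ℕ) λ ys → ys ↭ xs × AllPairs _>_ ys
sortDesc [] [] = [] , Perm.refl , []
sortDesc (x ∷ xs) (h ∷ u) with sortDesc xs u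
... | ys , p , d with insertDesc x ys d (Permₚ.All-resp-↭ (↭-sym p) h)
...   | zs , p' , d' = zs , ↭-trans p' (Perm.prep x p) , d'

head-bound : ∀ x xs → AllPairs _>_ (x ∷ xs) → All (1 ≤_) (x ∷ xs) → suc (length xs) ≤ x
head-bound x [] _ (l ∷ []) = l
head-bound x (y ∷ ys) ((y<x ∷ _) ∷ d) (_ ∷ pos) = ℕₚ.≤-<-trans (head-bound y ys d pos) y<x

desc-sum : ∀ xs → AllPairs _>_ xs → All (1 ≤_) xs → tri (suc (length xs)) ≤ lsum id xs
desc-sum [] [] [] = z≤n
desc-sum (x ∷ xs) d@(_ ∷ d') pos@(_ ∷ pos') = ℕₚ.+-mono-≤ (head-bound x xs d pos) (desc-sum xs d' pos')

desc-sum-tight : ∀ xs → AllPairs _>_ xs → All (1 ≤_) xs → lsum id xs ≤ tri (suc (length xs)) → xs ≡ down (length xs)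
desc-sum-tight [] [] [] _ = refl
desc-sum-tight (x ∷ xs) d@(_ ∷ d') pos@(_ ∷ pos') l = cong₂ _∷_ x≡
  (desc-sum-tight xs d' pos' (ℕₚ.+-cancelˡ-≤ (suc (length xs)) _ _ (subst (λ z → z + lsum id xs ≤ _) x≡ l)))
  where
  x≡ : x ≡ suc (length xs)
  x≡ = ℕₚ.≤-antisym (ℕₚ.+-cancelʳ-≤ (tri (suc (length xs))) x (suc (length xs))
    (ℕₚ.≤-trans (ℕₚ.+-monoʳ-≤ x (desc-sum xs d' pos')) l)) (head-bound x xs d pos)

unique-sum : ∀ w → Unique w → All (1 ≤_) w → tri (suc (length w)) ≤ lsum id w
unique-sum w u pos with sortDesc w u
... | ys , p , d = ℕₚ.≤-trans (ℕₚ.≤-reflexive (cong (tri ∘ suc) (sym (Permₚ.↭-length p))))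
  (ℕₚ.≤-trans (desc-sum ys d (Permₚ.All-resp-↭ (↭-sym p) pos)) (ℕₚ.≤-reflexive (lsum-↭ id p)))

unique-sum-tight : ∀ w → Unique w → All (1 ≤_) w → lsum id w ≤ tri (suc (length w)) → w ↭ down (length w)
unique-sum-tight w u pos l with sortDesc w u
... | ys , p , d = ↭-trans (↭-sym p) (Perm.↭-reflexive (trans
  (desc-sum-tight ys d (Permₚ.All-resp-↭ (↭-sym p) pos)
    (subst (λ z → lsum id ys ≤ tri (suc z)) (sym (Permₚ.↭-length p)) (subst (_≤ tri (suc (length w))) (sym (lsum-↭ id p)) l)))
  (cong down (Permₚ.↭-length p))))

data AllInv : List ℕ → List ℕ → Set where
  [] : ∀ {b} → AllInv [] b
  bottom : ∀ {x w} → All (λ y → invCond x y 0 ≡ true) w → AllInv w [] → AllInv (x ∷ w) []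
  above : ∀ {x w z b} → All (λ y → invCond x y z ≡ true) w → AllInv w b → AllInv (x ∷ w) (z ∷ b)

lsum-ind-≤ : ∀ (p : ℕ → Bool) w → lsum (ind ∘ p) w ≤ length w
lsum-ind-≤ p [] = z≤n
lsum-ind-≤ p (y ∷ w) with p y
... | true = s≤s (lsum-ind-≤ p w)
... | false = ℕₚ.m≤n⇒m≤1+n (lsum-ind-≤ p w)

lsum-ind-tight : ∀ (p : ℕ → Bool) w → length w ≤ lsum (ind ∘ p) w → All (λ y → p y ≡ true) w
lsum-ind-tight p [] _ = []
lsum-ind-tight p (y ∷ w) l with p y in eq
... | true = eq ∷ lsum-ind-tight p w (ℕₚ.≤-pred l)
... | false = ⊥-elim (ℕₚ.<⇒≱ l (lsum-ind-≤ p w))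

-- This passes extremality down from a filling to its rows, and from a row to the pairs with a given
-- left cell.
tight-sum : ∀ {a b c d} → a ≤ c → b ≤ d → c + d ≤ a + b → c ≤ a × d ≤ b
tight-sum {a} {b} {c} {d} p q l = ℕₚ.+-cancelʳ-≤ d c a (ℕₚ.≤-trans l (ℕₚ.+-monoʳ-≤ a q)) ,
  ℕₚ.+-cancelˡ-≤ c d b (ℕₚ.≤-trans l (ℕₚ.+-monoˡ-≤ b p))

triples-≤ : ∀ w b → triples w b ≤ tri (length w)
triples-≤ [] b = z≤n
triples-≤ (x ∷ w) [] = ℕₚ.+-mono-≤ (lsum-ind-≤ (λ y → invCond x y 0) w) (triples-≤ w [])
triples-≤ (x ∷ w) (z ∷ b) = ℕₚ.+-mono-≤ (lsum-ind-≤ (λ y → invCond x y z) w) (triples-≤ w b)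

triples-tight : ∀ w b → tri (length w) ≤ triples w b → AllInv w b
triples-tight [] b l = []
triples-tight (x ∷ w) [] l with tight-sum (lsum-ind-≤ (λ y → invCond x y 0) w) (triples-≤ w []) l
... | l₁ , l₂ = bottom (lsum-ind-tight _ w l₁) (triples-tight w [] l₂)
triples-tight (x ∷ w) (z ∷ b) l with tight-sum (lsum-ind-≤ (λ y → invCond x y z) w) (triples-≤ w b) l
... | l₁ , l₂ = above (lsum-ind-tight _ w l₁) (triples-tight w b l₂)

invCond-irrefl : ∀ x z → invCond x x z ≢ true
invCond-irrefl x z e with cmp z x
... | lt a b _ rewrite b | <ᵇ-no (ℕₚ.≤-refl {x}) | a with e
...   | ()
invCond-irrefl x z e | ge a b _ rewrite a | b | <ᵇ-no (ℕₚ.≤-refl {x}) with e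
...   | ()

AllInv-unique : ∀ {w b} → AllInv w b → Unique w
AllInv-unique [] = []
AllInv-unique (bottom {x} h i) = All.map (λ {y} e → λ { refl → invCond-irrefl x 0 e }) h ∷ AllInv-unique i
AllInv-unique (above {x} {z = z} h i) = All.map (λ {y} e → λ { refl → invCond-irrefl x z e }) h ∷ AllInv-unique i

-- As the entry below is at least y, both alternatives of `invCond` that contain z < y drop out.
invCond-below : ∀ {x y z} → invCond x y z ≡ true → x ≤ z → y ≤ z → y < x
invCond-below {x} {y} {z} e x≤z y≤z with y ℕ.<? x
... | yes l = l
... | no nl rewrite <ᵇ-no (ℕₚ.≮⇒≥ nl) | <ᵇ-no y≤z | ≤ᵇ-yes x≤z with e
...   | ()

invCond-ground : ∀ {x y} → invCond x y 0 ≡ true → 1 ≤ x → y < x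
invCond-ground {x} {y} e pos with y ℕ.<? x
... | yes l = l
... | no nl rewrite <ᵇ-no (ℕₚ.≮⇒≥ nl) | ≤ᵇ-no pos | 𝔹ₚ.∧-zeroʳ (0 <ᵇ y) with e
...   | ()

down-bounds : ∀ k → All (λ x → 1 ≤ x × x ≤ k) (down k)
down-bounds zero = []
down-bounds (suc k) = (s≤s z≤n , ℕₚ.≤-refl) ∷ All.map (λ { (a , b) → a , ℕₚ.m≤n⇒m≤1+n b }) (down-bounds k)

length-down : ∀ k → length (down k) ≡ k
length-down zero = refl
length-down (suc k) = cong suc (length-down k)

-- What is known about the row beneath when the rows of an extremal filling are determined from the
-- bottom up.
data Under (k : ℕ) : List ℕ → Set where
  ground : Under k []
  row : ∀ {m b} → k ≤ m → b ≡ down m → Under k b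

-- The first cell stands on the ground or on an entry that is at least every entry of its row. Since
-- its pairs are inversions, everything to its right is smaller, so it holds the maximum. The
-- argument repeats with both rows shortened by one cell.
row-determined : ∀ {w b} k → AllInv w b → w ↭ down k → Under k b → w ≡ down k
row-determined {[]} zero _ _ _ = refl
row-determined {[]} (suc k) _ p _ with Permₚ.↭-length p
... | ()
row-determined {x ∷ w} zero _ p _ with Permₚ.↭-length p
... | ()
row-determined {x ∷ w} (suc k) i p un = go i un
  where
  bounds : All (λ x → 1 ≤ x × x ≤ suc k) (x ∷ w)
  bounds = Permₚ.All-resp-↭ (↭-sym p) (down-bounds (suc k))
  top : All (_< x) w → x ≡ suc k
  top h with Permₚ.∈-resp-↭ (↭-sym p) (here {xs = down k} refl)
  ... | here e = sym e
  ... | there m = ⊥-elim (ℕₚ.<⇒≱ (All.lookup h m) (proj₂ (All.head bounds)))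
  rest : x ≡ suc k → w ↭ down k
  rest refl = Permₚ.drop-∷ p
  finish : ∀ {b} → All (_< x) w → AllInv w b → Under k b → x ∷ w ≡ down (suc k)
  finish h i u = cong₂ _∷_ (top h) (row-determined k i (rest (top h)) u)
  go : ∀ {b} → AllInv (x ∷ w) b → Under (suc k) b → x ∷ w ≡ down (suc k)
  go (bottom h i) ground = finish (All.map (λ e → invCond-ground e (proj₁ (All.head bounds))) h) i ground
  go (bottom h i) (row {zero} () _)
  go (bottom h i) (row {suc m} _ ())
  go (above h i) (row {suc m} l refl) = finish
    (All.zipWith (λ { (e , (_ , u)) → invCond-below e (ℕₚ.≤-trans (proj₂ (All.head bounds)) l) (ℕₚ.≤-trans u l) }) (h , All.tail bounds))
    i (row (ℕₚ.≤-pred l) refl)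

partition-desc : ∀ {μ} → IsPartition μ → Desc μ
partition-desc (_ , l) = Linked⇒AllPairs (λ p q → ℕₚ.≤-trans q p) l

-- (q - 1)^(r - 1) times the cumulant

cumP : ℕ → Pqt
cumP k = constP ((-[1+ 0 ] ℤ.^ (k ∸ 1)) ℤ.* (int ((k ∸ 1) !)))

columns : List ℕ → List (List ℕ)
columns μ = map col (conjugate μ)

blockProduct : List (List (List ℕ)) → Series
blockProduct π = prod (map (λ B → H (⊕all B)) π)

K : List ℕ → Series
K μ α = sumL (setPartitions (columns μ)) (λ π → cumP (length π) *P blockProduct π α)

columns-desc : ∀ μ → All Desc (columns μ)
columns-desc μ = Allₚ.map⁺ (All.universal col-desc (conjugate μ))

columns-rows : ∀ μ → All Rows (columns μ)
columns-rows [] = []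
columns-rows (r ∷ μ) = Allₚ.map⁺ (subst (All (Rows ∘ col)) (sym (conjugate-vals (r ∷ μ)))
  (vals-All (conjAt (r ∷ μ)) 1 r (λ { (suc i) _ (s≤s u) → col-rows _ (subst (1 ≤_) (sym (conjAt-∷ r μ i u)) (s≤s z≤n)) })))

⊕all-columns : ∀ {μ} → IsPartition μ → ⊕all (columns μ) ≡ μ
⊕all-columns {μ} p = trans (cong (⊕all ∘ map col) (conjugate-vals μ)) (columns-conjugate μ _ (proj₁ p) (partition-desc p) ℕₚ.≤-refl)

blocks-All : ∀ {Q : List ℕ → Set} {Ls π} → All Q Ls → IsSetPartition Ls π → All (All Q) π
blocks-All h v = Allₚ.concat⁻ (Permₚ.All-resp-↭ (↭-sym (covers v)) h)

sum-⊕ : ∀ xs ys → sum (xs ⊕ ys) ≡ sum xs + sum ys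
sum-⊕ [] ys = refl
sum-⊕ (x ∷ xs) [] = sym (ℕₚ.+-identityʳ _)
sum-⊕ (x ∷ xs) (y ∷ ys) = trans (cong (x + y +_) (sum-⊕ xs ys))
  (solve 4 (λ a b c d → (a :+ b) :+ (c :+ d) := (a :+ c) :+ (b :+ d)) refl x y (sum xs) (sum ys))
  where open +-*-Solver

sum-blocks : ∀ π → sum (map (sum ∘ ⊕all) π) ≡ sum (⊕all (concat π))
sum-blocks [] = refl
sum-blocks (B ∷ π) = trans (cong (sum (⊕all B) +_) (sum-blocks π))
  (sym (trans (cong sum (⊕all-++ B (concat π))) (sum-⊕ (⊕all B) _)))

H-Λ : ∀ {la} → Desc la → InΛ≤ (sum la) (H la)
H-Λ {la} d = mkΛ (H-swap la d) (H-∷ʳ0 la d) (λ α l → H-degree la α (ℕₚ.<⇒≢ l))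

K-Λ : ∀ {μ} → IsPartition μ → InΛ≤ (sum μ) (K μ)
K-Λ {μ} p = sum-Λ _ (All.map term (setPartitions-valid (columns μ)))
  where
  term : ∀ {π} → IsSetPartition (columns μ) π → InΛ≤ (sum μ) (λ α → cumP (length π) *P blockProduct π α)
  term {π} v = scale-Λ (cumP (length π)) (subst (λ d → InΛ≤ d (blockProduct π))
    (trans (sum-blocks π) (cong sum (trans (⊕all-↭ (covers v)) (⊕all-columns p))))
    (prod-Λ (λ B → H (⊕all B)) (sum ∘ ⊕all) (All.map (λ ds → H-Λ (⊕all-desc ds)) (blocks-All (columns-desc μ) v))))

-- Degrees in q

QDeg≤ : ℕ → Pqt → Set
QDeg≤ N p = ∀ a b → N < a → coeffP p a b ≡ int 0

module ℤSums = RingSums ℤₚ.+-*-commutativeRing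

coeff-sumL : ∀ {A : Set} (xs : List A) (F : A → Pqt) a b → coeffP (sumL xs F) a b ≡ ℤSums.sumL xs (λ x → coeffP (F x) a b)
coeff-sumL [] F a b = refl
coeff-sumL (x ∷ xs) F a b = trans (coeff-++ (F x) (sumL xs F) a b) (cong (ℤ._+_ (coeffP (F x) a b)) (coeff-sumL xs F a b))

coeff-sum : ∀ {A : Set} {a b} (F : A → Pqt) {xs} → All (λ x → coeffP (F x) a b ≡ int 0) xs → coeffP (sumL xs F) a b ≡ int 0
coeff-sum {a = a} {b} F {xs} h = trans (coeff-sumL xs F a b) (ℤSums.sumL-zero-All h)

coeff-sum-pick : ∀ {A : Set} {a b} (F : A → Pqt) {xs} {x} → Unique xs → x ∈ xs →
  (∀ y → y ∈ xs → y ≢ x → coeffP (F y) a b ≡ int 0) → coeffP (sumL xs F) a b ≡ coeffP (F x) a b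
coeff-sum-pick {a = a} {b} F {xs} u x∈ z = trans (coeff-sumL xs F a b) (ℤSums.sumL-pick (λ x → coeffP (F x) a b) u x∈ z)

QDeg-* : ∀ {N M p r} → QDeg≤ N p → QDeg≤ M r → QDeg≤ (N + M) (p *P r)
QDeg-* {N} {M} {p} {r} hp hr a b l = trans (coeff-* p r a b) (trans (pair-local p _ (λ _ _ → int 0) local) (pair-0 p))
  where
  local : ∀ i j → coeffP p i j ≡ int 0 ⊎ pair r (shift (δ a b) i j) ≡ int 0
  local i j with N ℕ.<? i
  ... | yes N<i = inj₁ (hp i j N<i)
  ... | no N≮i with shifted-case r a b i j
  ...   | inj₁ (_ , z) = inj₂ z
  ...   | inj₂ (k , l' , e , _ , z) = inj₂ (trans z (hr k l' (ℕₚ.+-cancelˡ-< N M k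
            (ℕₚ.<-≤-trans l (subst (_≤ N + k) e (ℕₚ.+-monoˡ-≤ k (ℕₚ.≮⇒≥ N≮i)))))))

QDeg-const : ∀ c → QDeg≤ 0 (constP c)
QDeg-const c (suc a) b _ = refl

QDeg-prod : ∀ {A : Set} (F : A → Series) (deg : A → ℕ) {xs} → All (λ x → ∀ α → QDeg≤ (deg x) (F x α)) xs →
  ∀ α → QDeg≤ (sum (map deg xs)) (prod (map F xs) α)
QDeg-prod F deg [] α with allZero α
... | true = QDeg-const (int 1)
... | false = λ _ _ _ → refl
QDeg-prod F deg {x ∷ xs} (h ∷ hs) α a b l =
  coeff-sum _ (All.universal (λ β → QDeg-* {p = F x β} {r = prod (map F xs) (zipWith _∸_ α β)} (h β) (QDeg-prod F deg hs _) a b l) (below α))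

invAbove-≤ : ∀ {n la σ} b → Shaped n la σ → invAbove b σ ≤ triTail la
invAbove-≤ b [] = z≤n
invAbove-≤ b (_∷_ {w = w} (refl , _) sh) = ℕₚ.+-mono-≤ (triples-≤ w b) (invAbove-≤ w sh)

QDeg-H : ∀ la α → QDeg≤ (triTail la) (H la α)
QDeg-H la α a b l = coeff-sum _ (All.map term (fillings-shaped la (length α)))
  where
  term : ∀ {σ} → Shaped (length α) la σ →
    coeffP (select (eqListᵇ (content (length α) σ) α) (qt^ (invF la σ) (majF la σ))) a b ≡ int 0
  term {σ} sh with eqListᵇ (content (length α) σ) α
  ... | false = refl
  ... | true rewrite ≡ᵇ-≢ {invF la σ} {a} (λ e → ℕₚ.<⇒≱ l (subst (_≤ triTail la) (trans (sym (invF-structural sh)) e) (invAbove-≤ [] sh))) = refl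

QDeg-term : ∀ π α → QDeg≤ (blockTri π) (cumP (length π) *P blockProduct π α)
QDeg-term π α = QDeg-* {0} {blockTri π} {cumP (length π)} {blockProduct π α} (QDeg-const _)
  (QDeg-prod (λ B → H (⊕all B)) (triTail ∘ ⊕all) (All.universal (λ B → QDeg-H (⊕all B)) π) α)

-- By `blockTri-<` the products over several blocks stay below degree `triTail μ`. Including all
-- degrees from there upwards lets the degree bound for `K` follow from that for `H`.
topCoeff : ∀ {μ} → IsPartition μ → ∀ α a b → triTail μ ≤ a → coeffP (K μ α) a b ≡ coeffP (H μ α) a b
-- The only set partition is the one without blocks. Its coefficient `cumP 0` is 1 because of the
-- truncated subtraction, and its empty product is `one`.
topCoeff {[]} p α a b l = coeffs (P.trans (P.+-identityʳ _) (P.trans (P.*-identityˡ _) one≈H)) a b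
  where
  zeros : ∀ s α → eqListᵇ (vals (λ _ → 0) s (length α)) α ≡ allZero α
  zeros s [] = refl
  zeros s (zero ∷ α) = zeros (suc s) α
  zeros s (suc x ∷ α) = refl
  one≈H : one α ≈ H [] α
  one≈H rewrite map-oneTo (λ _ → 0) (length α) | zeros 1 α with allZero α
  ... | true = P.refl
  ... | false = P.refl
topCoeff {zero ∷ μ} ((() ∷ _) , _)
topCoeff {suc r ∷ μ} p α a b l = trans (collapse (columns (suc r ∷ μ)) refl)
  (cong (λ z → coeffP (H z α) a b) (⊕all-columns p))
  where
  bound : ∀ {π} → IsSetPartition (columns (suc r ∷ μ)) π → 2 ≤ length π → blockTri π < triTail (suc r ∷ μ)
  bound {π} v l₂ = subst (λ z → blockTri π < triTail z) (trans (⊕all-↭ (covers v)) (⊕all-columns p))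
    (blockTri-< π l₂ (nonempty v) (blocks-All (columns-rows (suc r ∷ μ)) v))
  term : List (List (List ℕ)) → Pqt
  term π = cumP (length π) *P blockProduct π α
  collapse : ∀ Ls → Ls ≡ columns (suc r ∷ μ) → coeffP (sumL (setPartitions Ls) term) a b ≡ coeffP (H (⊕all Ls) α) a b
  collapse (L ∷ Ls) e = trans (coeff-sumL (setPartitions (L ∷ Ls)) term a b)
    (trans (sum-setPartitions ℤₚ.+-*-commutativeRing L Ls (λ π → coeffP (term π) a b) smaller) (coeffs single a b))
    where
    smaller : ∀ π → IsSetPartition (L ∷ Ls) π → 2 ≤ length π → coeffP (term π) a b ≡ int 0
    smaller π v l₂ = QDeg-term π α a b (ℕₚ.<-≤-trans (bound (subst (λ z → IsSetPartition z π) e v) l₂) l)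
    single : term ((L ∷ Ls) ∷ []) ≈ H (⊕all (L ∷ Ls)) α
    single = P.trans (P.*-identityˡ _) (⊛-one (H (⊕all (L ∷ Ls))) α)

QDeg-K : ∀ {μ} → IsPartition μ → ∀ α → QDeg≤ (triTail μ) (K μ α)
QDeg-K {μ} p α a b l = trans (topCoeff p α a b (ℕₚ.<⇒≤ l)) (QDeg-H μ α a b l)

-- The extremal filling: row r contains r, …, 2, 1

canonical : List ℕ → Filling
canonical = map down

canonical-shaped : ∀ {n la} → All (_≤ n) la → Shaped n la (canonical la)
canonical-shaped [] = []
canonical-shaped {la = r ∷ la} (l ∷ h) =
  (length-down r , All.map (λ { (a , b) → a , ℕₚ.≤-trans b l }) (down-bounds r)) ∷ canonical-shaped h

occ-down : ∀ i r → occ (suc i) (down r) ≡ ind (i <ᵇ r)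
occ-down i zero = refl
occ-down i (suc r) with ℕₚ.<-cmp i r
... | tri< l ne _ rewrite ≡ᵇ-≢ {r} {i} (ne ∘ sym) | occ-down i r | <ᵇ-yes l | <ᵇ-yes (ℕₚ.m≤n⇒m≤1+n l) = refl
... | tri≈ _ refl _ rewrite ≡ᵇ-yes i | occ-down i i | <ᵇ-no (ℕₚ.≤-refl {i}) | <ᵇ-yes (ℕₚ.≤-refl {suc i}) = refl
... | tri> _ ne l rewrite ≡ᵇ-≢ {r} {i} (ne ∘ sym) | occ-down i r | <ᵇ-no (ℕₚ.<⇒≤ l) | <ᵇ-no l = refl

occ-canonical : ∀ i la → occ (suc i) (concat (canonical la)) ≡ conjAt la (suc i)
occ-canonical i [] = refl
occ-canonical i (r ∷ la) = trans (lsum-++ _ (down r) _) (trans (cong₂ _+_ (occ-down i r) (occ-canonical i la)) step)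
  where
  step : ind (i <ᵇ r) + conjAt la (suc i) ≡ conjAt (r ∷ la) (suc i)
  step with i <ᵇ r
  ... | true = refl
  ... | false = refl

length-conjugate : ∀ μ → length (conjugate μ) ≡ nth1 0 μ 1
length-conjugate μ = trans (cong length (conjugate-vals μ)) (length-vals (conjAt μ) 1 _)

content-canonical : ∀ μ → content (length (conjugate μ)) (canonical μ) ≡ conjugate μ
content-canonical μ = trans (content-occ n (canonical μ)) (trans (map-oneTo _ n)
  (trans (vals-cong 1 n (λ { (suc i) _ → occ-canonical i μ }))
    (trans (cong (vals (conjAt μ) 1) (length-conjugate μ)) (sym (conjugate-vals μ)))))
  where n = length (conjugate μ)

parts-≤ : ∀ {μ} → Desc μ → All (_≤ length (conjugate μ)) μ
parts-≤ {[]} [] = []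
parts-≤ {r ∷ μ} (h ∷ d) = subst (λ z → All (_≤ z) (r ∷ μ)) (sym (length-conjugate (r ∷ μ))) (ℕₚ.≤-refl ∷ h)

invCond-desc : ∀ {x y z} → y < x → x ≤ z → invCond x y z ≡ true
invCond-desc {x} {y} {z} l m rewrite ≤ᵇ-yes m | <ᵇ-no (ℕₚ.≤-trans (ℕₚ.<⇒≤ l) m) | <ᵇ-yes l = refl

lsum-true : ∀ (p : ℕ → Bool) w → All (λ y → p y ≡ true) w → lsum (ind ∘ p) w ≡ length w
lsum-true p [] [] = refl
lsum-true p (y ∷ w) (h ∷ hs) rewrite h = cong suc (lsum-true p w hs)

triples-down : ∀ {b} r → Under r b → triples (down r) b ≡ tri r
triples-down zero u = refl
triples-down (suc r) ground = cong₂ _+_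
  (trans (lsum-true (λ y → invCond (suc r) y 0) (down r) (All.map (λ { (a , b) → trans (invCond-bottom (suc r) _ (s≤s z≤n) a) (<ᵇ-yes (s≤s b)) }) (down-bounds r))) (length-down r))
  (triples-down r ground)
triples-down (suc r) (row {suc m} l refl) = cong₂ _+_
  (trans (lsum-true (λ y → invCond (suc r) y (suc m)) (down r) (All.map (λ { (_ , b) → invCond-desc (s≤s b) l }) (down-bounds r))) (length-down r))
  (triples-down r (row (ℕₚ.≤-pred l) refl))

invAbove-canonical : ∀ {b la} → All (λ r → Under r b) la → Desc la → invAbove b (canonical la) ≡ triTail la
invAbove-canonical [] [] = refl
invAbove-canonical (u ∷ _) (h ∷ d) = cong₂ _+_ (triples-down _ u) (invAbove-canonical (All.map (λ l → row l refl) h) d)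

tExponent-down : ∀ leg r m → r ≤ m → tExponent leg (down r) (down m) ≡ 0
tExponent-down leg zero m l = refl
tExponent-down leg (suc r) (suc m) (s≤s l) rewrite <ᵇ-no l = tExponent-down (leg ∘ suc) r m l

majAbove-canonical : ∀ {m la} → All (_≤ m) la → Desc la → majAbove (down m) la (canonical la) ≡ 0
majAbove-canonical [] [] = refl
majAbove-canonical (l ∷ _) (h ∷ d) = cong₂ _+_ (tExponent-down _ _ _ l) (majAbove-canonical h d)

maj-canonical : ∀ {la} → Desc la → maj la (canonical la) ≡ 0
maj-canonical [] = refl
maj-canonical (h ∷ d) = majAbove-canonical h d

weight : List ℕ → ℕ
weight = lsum (tri ∘ suc)

lsum-canonical : ∀ la → lsum id (concat (canonical la)) ≡ weight la
lsum-canonical [] = refl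
lsum-canonical (r ∷ la) = trans (lsum-++ id (down r) _) (cong₂ _+_ (go r) (lsum-canonical la))
  where
  go : ∀ r → lsum id (down r) ≡ tri (suc r)
  go zero = refl
  go (suc r) = cong (suc r +_) (go r)

top-sum : ∀ {n la σ} b → Shaped n la σ → triTail la ≤ invAbove b σ → weight la ≤ lsum id (concat σ)
top-sum b [] l = z≤n
top-sum b (_∷_ {w = w} {σ = σ} (refl , h) sh) l with tight-sum (triples-≤ w b) (invAbove-≤ w sh) l
... | l₁ , l₂ = subst (_ ≤_) (sym (lsum-++ id w (concat σ)))
  (ℕₚ.+-mono-≤ (unique-sum w (AllInv-unique (triples-tight w b l₁)) (All.map proj₁ h)) (top-sum w sh l₂))

data TopRows : List ℕ → List ℕ → Filling → Set where
  [] : ∀ {b} → TopRows b [] []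
  _∷_ : ∀ {b r la w σ} → AllInv w b × w ↭ down r → TopRows w la σ → TopRows b (r ∷ la) (w ∷ σ)

-- In each row extremality of the inversions comes first, as it makes the entries distinct; equality
-- of the entry sums then leaves only the entries 1, ..., r.
top-tight : ∀ {n la σ} b → Shaped n la σ → triTail la ≤ invAbove b σ → lsum id (concat σ) ≤ weight la → TopRows b la σ
top-tight b [] l l' = []
top-tight b (_∷_ {w = w} {σ = σ} (refl , h) sh) l l' with tight-sum (triples-≤ w b) (invAbove-≤ w sh) l
... | l₁ , l₂ with triples-tight w b l₁
...   | inv with tight-sum (unique-sum w (AllInv-unique inv) (All.map proj₁ h)) (top-sum w sh l₂) (subst (_≤ _) (lsum-++ id w (concat σ)) l')
...     | s₁ , s₂ = (inv , unique-sum-tight w (AllInv-unique inv) (All.map proj₁ h) s₁) ∷ top-tight w sh l₂ s₂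

top-occ : ∀ {b la σ} k → TopRows b la σ → occ k (concat σ) ≡ occ k (concat (canonical la))
top-occ k [] = refl
top-occ k (_∷_ {r = r} {w = w} (_ , p) t) = trans (lsum-++ _ w _)
  (trans (cong₂ _+_ (lsum-↭ _ p) (top-occ k t)) (sym (lsum-++ _ (down r) _)))

top-canonical : ∀ {b la σ} → TopRows b la σ → All (λ r → Under r b) la → Desc la → σ ≡ canonical la
top-canonical [] _ _ = refl
top-canonical (_∷_ {r = r} (i , p) t) (u ∷ _) (h ∷ d) with row-determined r i p u
... | refl = cong (down r ∷_) (top-canonical t (All.map (λ l → row l refl) h) d)

vals-injective : ∀ f g s n → vals f s n ≡ vals g s n → ∀ i → s ≤ i → i < s + n → f i ≡ g i
vals-injective f g s zero e i l u = ⊥-elim (ℕₚ.<⇒≱ u (subst (_≤ i) (sym (ℕₚ.+-identityʳ s)) l))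
vals-injective f g s (suc n) e i l u with s ℕ.≟ i
... | yes refl = Lₚ.∷-injectiveˡ e
... | no ne = vals-injective f g (suc s) n (Lₚ.∷-injectiveʳ e) i (ℕₚ.≤∧≢⇒< l ne) (subst (i <_) (ℕₚ.+-suc s n) u)

occ-absent : ∀ k l → All (_≢ k) l → occ k l ≡ 0
occ-absent k [] [] = refl
occ-absent k (y ∷ l) (h ∷ hs) rewrite ≡ᵇ-≢ h = occ-absent k l hs

words-unique : ∀ r n → Unique (words r n)
fillings-unique : ∀ la n → Unique (fillings la n)
prefix-unique : ∀ {A : Set} (xs : List A) (ys : List (List A)) → Unique xs → Unique ys → Unique (concatMap (λ x → map (x ∷_) ys) xs)
prefix-unique [] ys [] uy = []
prefix-unique (x ∷ xs) ys (h ∷ ux) uy = Uniqueₚ.++⁺ (Uniqueₚ.map⁺ Lₚ.∷-injectiveʳ uy) (prefix-unique xs ys ux uy) disjoint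
  where
  heads : ∀ xs → All (x ≢_) xs → ∀ {z} → x ∷ z ∈ concatMap (λ x → map (x ∷_) ys) xs → ⊥
  heads (x' ∷ xs) (ne ∷ nes) m with ∈ₚ.∈-++⁻ (map (x' ∷_) ys) m
  ... | inj₂ m' = heads xs nes m'
  ... | inj₁ m' with ∈ₚ.∈-map⁻ (x' ∷_) m'
  ...   | _ , _ , e = ne (Lₚ.∷-injectiveˡ e)
  disjoint : ∀ {v} → v ∈ map (x ∷_) ys × v ∈ concatMap (λ x → map (x ∷_) ys) xs → ⊥
  disjoint (m , m') with ∈ₚ.∈-map⁻ (x ∷_) m
  ... | z , _ , refl = heads xs h m'
words-unique zero n = [] ∷ []
words-unique (suc r) n = prefix-unique (oneTo n) (words r n) (oneTo-unique n) (words-unique r n)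
fillings-unique [] n = [] ∷ []
fillings-unique (r ∷ la) n = prefix-unique (words r n) (fillings la n) (words-unique r n) (fillings-unique la n)
prefix-∈ : ∀ {A : Set} {xs : List A} {ys x y} → x ∈ xs → y ∈ ys → List._∷_ {A = A} x y ∈ concatMap (λ x → map (x ∷_) ys) xs
prefix-∈ {x = x} (here refl) y∈ = ∈ₚ.∈-++⁺ˡ (∈ₚ.∈-map⁺ (List._∷_ x) y∈)
prefix-∈ {xs = x' ∷ _} {ys} (there x∈) y∈ = ∈ₚ.∈-++⁺ʳ (map (List._∷_ x') ys) (prefix-∈ x∈ y∈)
words-∈ : ∀ {n} w → All (λ x → 1 ≤ x × x ≤ n) w → w ∈ words (length w) n
words-∈ [] [] = here refl
words-∈ (suc x ∷ w) ((_ , l) ∷ h) = prefix-∈ (∈-oneTo l) (words-∈ w h)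
fillings-∈ : ∀ {n la σ} → Shaped n la σ → σ ∈ fillings la n
fillings-∈ [] = here refl
fillings-∈ ((refl , h) ∷ sh) = prefix-∈ (words-∈ _ h) (fillings-∈ sh)

-- Top coefficients at the exponent μᵗ

module Extremal {μ} (pμ : IsPartition μ) where
  n : ℕ
  n = length (conjugate μ)

  same-occ : ∀ {ν σ} → Shaped n ν σ → content n σ ≡ conjugate μ → ∀ i → occ (suc i) (concat σ) ≡ occ (suc i) (concat (canonical μ))
  same-occ {σ = σ} sh e i with i ℕ.<? n
  ... | yes l = vals-injective _ _ 1 n (begin
      vals (λ k → occ k (concat σ)) 1 n ≡⟨ sym (map-oneTo _ n) ⟩
      map (λ k → occ k (concat σ)) (oneTo n) ≡⟨ sym (content-occ n σ) ⟩
      content n σ ≡⟨ trans e (sym (content-canonical μ)) ⟩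
      content n (canonical μ) ≡⟨ content-occ n (canonical μ) ⟩
      map (λ k → occ k (concat (canonical μ))) (oneTo n) ≡⟨ map-oneTo _ n ⟩
      vals (λ k → occ k (concat (canonical μ))) 1 n ∎) (suc i) (s≤s z≤n) (s≤s l)
    where open ≡.≡-Reasoning
  ... | no nl = trans (absent sh) (sym (absent (canonical-shaped (parts-≤ (partition-desc pμ)))))
    where
    absent : ∀ {ν σ} → Shaped n ν σ → occ (suc i) (concat σ) ≡ 0
    absent sh = occ-absent (suc i) _ (All.map (λ { (_ , u) refl → nl u }) (shaped-entries sh))

  same-sum : ∀ {ν σ} → Shaped n ν σ → content n σ ≡ conjugate μ → lsum id (concat σ) ≡ weight μ
  same-sum {ν} {σ} sh e = begin
    lsum id (concat σ) ≡⟨ sym (double-count n id (concat σ) (shaped-entries sh)) ⟩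
    su n (λ i → suc i * occ (suc i) (concat σ)) ≡⟨ su-cong n (λ i _ → cong (suc i *_) (same-occ sh e i)) ⟩
    su n (λ i → suc i * occ (suc i) (concat (canonical μ)))
      ≡⟨ double-count n id (concat (canonical μ)) (shaped-entries (canonical-shaped {la = μ} (parts-≤ (partition-desc pμ)))) ⟩
    lsum id (concat (canonical μ)) ≡⟨ lsum-canonical μ ⟩
    weight μ ∎
    where open ≡.≡-Reasoning

  topRows : ∀ {ν σ} → weight μ ≤ weight ν → Shaped n ν σ → content n σ ≡ conjugate μ → invF ν σ ≡ triTail ν → TopRows [] ν σ
  topRows {ν} {σ} l sh e i = top-tight [] sh (ℕₚ.≤-reflexive (trans (sym i) (invF-structural sh)))
    (subst (_≤ weight ν) (sym (same-sum sh e)) l)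

  term : List ℕ → Filling → Pqt
  term ν σ = select (eqListᵇ (content n σ) (conjugate μ)) (qt^ (invF ν σ) (majF ν σ))

  term-cases : ∀ ν σ b → coeffP (term ν σ) (triTail ν) b ≡ int 0 ⊎ (content n σ ≡ conjugate μ × invF ν σ ≡ triTail ν)
  term-cases ν σ b with eqListᵇ (content n σ) (conjugate μ) | eqListᵇ-sound (content n σ) (conjugate μ)
  ... | false | _ = inj₁ refl
  ... | true | s with invF ν σ ℕ.≟ triTail ν
  ...   | yes e = inj₂ (s refl , e)
  ...   | no ne rewrite ≡ᵇ-≢ ne = inj₁ refl

  -- A contributing filling of ν has entry sum `weight μ`, at most `weight ν`, which is the minimum
  -- for fillings of top q-degree. Equality forces its content to be νᵗ; but the content is μᵗ, and
  -- conjugation is injective.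
  off-diagonal : ∀ {ν} → IsPartition ν → ν ≢ μ → weight μ ≤ weight ν → ∀ b → coeffP (H ν (conjugate μ)) (triTail ν) b ≡ int 0
  off-diagonal {ν} pν ne l b = coeff-sum _ (All.map zero-term (fillings-shaped ν n))
    where
    zero-term : ∀ {σ} → Shaped n ν σ → coeffP (term ν σ) (triTail ν) b ≡ int 0
    zero-term {σ} sh with term-cases ν σ b
    ... | inj₁ z = z
    ... | inj₂ (e , i) = ⊥-elim (ne (conjAt-injective ν μ (proj₁ pν) (partition-desc pν) (proj₁ pμ) (partition-desc pμ)
        (λ k → trans (sym (occ-canonical k ν)) (trans (sym (top-occ (suc k) (topRows l sh e i)))
          (trans (same-occ sh e k) (occ-canonical k μ))))))

  -- Only the canonical filling contributes, and it has no descents. The pivot is thus exactly 1,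
  -- with no power of t.
  diagonal : ∀ b → coeffP (H μ (conjugate μ)) (triTail μ) b ≡ (if 0 ≡ᵇ b then int 1 else int 0)
  diagonal b = trans (coeff-sum-pick (term μ) (fillings-unique μ n) (fillings-∈ csh) others) top
    where
    d = partition-desc pμ
    csh : Shaped n μ (canonical μ)
    csh = canonical-shaped (parts-≤ d)
    others : ∀ σ → σ ∈ fillings μ n → σ ≢ canonical μ → coeffP (term μ σ) (triTail μ) b ≡ int 0
    others σ σ∈ ne with term-cases μ σ b
    ... | inj₁ z = z
    ... | inj₂ (e , i) = ⊥-elim (ne (top-canonical (topRows ℕₚ.≤-refl (All.lookup (fillings-shaped μ n) σ∈) e i)
        (All.universal (λ _ → ground) μ) d))
    top : coeffP (term μ (canonical μ)) (triTail μ) b ≡ (if 0 ≡ᵇ b then int 1 else int 0)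
    top rewrite content-canonical μ | eqListᵇ-refl (conjugate μ) | invF-structural csh | majF-structural d csh
      | invAbove-canonical {[]} (All.universal (λ _ → ground) μ) d | maj-canonical d | ≡ᵇ-yes (triTail μ) = ℤₚ.+-identityʳ _

-- Linear independence over ℤ[q,t]

unique-map⁻ : ∀ {A B : Set} {f : A → B} {xs} → Unique (map f xs) → Unique xs
unique-map⁻ {f = f} u = AllPairs.map (λ ne → ne ∘ cong f) (AllPairsₚ.map⁻ u)

unique-key : ∀ {A B : Set} {f : A → B} {xs x y} → Unique (map f xs) → x ∈ xs → y ∈ xs → f x ≡ f y → x ≡ y
unique-key u (here refl) (here refl) e = refl
unique-key {f = f} (h ∷ u) (here refl) (there y∈) e = ⊥-elim (All.lookup h (∈ₚ.∈-map⁺ f y∈) e)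
unique-key {f = f} (h ∷ u) (there x∈) (here refl) e = ⊥-elim (All.lookup h (∈ₚ.∈-map⁺ f x∈) (sym e))
unique-key (h ∷ u) (there x∈) (there y∈) e = unique-key u x∈ y∈ e

Combination : Set
Combination = List (Pqt × List ℕ)

combine : Combination → List ℕ → Pqt
combine L α = sumL L (λ p → proj₁ p *P K (proj₂ p) α)

-- Coefficients are killed by descending induction on the total q-degree e of C·K μ and, for fixed e, by ascending
-- induction on the weight of μ, reading off the coefficient of q^e at the exponent μᵗ.
module Independence (L : Combination) (parts : All (IsPartition ∘ proj₂) L) (distinct : Unique (map proj₂ L))
                    (relation : ∀ α → combine L α ≋ []) where

  -- A term q^a of C reaches at most q^(a + `triTail μ`) in `C *P K μ`, so the induction runs on
  -- this total degree and not on that of C.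
  Vanish : ℕ → Set
  Vanish e = ∀ {C μ} → (C , μ) ∈ L → ∀ a b → e ≤ a + triTail μ → coeffP C a b ≡ int 0

  vanish-large : Σ ℕ Vanish
  vanish-large = go L
    where
    go : ∀ L → Σ ℕ λ e → ∀ {C μ} → (C , μ) ∈ L → ∀ a b → e ≤ a + triTail μ → coeffP C a b ≡ int 0
    go [] = 0 , λ ()
    go ((C , μ) ∷ L) with box C | go L
    ... | A , B , inb | e , h = (A + triTail μ) + e , λ
      { (here refl) a b l → coeff-outside C A B inb a b (inj₁ (ℕₚ.+-cancelʳ-≤ (triTail μ) A a (ℕₚ.≤-trans (ℕₚ.m≤m+n _ e) l)))
      ; (there m) a b l → h m a b (ℕₚ.≤-trans (ℕₚ.m≤n+m e (A + triTail μ)) l) }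

  module Descent (e : ℕ) (vanish : Vanish (suc e)) where

    level : ∀ k {C μ} → (C , μ) ∈ L → weight μ < k → ∀ a b → a + triTail μ ≡ e → coeffP C a b ≡ int 0
    level (suc k) {C} {μ} C∈ (s≤s w≤k) a b ea = begin
      coeffP C a b ≡⟨ coeff-pair C a b ⟩
      pair C (δ a b) ≡⟨ sym (pair-local C _ (δ a b) own) ⟩
      pair C (λ i j → pair (K μ α) (shift (δ e b) i j)) ≡⟨ sym (coeff-* C (K μ α) e b) ⟩
      coeffP (C *P K μ α) e b ≡⟨ sym (coeff-sum-pick (λ p → proj₁ p *P K (proj₂ p) α) (unique-map⁻ distinct) C∈ others) ⟩
      coeffP (combine L α) e b ≡⟨ coeffs (relation α) e b ⟩
      int 0 ∎
      where
      open ≡.≡-Reasoning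
      α = conjugate μ
      pμ = All.lookup parts C∈
      open Extremal pμ using (off-diagonal; diagonal)
      K-top : ∀ {ν} → IsPartition ν → ∀ b → coeffP (K ν α) (triTail ν) b ≡ coeffP (H ν α) (triTail ν) b
      K-top p b = topCoeff p α _ b ℕₚ.≤-refl
      δ-off : ∀ i j → i ≢ a ⊎ j ≢ b → int 0 ≡ δ a b i j
      δ-off i j (inj₁ ne) rewrite ≡ᵇ-≢ ne = refl
      δ-off i j (inj₂ ne) rewrite ≡ᵇ-≢ ne with i ≡ᵇ a
      ... | Bool.true = refl
      ... | Bool.false = refl
      own : ∀ i j → coeffP C i j ≡ int 0 ⊎ pair (K μ α) (shift (δ e b) i j) ≡ δ a b i j
      -- The exponent `e` splits as `i + k'`. If `k'` is below the top degree of `K μ`, then `i` is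
      -- so large that `C` has no term there by `vanish`; if it is above, `K μ` has none. At the top
      -- degree `diagonal` leaves just i = a, j = b.
      own i j with shifted-case (K μ α) e b i j
      ... | inj₁ (inj₁ e<i , z) = inj₂ (trans z (δ-off i j (inj₁ (λ { refl → ℕₚ.<⇒≱ e<i (subst (i ≤_) ea (ℕₚ.m≤m+n i _)) }))))
      ... | inj₁ (inj₂ b<j , z) = inj₂ (trans z (δ-off i j (inj₂ (λ { refl → ℕₚ.<-irrefl refl b<j }))))
      ... | inj₂ (k' , l , ei , ej , z) with ℕₚ.<-cmp k' (triTail μ)
      ...   | tri< k'< _ _ = inj₁ (vanish C∈ i j (subst (λ x → suc x ≤ i + triTail μ) ei (ℕₚ.+-monoʳ-< i k'<)))
      ...   | tri> _ _ k'> = inj₂ (trans z (trans (QDeg-K pμ α k' l k'>)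
                (δ-off i j (inj₁ (λ { refl → ℕₚ.<-irrefl (ℕₚ.+-cancelˡ-≡ i _ _ (trans ea (sym ei))) k'> })))))
      ...   | tri≈ _ refl _ = inj₂ (trans z (trans (K-top pμ l) (trans (diagonal l) (on l ej))))
        where
        on : ∀ l → j + l ≡ b → (if 0 ≡ᵇ l then int 1 else int 0) ≡ δ a b i j
        on zero ej rewrite ℕₚ.+-cancelʳ-≡ (triTail μ) i a (trans ei (sym ea)) | trans (sym (ℕₚ.+-identityʳ j)) ej
          | ≡ᵇ-yes a | ≡ᵇ-yes b = refl
        on (suc l) ej = δ-off i j (inj₂ (λ { refl → ℕₚ.m+1+n≢m j ej }))
      others : ∀ p → p ∈ L → p ≢ (C , μ) → coeffP (proj₁ p *P K (proj₂ p) α) e b ≡ int 0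
      others (C' , ν) p∈ ne = trans (coeff-* C' (K ν α) e b) (trans (pair-local C' _ (λ _ _ → int 0) local) (pair-0 C'))
        where
        pν = All.lookup parts p∈
        local : ∀ i j → coeffP C' i j ≡ int 0 ⊎ pair (K ν α) (shift (δ e b) i j) ≡ int 0
        -- The same splitting. At the top degree a lighter ν is settled by the induction on the
        -- weight, and any other ν by `off-diagonal`.
        local i j with shifted-case (K ν α) e b i j
        ... | inj₁ (_ , z) = inj₂ z
        ... | inj₂ (k' , l , ei , ej , z) with ℕₚ.<-cmp k' (triTail ν)
        ...   | tri< k'< _ _ = inj₁ (vanish p∈ i j (subst (λ x → suc x ≤ i + triTail ν) ei (ℕₚ.+-monoʳ-< i k'<)))
        ...   | tri> _ _ k'> = inj₂ (trans z (QDeg-K pν α k' l k'>))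
        ...   | tri≈ _ refl _ with weight ν ℕ.<? weight μ
        ...     | yes lighter = inj₁ (level k p∈ (ℕₚ.<-≤-trans lighter w≤k) i j ei)
        ...     | no heavier = inj₂ (trans z (trans (K-top pν l) (off-diagonal pν
                    (λ ν≡μ → ne (unique-key distinct p∈ C∈ ν≡μ)) (ℕₚ.≮⇒≥ heavier) l)))

    descend : Vanish e
    descend {C} {μ} C∈ a b l with ℕₚ.m≤n⇒m<n∨m≡n l
    ... | inj₁ l' = vanish C∈ a b l'
    ... | inj₂ eq = level (suc (weight μ)) C∈ ℕₚ.≤-refl a b (sym eq)

  vanish-all : ∀ e → Vanish e → Vanish 0
  vanish-all zero v = v
  vanish-all (suc e) v = vanish-all e (Descent.descend e v)

  independent : All (λ p → proj₁ p ≋ []) L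
  independent = All.tabulate (λ {p} p∈ → eqP (λ a b → vanish-all _ (proj₂ vanish-large) p∈ a b z≤n))

-- Nonzero elements and cancellation in ℤ[q,t]

1P : Pqt
1P = constP (int 1)

1≉0 : ¬ 1P ≋ []
1≉0 (eqP h) with h 0 0
... | ()

nonzero-*P : ∀ {p r} → ¬ p ≋ [] → ¬ r ≋ [] → ¬ p *P r ≋ []
nonzero-*P np nr z = np (≋-domain z nr)

qMinus1≉0 : ¬ qMinus1 ≋ []
qMinus1≉0 (eqP h) with h 1 0
... | ()

powP≉0 : ∀ {p} → ¬ p ≋ [] → ∀ n → ¬ powP p n ≋ []
powP≉0 np zero = 1≉0
powP≉0 np (suc n) = nonzero-*P np (powP≉0 np n)

cancelʳ : ∀ {x y k} → ¬ k ≋ [] → x *P k ≋ y *P k → x ≋ y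
cancelʳ {x} {y} {k} nk h = x∙y⁻¹≈ε⇒x≈y x y (≋-domain {r = k}
  (P.trans (P.distribʳ k x (negP y)) (P.trans (P.+-cong h (P.sym (-‿distribˡ-* y k))) (P.-‿inverseʳ (y *P k)))) nk)

module Laws = FractionLaws polyRing

-- Fractions

infix 4 _≃_
_≃_ : QT → QT → Set
x ≃ y = num x *P den y ≋ num y *P den x

-- Cross-multiplied equality passes only through a nonzero middle denominator, since that
-- denominator has to be cancelled.
≃-trans : ∀ {x y z} → ¬ den y ≋ [] → x ≃ y → y ≃ z → x ≃ z
≃-trans {x} {y} {z} ny h k = cancelʳ ny (begin
  (num x *P den z) *P den y ≈⟨ Laws.swap₁ (num x) (den z) (den y) ⟩
  (num x *P den y) *P den z ≈⟨ P.*-congʳ h ⟩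
  (num y *P den x) *P den z ≈⟨ Laws.swap₁ (num y) (den x) (den z) ⟩
  (num y *P den z) *P den x ≈⟨ P.*-congʳ k ⟩
  (num z *P den y) *P den x ≈⟨ Laws.swap₁ (num z) (den y) (den x) ⟩
  (num z *P den x) *P den y ∎)
  where open import Relation.Binary.Reasoning.Setoid P.setoid

-- The operations `_+Q_` and `_*Q_` never cancel, so numerator and denominator can be followed
-- separately. This is finer than equality of fractions and needs no nonvanishing.
record Rep (x : QT) (p d : Pqt) : Set where
  constructor rep
  field
    numerator : num x ≋ p
    denominator : den x ≋ d
open Rep

rep-≃ : ∀ {x y p r d} → Rep x p d → Rep y r d → p ≋ r → x ≃ y
rep-≃ (rep n d) (rep n' d') e = P.*-cong (P.trans n (P.trans e (P.sym n'))) (P.trans d' (P.sym d))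

num0-≃ : ∀ {x} → num x ≋ [] → x ≃ 0Q
num0-≃ {x} h = P.*-congʳ {1P} h

≃-num0 : ∀ {x} → x ≃ 0Q → num x ≋ []
≃-num0 {x} h = P.trans (P.sym (P.*-identityʳ (num x))) h

-- Equality with p / s in cross-multiplied form. Unlike `Rep` it keeps a common denominator `s` in
-- sums, although `_+Q_` multiplies the actual denominators.
record Frac (x : QT) (p s : Pqt) : Set where
  constructor frac
  field
    valid : ¬ den x ≋ []
    value : num x *P s ≋ p *P den x
open Frac

rep-fraction : ∀ n e {x k s y m D m'} → Rep x k s → Rep y m D → m' ≋ (e *P s) *P m →
  Rep (((n / e) *Q x) +Q y) (((n *P D) *P k) +P m') ((e *P s) *P D)
rep-fraction n e {x} {k} {s} {y} {m} {D} (rep hn hd) (rep hn' hd') h = rep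
  (P.trans (P.+-cong (P.*-cong {n *P num x} {n *P k} {den y} {D} (P.*-congˡ {n} hn) hd')
                     (P.*-cong {num y} {m} {e *P den x} {e *P s} hn' (P.*-congˡ {e} hd)))
    (P.trans (Laws.sum-num n k D m (e *P s)) (P.+-congˡ {(n *P D) *P k} (P.sym h))))
  (P.*-cong {e *P den x} {e *P s} {den y} {D} (P.*-congˡ {e} hd) hd')

frac-fraction : ∀ C S {x k s y m} → ¬ S ≋ [] → ¬ s ≋ [] → Rep x k s → Frac y m S →
  Frac ((((C *P s) / S) *Q x) +Q y) ((C *P k) +P m) S
frac-fraction C S {x} {k} {s} {y} {m} S≉0 s≉0 (rep hn hd) (frac v h) = frac (nonzero-*P x≉0 v) (begin
  ((nx *P dy) +P (ny *P dx)) *P S ≈⟨ Laws.frac-sum nx ny dx dy S ⟩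
  ((nx *P S) *P dy) +P ((ny *P S) *P dx) ≈⟨ P.+-cong (P.*-congʳ {dy} head) (P.*-congʳ {dx} h) ⟩
  (((C *P k) *P dx) *P dy) +P ((m *P dy) *P dx) ≈⟨ Laws.frac-sum' (C *P k) m dx dy ⟩
  ((C *P k) +P m) *P (dx *P dy) ∎)
  where
  open import Relation.Binary.Reasoning.Setoid P.setoid
  nx = (C *P s) *P num x
  dx = S *P den x
  ny = num y
  dy = den y
  x≉0 : ¬ dx ≋ []
  x≉0 = nonzero-*P S≉0 (λ z → s≉0 (P.trans (P.sym hd) z))
  head : nx *P S ≋ (C *P k) *P dx
  head = P.trans (P.*-congʳ {S} (P.*-congˡ {C *P s} hn))
    (P.trans (Laws.entry C s k S) (P.*-congˡ {C *P k} (P.*-congˡ {S} (P.sym hd))))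

rep-+ : ∀ {x y p r} → Rep x p 1P → Rep y r 1P → Rep (x +Q y) (p +P r) 1P
rep-+ {p = p} {r} (rep n d) (rep n' d') = rep
  (P.+-cong (P.trans (P.*-cong n d') (P.*-identityʳ p)) (P.trans (P.*-cong n' d) (P.*-identityʳ r)))
  (P.trans (P.*-cong d d') (P.*-identityʳ 1P))

rep-* : ∀ {x y p r} → Rep x p 1P → Rep y r 1P → Rep (x *Q y) (p *P r) 1P
rep-* (rep n d) (rep n' d') = rep (P.*-cong n n') (P.trans (P.*-cong d d') (P.*-identityʳ 1P))

rep-sumQ : ∀ {A : Set} (F : A → QT) (G : A → Pqt) xs → (∀ x → Rep (F x) (G x) 1P) → Rep (sumQ (map F xs)) (sumL xs G) 1P
rep-sumQ F G [] h = rep P.refl P.refl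
rep-sumQ F G (x ∷ xs) h = rep-+ (h x) (rep-sumQ F G xs h)

rep-cong : ∀ {x p r d} → p ≋ r → Rep x p d → Rep x r d
rep-cong e (rep n d) = rep (P.trans n e) d

rep-Htilde : ∀ la α → Rep (Htilde la α) (H la α) 1P
rep-Htilde la α = rep-cong (sumL-filter (λ σ → eqListᵇ (content (length α) σ) α) (fillings la (length α)) (λ σ → qt^ (invF la σ) (majF la σ)))
  (rep-sumQ _ (λ σ → qt^ (invF la σ) (majF la σ)) (filterᵇ (λ σ → eqListᵇ (content (length α) σ) α) (fillings la (length α))) (λ σ → rep P.refl P.refl))

RepS : Ser → Series → Set
RepS F G = ∀ α → Rep (F α) (G α) 1P

rep-prodS : ∀ {A : Set} (F : A → Ser) (G : A → Series) xs → (∀ x → RepS (F x) (G x)) → RepS (prodS (map F xs)) (prod (map G xs))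
rep-prodS F G [] h α with allZero α
... | true = rep P.refl P.refl
... | false = rep P.refl P.refl
rep-prodS F G (x ∷ xs) h α = rep-sumQ _ _ (below α) (λ β → rep-* (h x β) (rep-prodS F G xs h (zipWith _∸_ α β)))

rep-sumS : ∀ {A : Set} (F : A → Ser) (G : A → Series) xs → (∀ x → RepS (F x) (G x)) →
  RepS (sumS (map F xs)) (λ α → sumL xs (λ x → G x α))
rep-sumS F G [] h α = rep P.refl P.refl
rep-sumS F G (x ∷ xs) h α = rep-+ (h x α) (rep-sumS F G xs h α)

scaleD : List ℕ → Pqt
scaleD μ = powP qMinus1 (length (columns μ) ∸ 1)

scaleD≉0 : ∀ μ → ¬ scaleD μ ≋ []
scaleD≉0 μ = powP≉0 qMinus1≉0 (length (columns μ) ∸ 1)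

-- The values of `Htilde` have denominator 1, and sums and products preserve this, so the only
-- denominator is the power of q - 1 in front of the cumulant.
rep-Hbar : ∀ μ α → Rep (Hbar μ α) (K μ α) (scaleD μ)
rep-Hbar μ α = rep (P.trans (P.*-identityˡ (num (sumS terms α))) (numerator total))
  (P.trans (P.*-congˡ {scaleD μ} (denominator total)) (P.*-identityʳ (scaleD μ)))
  where
  terms : List Ser
  terms = map (λ π → cumCoef (length π) ·S prodS (map (λ B → Htilde (⊕all B)) π)) (setPartitions (columns μ))
  total : Rep (sumS terms α) (K μ α) 1P
  total = rep-sumS _ (λ π α → cumP (length π) *P blockProduct π α) (setPartitions (columns μ))
    (λ π α → rep-* {x = cumCoef (length π)} (rep P.refl P.refl)
      (rep-prodS (λ B → Htilde (⊕all B)) (λ B → H (⊕all B)) π (λ B → rep-Htilde (⊕all B)) α)) α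

-- Invariance under permutations, and reduction of exponents to partitions

perm-invariant : ∀ {d F} → InΛ≤ d F → ∀ {α β} → α ↭ β → F α ≋ F β
perm-invariant {F = F} Λ p = go [] p
  where
  go : ∀ γ {α β} → α ↭ β → F (γ ++ α) ≋ F (γ ++ β)
  go γ Perm.refl = P.refl
  go γ (Perm.prep {xs} {ys} x p) = P.trans (P.reflexive (cong F (sym (Lₚ.++-assoc γ (x ∷ []) xs))))
    (P.trans (go (γ ++ x ∷ []) p) (P.reflexive (cong F (Lₚ.++-assoc γ (x ∷ []) ys))))
  go γ (Perm.swap {xs} {ys} x y p) = P.trans (swapΛ Λ γ x y xs)
    (P.trans (P.reflexive (cong F (sym (Lₚ.++-assoc γ (y ∷ x ∷ []) xs))))
      (P.trans (go (γ ++ y ∷ x ∷ []) p) (P.reflexive (cong F (Lₚ.++-assoc γ (y ∷ x ∷ []) ys)))))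
  go γ (Perm.trans p r) = P.trans (go γ p) (go γ r)

Hbar-Λ : ∀ μ → IsPartition μ → InΛ (Hbar μ)
Hbar-Λ μ p = (λ α z → scaleD≉0 μ (P.trans (P.sym (denominator (rep-Hbar μ α))) (eqP z))) ,
  (λ α → coeffs (rep-≃ (rep-Hbar μ α) (rep-Hbar μ (α ++ 0 ∷ [])) (P.sym (trailΛ (K-Λ p) α)))) ,
  (λ α β perm → coeffs (rep-≃ (rep-Hbar μ α) (rep-Hbar μ β) (perm-invariant (K-Λ p) perm))) ,
  sum μ , (λ α l → coeffs (num0-≃ {Hbar μ α} (P.trans (numerator (rep-Hbar μ α)) (degreeΛ (K-Λ p) α l))))

insertPart : ∀ x xs → Desc xs → Σ (List ℕ) λ ys → ys ↭ x ∷ xs × Desc ys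
insertPart x [] [] = x ∷ [] , Perm.refl , [] ∷ []
insertPart x (y ∷ xs) (h ∷ d) with y ℕ.≤? x
... | yes y≤x = x ∷ y ∷ xs , Perm.refl , (y≤x ∷ All.map (λ l → ℕₚ.≤-trans l y≤x) h) ∷ h ∷ d
... | no y≰x with insertPart x xs d
...   | ys , p , d' = y ∷ ys , ↭-trans (Perm.prep y p) (Perm.swap y x Perm.refl) ,
        Permₚ.All-resp-↭ (↭-sym p) (ℕₚ.<⇒≤ (ℕₚ.≰⇒> y≰x) ∷ h) ∷ d'

sort-exponent : ∀ α → Σ (List ℕ) λ ν → Σ ℕ λ k → α ↭ ν ++ replicate k 0 × All (1 ≤_) ν × Desc ν
sort-exponent [] = [] , 0 , Perm.refl , [] , []
sort-exponent (zero ∷ α) with sort-exponent α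
... | ν , k , p , ps , d = ν , suc k , ↭-trans (Perm.prep 0 p) (↭-sym (Permₚ.shift 0 ν (replicate k 0))) , ps , d
sort-exponent (suc x ∷ α) with sort-exponent α
... | ν , k , p , ps , d with insertPart (suc x) ν d
...   | ν' , p' , d' = ν' , k , ↭-trans (Perm.prep (suc x) p) (↭-sym (Permₚ.++⁺ʳ (replicate k 0) p')) ,
        Permₚ.All-resp-↭ (↭-sym p') (s≤s z≤n ∷ ps) , d'

sum-zeros : ∀ ν k → sum (ν ++ replicate k 0) ≡ sum ν
sum-zeros ν k = trans (sum-++ ν (replicate k 0)) (trans (cong (sum ν +_) (z k)) (ℕₚ.+-identityʳ _))
  where
  z : ∀ k → sum (replicate k 0) ≡ 0
  z zero = refl
  z (suc k) = z k

trailing-zeros : ∀ {d F} → InΛ≤ d F → ∀ ν k → F (ν ++ replicate k 0) ≋ F ν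
trailing-zeros {F = F} Λ ν zero = P.reflexive (cong F (Lₚ.++-identityʳ ν))
trailing-zeros {F = F} Λ ν (suc k) = P.trans (P.reflexive (cong F (sym (Lₚ.++-assoc ν (0 ∷ []) (replicate k 0)))))
  (P.trans (trailing-zeros Λ (ν ++ 0 ∷ []) k) (trailΛ Λ ν))

-- Enumeration of the partitions of bounded size

partition? : ∀ la → Dec (IsPartition la)
partition? la = All.all? (1 ℕ.≤?_) la ×-dec Linked.linked? ℕ._≥?_ la

bounded? : ∀ d la → Dec (IsPartition la × sum la ≤ d)
bounded? d la = partition? la ×-dec (sum la ℕ.≤? d)

-- A partition of size at most d has at most d parts, each at most d.
candidates : ℕ → List (List ℕ)
candidates d = concatMap (λ l → words l d) (upTo (suc d))

partitionsUpTo : ℕ → List (List ℕ)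
partitionsUpTo d = deduplicate (Lₚ.≡-dec ℕ._≟_) (filter (bounded? d) (candidates d))

partitionsUpTo-unique : ∀ d → Unique (partitionsUpTo d)
partitionsUpTo-unique d = DecUniqueₚ.deduplicate-! ℕList≟ (filter (bounded? d) (candidates d))
  where ℕList≟ = Lₚ.≡-dec ℕ._≟_

partitionsUpTo-sound : ∀ d → All (λ la → IsPartition la × sum la ≤ d) (partitionsUpTo d)
partitionsUpTo-sound d = All.tabulate (λ m → proj₂ (∈ₚ.∈-filter⁻ (bounded? d)
  {xs = candidates d} (∈ₚ.∈-deduplicate⁻ (Lₚ.≡-dec ℕ._≟_) (filter (bounded? d) (candidates d)) m)))

part-≤-sum : ∀ la → All (_≤ sum la) la
part-≤-sum [] = []
part-≤-sum (r ∷ la) = ℕₚ.m≤m+n r (sum la) ∷ All.map (λ l → ℕₚ.≤-trans l (ℕₚ.m≤n+m (sum la) r)) (part-≤-sum la)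

length-≤-sum : ∀ la → All (1 ≤_) la → length la ≤ sum la
length-≤-sum [] [] = z≤n
length-≤-sum (r ∷ la) (l ∷ h) = ℕₚ.+-mono-≤ l (length-≤-sum la h)

partitionsUpTo-complete : ∀ d la → IsPartition la → sum la ≤ d → la ∈ partitionsUpTo d
partitionsUpTo-complete d la p l = ∈ₚ.∈-deduplicate⁺ (Lₚ.≡-dec ℕ._≟_) (∈ₚ.∈-filter⁺ (bounded? d) {xs = candidates d}
  (∈ₚ.∈-concat⁺′ (words-∈ la (All.zipWith (λ { (a , b) → a , ℕₚ.≤-trans b l }) (proj₁ p , part-≤-sum la)))
    (∈ₚ.∈-map⁺ (λ l → words l d) (∈ₚ.∈-upTo⁺ (s≤s (ℕₚ.≤-trans (length-≤-sum la (proj₁ p)) l))))) (p , l))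

reduce-exponent : ∀ α → Σ (List ℕ) λ ν → Σ ℕ λ k → α ↭ ν ++ replicate k 0 × IsPartition ν × sum ν ≡ sum α
reduce-exponent α with sort-exponent α
... | ν , k , p , ps , d = ν , k , p , (ps , AllPairs⇒Linked d) , trans (sym (sum-zeros ν k)) (sum-↭ (↭-sym p))

open Elimination polyRing ≋0? ≋-domain 1≉0

-- The cofactors witness that `D` is divisible by each denominator. A new exponent ν multiplies the
-- old cofactors by its denominator, while its own cofactor is the old `D`.
common-denominator : ∀ (f : Ser) → (∀ α → ¬ den (f α) ≋ []) → ∀ νs →
  Σ Pqt λ D → Σ (List ℕ → Pqt) λ cof → ¬ D ≋ [] × All (λ ν → D ≋ den (f ν) *P cof ν) νs
common-denominator f v [] = 1P , (λ _ → []) , 1≉0 , []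
common-denominator f v (ν ∷ νs) with common-denominator f v νs
... | D , cof , D≉0 , h = den (f ν) *P D , cof' , nonzero-*P (v ν) D≉0 , first ∷ All.map rest h
  where
  cof' : List ℕ → Pqt
  cof' κ with Lₚ.≡-dec ℕ._≟_ κ ν
  ... | yes _ = D
  ... | no _ = den (f ν) *P cof κ
  first : den (f ν) *P D ≋ den (f ν) *P cof' ν
  first with Lₚ.≡-dec ℕ._≟_ ν ν
  ... | yes _ = P.refl
  ... | no ne = ⊥-elim (ne refl)
  rest : ∀ {κ} → D ≋ den (f κ) *P cof κ → den (f ν) *P D ≋ den (f κ) *P cof' κ
  rest {κ} e with Lₚ.≡-dec ℕ._≟_ κ ν
  ... | yes refl = P.refl
  ... | no _ = P.trans (P.*-congˡ {den (f ν)} e) (Laws.swap₂ (den (f ν)) (den (f κ)) (cof κ))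

-- Linear independence

module Evaluation (h : List ℕ → Ser) (k : List ℕ → Series) (s : List ℕ → Pqt)
  (rep-h : ∀ μ α → Rep (h μ α) (k μ α) (s μ)) (s≉0 : ∀ μ → ¬ s μ ≋ []) where

  eval : LinComb → Ser
  eval [] = 0S
  eval ((c , μ) ∷ L) = (c ·S h μ) +S eval L

  combineWith : Combination → Series
  combineWith L α = sumL L (λ p → proj₁ p *P k (proj₂ p) α)

  denominators : LinComb → Pqt
  denominators [] = 1P
  denominators ((c , μ) ∷ L) = (den c *P s μ) *P denominators L

  scaleAll : Pqt → Combination → Combination
  scaleAll a = map (λ p → a *P proj₁ p , proj₂ p)

  -- The coefficients over the common denominator `denominators L`: each numerator is multiplied by
  -- the denominators of all the other terms.
  clear : LinComb → Combination
  clear [] = []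
  clear ((c , μ) ∷ L) = (num c *P denominators L , μ) ∷ scaleAll (den c *P s μ) (clear L)

  combine-scaleAll : ∀ a L α → combineWith (scaleAll a L) α ≋ a *P combineWith L α
  combine-scaleAll a L α = P.trans (P.reflexive (sumL-map (λ p → a *P proj₁ p , proj₂ p) L (λ p → proj₁ p *P k (proj₂ p) α)))
    (P.trans (sumL-cong L (λ p → P.*-assoc a (proj₁ p) (k (proj₂ p) α))) (sumL-*ˡ a L (λ p → proj₁ p *P k (proj₂ p) α)))

  clear-keys : ∀ L → map proj₂ (clear L) ≡ map proj₂ L
  clear-keys [] = refl
  clear-keys ((c , μ) ∷ L) = cong (μ ∷_) (trans (sym (Lₚ.map-∘ (clear L))) (clear-keys L))

  rep-eval : ∀ L α → Rep (eval L α) (combineWith (clear L) α) (denominators L)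
  rep-eval [] α = rep P.refl P.refl
  rep-eval ((c , μ) ∷ L) α = rep-fraction (num c) (den c) (rep-h μ α) (rep-eval L α)
    (combine-scaleAll (den c *P s μ) (clear L) α)

  denominators≉0 : ∀ L → All (λ p → ValidQ (proj₁ p)) L → ¬ denominators L ≋ []
  denominators≉0 [] [] = 1≉0
  denominators≉0 ((c , μ) ∷ L) (v ∷ vs) = nonzero-*P {den c *P s μ} {denominators L} (nonzero-*P {den c} {s μ} (λ z → v (coeffs z)) (s≉0 μ)) (denominators≉0 L vs)

  unclear : ∀ L → All (λ p → ValidQ (proj₁ p)) L → All (λ p → proj₁ p ≋ []) (clear L) → All (λ p → num (proj₁ p) ≋ []) L
  unclear [] [] [] = []
  unclear ((c , μ) ∷ L) (v ∷ vs) (h ∷ hs) = ≋-domain {num c} {denominators L} h (denominators≉0 L vs) ∷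
    unclear L vs (All.map (λ {p} z → ≋-domain {proj₁ p} {a} (P.trans (P.*-comm (proj₁ p) a) z) a≉0) (Allₚ.map⁻ hs))
    where
    a = den c *P s μ
    a≉0 : ¬ a ≋ []
    a≉0 = nonzero-*P {den c} {s μ} (λ z → v (coeffs z)) (s≉0 μ)

  -- The factor `s μ` cancels the denominator of `h μ`, which is `k μ` divided by `s μ`.
  quotients : Pqt → Combination → LinComb
  quotients S = map (λ p → (proj₁ p *P s (proj₂ p)) / S , proj₂ p)

  frac-eval : ∀ S → ¬ S ≋ [] → ∀ L α → Frac (eval (quotients S L) α) (combineWith L α) S
  frac-eval S S≉0 [] α = frac 1≉0 P.refl
  frac-eval S S≉0 ((C , μ) ∷ L) α = frac-fraction C S S≉0 (s≉0 μ) (rep-h μ α) (frac-eval S S≉0 L α)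

  -- Spanning

  module Span (Λk : ∀ {μ} → IsPartition μ → InΛ≤ (sum μ) (k μ))
    (independent : ∀ L → All (λ p → IsPartition (proj₂ p)) L → Unique (map proj₂ L) → (∀ α → combineWith L α ≋ []) →
      All (λ p → proj₁ p ≋ []) L) where

    -- Vectors and test exponents are both the partitions of size at most d, so the system is
    -- square. A dependence at these exponents extends to all exponents by symmetry, trailing zeros
    -- and degree, against `independent`; hence the values of `f` can be interpolated, and the same
    -- three properties extend the agreement.
    span : ∀ f → InΛ f →
      Σ LinComb (λ L → All (λ p → IsPartition (proj₂ p)) L × All (λ p → ValidQ (proj₁ p)) L × (∀ α → eval L α ≃ f α))
    span f (f-valid , f-trail , f-perm , d , f-degree) = [ (λ dep → ⊥-elim (no-relation dep)) , (λ sp → build (sp w)) ]′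
        (gauss Ps Ps k ℕₚ.≤-refl)
      where
      Ps = partitionsUpTo d
      f≉0 : ∀ α → ¬ den (f α) ≋ []
      f≉0 α = f-valid α ∘ coeffs
      denom = common-denominator f f≉0 Ps
      Dc = proj₁ denom
      cof = proj₁ (proj₂ denom)
      Dc≉0 = proj₁ (proj₂ (proj₂ denom))
      w : List ℕ → Pqt
      -- This is `Dc` times the value `f ν`, as the elimination takes polynomial targets.
      w ν = num (f ν) *P cof ν

      parts-of : ∀ {L : Combination} → map proj₂ L ↭ Ps → All (λ p → IsPartition (proj₂ p) × sum (proj₂ p) ≤ d) L
      parts-of perm = Allₚ.map⁻ (Permₚ.All-resp-↭ (↭-sym perm) (partitionsUpTo-sound d))

      combine-high : ∀ {L : Combination} → map proj₂ L ↭ Ps → ∀ α → d < sum α → combineWith L α ≋ []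
      combine-high perm α l = sumL-zero-All (All.map (λ { {C , μ} (p , le) →
        P.trans (P.*-congˡ {C} (degreeΛ (Λk p) α (ℕₚ.≤-<-trans le l))) (P.zeroʳ C) }) (parts-of perm))

      combine-reduce : ∀ {L : Combination} → map proj₂ L ↭ Ps → ∀ {α ν} m → α ↭ ν ++ replicate m 0 → combineWith L α ≋ combineWith L ν
      combine-reduce perm {α} {ν} m e = sumL-cong-All (All.map (λ { {C , μ} (p , _) →
        P.*-congˡ {C} (P.trans (perm-invariant (Λk p) e) (trailing-zeros (Λk p) ν m)) }) (parts-of perm))

      no-relation : Dependent k Ps Ps → ⊥
      no-relation (L , perm , nz , h) = contradict nz (independent L (All.map proj₁ (parts-of perm))
        (unique-↭ (↭-sym perm) (partitionsUpTo-unique d)) relation)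
        where
        relation : ∀ α → combineWith L α ≋ []
        relation α with sum α ℕ.≤? d
        ... | no nl = combine-high perm α (ℕₚ.≰⇒> nl)
        ... | yes l with reduce-exponent α
        ...   | ν , m , e , p , es = P.trans (combine-reduce perm m e)
                  (All.lookup h (partitionsUpTo-complete d ν p (subst (_≤ d) (sym es) l)))
        contradict : ∀ {L : Combination} → Any (λ p → ¬ proj₁ p ≋ []) L → All (λ p → proj₁ p ≋ []) L → ⊥
        contradict (here n) (z ∷ _) = n z
        contradict (there n) (_ ∷ zs) = contradict n zs

      f-zeros : ∀ ν m → f (ν ++ replicate m 0) ≃ f ν
      f-zeros ν zero rewrite Lₚ.++-identityʳ ν = P.refl
      f-zeros ν (suc m) rewrite sym (Lₚ.++-assoc ν (0 ∷ []) (replicate m 0)) =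
        ≃-trans {f ((ν ++ 0 ∷ []) ++ replicate m 0)} {f (ν ++ 0 ∷ [])} {f ν} (f≉0 (ν ++ 0 ∷ [])) (f-zeros (ν ++ 0 ∷ []) m) (P.sym (eqP (f-trail ν)))

      build : (Σ Pqt λ D → Σ Combination λ L → map proj₂ L ↭ Ps × ¬ D ≋ [] × All (λ ν → D *P w ν ≋ comb k L ν) Ps) →
        Σ LinComb (λ L → All (λ p → IsPartition (proj₂ p)) L × All (λ p → ValidQ (proj₁ p)) L × (∀ α → eval L α ≃ f α))
      build (D , L , perm , D≉0 , h) = quotients S L ,
        Allₚ.map⁺ (All.map proj₁ (parts-of perm)) ,
        Allₚ.map⁺ (All.universal (λ _ z → S≉0 (eqP z)) L) ,
        agrees
        where
        -- `Dc` clears the denominators of `f`, and `D` is the multiplier that the elimination needs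
        -- in place of division.
        S = D *P Dc
        S≉0 = nonzero-*P D≉0 Dc≉0
        E : Ser
        E = eval (quotients S L)
        agrees : ∀ α → E α ≃ f α
        agrees α with sum α ℕ.≤? d | frac-eval S S≉0 L α
        ... | no nl | frac v e = P.trans (P.*-congʳ {den (f α)} E≈0)
                (P.sym (P.*-congʳ {den (E α)} (≃-num0 {f α} (eqP (f-degree α (ℕₚ.≰⇒> nl))))))
          where
          E≈0 : num (E α) ≋ []
          E≈0 = ≋-domain (P.trans e (P.*-congʳ {den (E α)} (combine-high perm α (ℕₚ.≰⇒> nl)))) S≉0
        ... | yes l | frac v e with reduce-exponent α
        ...   | ν , m , r , p , es = ≃-trans {E α} {f ν} {f α} (f≉0 ν) at-ν
                  (P.sym (≃-trans {f α} {f (ν ++ replicate m 0)} {f ν} (f≉0 (ν ++ replicate m 0)) (eqP (f-perm α _ r)) (f-zeros ν m)))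
          where
          open import Relation.Binary.Reasoning.Setoid P.setoid
          ν∈ : ν ∈ Ps
          ν∈ = partitionsUpTo-complete d ν p (subst (_≤ d) (sym es) l)
          Dc≈ : Dc ≋ den (f ν) *P cof ν
          Dc≈ = All.lookup (proj₂ (proj₂ (proj₂ denom))) ν∈
          unit≉0 : ¬ D *P cof ν ≋ []
          unit≉0 = nonzero-*P D≉0 (λ z → Dc≉0 (P.trans Dc≈ (P.trans (P.*-congˡ {den (f ν)} z) (P.zeroʳ (den (f ν))))))
          at-ν : E α ≃ f ν
          -- Multiplication by `D *P cof ν` turns the denominator of `f ν` into `S` and its
          -- numerator into `D *P w ν`, the two sides of the interpolation.
          at-ν = cancelʳ unit≉0 (begin
            (num (E α) *P den (f ν)) *P (D *P cof ν) ≈⟨ Laws.quotient (num (E α)) (den (f ν)) D (cof ν) ⟩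
            num (E α) *P (D *P (den (f ν) *P cof ν)) ≈⟨ P.*-congˡ {num (E α)} (P.*-congˡ {D} (P.sym Dc≈)) ⟩
            num (E α) *P S ≈⟨ e ⟩
            combineWith L α *P den (E α) ≈⟨ P.*-congʳ {den (E α)} (P.trans (combine-reduce perm m r) (P.sym (All.lookup h ν∈))) ⟩
            (D *P w ν) *P den (E α) ≈⟨ Laws.quotient' D (num (f ν)) (cof ν) (den (E α)) ⟩
            (num (f ν) *P den (E α)) *P (D *P cof ν) ∎)

-- Specialisation to the fully colored Macdonald polynomials

open Evaluation Hbar K scaleD rep-Hbar scaleD≉0

evalLC-eval : ∀ L α → evalLC L α ≡ eval L α
evalLC-eval [] α = refl
evalLC-eval ((c , μ) ∷ L) α = cong ((c *Q Hbar μ α) +Q_) (evalLC-eval L α)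

Hbar-independent : ∀ L → All (λ p → IsPartition (proj₂ p)) L → Unique (map proj₂ L) →
  All (λ p → ValidQ (proj₁ p)) L → evalLC L ≈S 0S → All (λ p → proj₁ p ≈Q 0Q) L
Hbar-independent L parts distinct valid zero-sum = All.map (λ {p} z → coeffs (num0-≃ {proj₁ p} z)) (unclear L valid
  (Independence.independent (clear L)
    (Allₚ.map⁻ (subst (All IsPartition) (sym (clear-keys L)) (Allₚ.map⁺ parts)))
    (subst Unique (sym (clear-keys L)) distinct)
    (λ α → P.trans (P.sym (numerator (rep-eval L α))) (≃-num0 {eval L α} (eqP (subst (_≈Q 0Q) (evalLC-eval L α) (zero-sum α)))))))

Hbar-spans : ∀ f → InΛ f →
  Σ LinComb (λ L → All (λ p → IsPartition (proj₂ p)) L × All (λ p → ValidQ (proj₁ p)) L × (evalLC L ≈S f))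
Hbar-spans f Λf = transfer (Span.span K-Λ Independence.independent f Λf)
  where
  transfer : Σ LinComb (λ L → All (λ p → IsPartition (proj₂ p)) L × All (λ p → ValidQ (proj₁ p)) L × (∀ α → eval L α ≃ f α)) →
    Σ LinComb (λ L → All (λ p → IsPartition (proj₂ p)) L × All (λ p → ValidQ (proj₁ p)) L × (evalLC L ≈S f))
  transfer (L , parts , valid , agrees) = L , parts , valid ,
    λ α → subst (_≈Q f α) (sym (evalLC-eval L α)) (coeffs (agrees α))

theorem7p2 : ((μ : List ℕ) → IsPartition μ → InΛ (Hbar μ)) ×
    ((L : LinComb) → All (λ p → IsPartition (proj₂ p)) L → Unique (map proj₂ L) →
    All (λ p → ValidQ (proj₁ p)) L → evalLC L ≈S 0S →
    All (λ p → proj₁ p ≈Q 0Q) L) ×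
    ((f : Ser) → InΛ f →
    Σ LinComb (λ L → All (λ p → IsPartition (proj₂ p)) L ×
    All (λ p → ValidQ (proj₁ p)) L × (evalLC L ≈S f)))
theorem7p2 = Hbar-Λ , Hbar-independent , Hbar-spans
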